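{- Let $n$ and $d$ be positive integers such that $n \equiv 1 \bmod d$. Then, in the Hopf algebra $\mathcal{P}$ of bounded posets, the antipode of the $d$-indivisible noncrossing partition poset $\mathrm{NC}^{d}_{n}$ is given by $$S(\mathrm{NC}^{d}_{n}) = \sum_{T} (-1)^{|T|} \cdot \prod_{E \in T} \mathrm{NC}^{d}_{|E|},$$ where $T$ ranges over all noncrossing hypertrees on the set $[n]$ such that each edge $E$ of $T$ satisfies $|E| \equiv 1 \bmod d$, and $|T|$ denotes the number of edges of $T$.
   Context: Noncrossing partitions: a partition of $[n]=\{1,\dots,n\}$ is noncrossing if there are no $i<j<k<\ell$ with $i,k$ in one block and $j,\ell$ in a different block. $\mathrm{NC}_n$ is the set of noncrossing partitions of $[n]$ ordered by refinement. Kreweras dual: place the symbols $1,1',2,2',\dots,n,n'$ on a circle in this cyclic order; the Kreweras dual $\pi'$ of $\pi\in\mathrm{NC}_n$ is the coarsest partition of $\{1',\dots,n'\}$ such that the blocks of $\pi$ together with the blocks of $\pi'$ form a noncrossing partition of the $2n$ points in this cyclic order. A noncrossing partition $\pi\in\mathrm{NC}_n$ is $d$-indivisible if every block of $\pi$ and every block of $\pi'$ has cardinality congruent to $1$ modulo $d$; $\mathrm{NC}^d_n$ is the subposet of $\mathrm{NC}_n$ of $d$-indivisible noncrossing partitions (ordered by refinement). The Hopf algebra $\mathcal{P}$ is the linear span of isomorphism classes of finite posets with a minimum $\hat 0$ and maximum $\hat 1$, with product given by Cartesian product of posets and coproduct $\Delta(P)=\sum_{\hat0\le x\le\hat1}[\hat0,x]\otimes[x,\hat1]$;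 $S$ denotes its antipode (equivalently $S(P)=\sum_{k\ge0}\sum_{\hat0=x_0<x_1<\cdots<x_k=\hat1}(-1)^k[x_0,x_1]\cdots[x_{k-1},x_k]$). A hypergraph on vertex set $V$ is a collection of subsets (edges) of $V$, each of cardinality at least $2$; it is connected if any two vertices are joined by a sequence of edges with consecutive edges intersecting; a connected hypergraph is a hypertree if $\sum_E(|E|-1)=|V|-1$. A hypergraph on $[n]$ is noncrossing if no two distinct edges $E,F$ admit $i<j<k<\ell$ with $i,k\in E$ and $j,\ell\in F$. -}

module Defs where

-- Conventions:
--  * A finite poset is represented concretely by its number of elements and a
--    Boolean order relation on Fin size.  Elements of the Hopf algebra P are
--    represented by formal Z-linear combinations (lists of coefficient/poset
--    pairs); two such combinations are equal in P iff they agree under every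
--    isomorphism-invariant Z-valued function on finite posets.
--  * A set partition of [n] is represented by its "same block" relation,
--    an n×n Boolean matrix that is reflexive, symmetric and transitive.
--  * Points 1..n are Fin n (0-based); a subset of [n] is a Vec Bool n.

open import Data.Bool using (Bool; true; false; _∧_; _∨_; not; if_then_else_)
open import Data.Nat as ℕ using (ℕ; zero; suc; _∸_; _<ᵇ_; _≡ᵇ_; _≤ᵇ_)
open import Data.Nat.Divisibility using (_∣?_)
open import Data.Fin as Fin using (Fin; toℕ; remQuot)
open import Data.Fin.Properties using () renaming (_≟_ to _≟ᶠ_)
open import Data.Vec as Vec using (Vec; []; _∷_)
open import Data.List as List using (List; []; _∷_; _++_; map; concatMap; filterᵇ; allFin; length; foldr)
open import Data.Bool.ListAction using (all; any)
open import Data.Nat.ListAction using (sum)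
open import Data.Product using (_×_; _,_; Σ; proj₁; proj₂)
open import Data.Integer as ℤ using (ℤ; +_; -_)
open import Relation.Nullary using (does)
open import Data.Vec.Properties using (≡-dec)
import Data.Bool.Properties as Bool
open import Relation.Binary.PropositionalEquality using (_≡_)

allVecs : ∀ {a} {A : Set a} → List A → (n : ℕ) → List (Vec A n)
allVecs xs zero    = [] ∷ []
allVecs xs (suc n) = concatMap (λ x → map (x ∷_) (allVecs xs n)) xs

bools : List Bool
bools = false ∷ true ∷ []

sublists : ∀ {a} {A : Set a} → List A → List (List A)
sublists []       = [] ∷ []
sublists (x ∷ xs) = sublists xs ++ map (x ∷_) (sublists xs)

_⇒ᵇ_ : Bool → Bool → Bool
a ⇒ᵇ b = not a ∨ b

_≟ᵇ_ : ∀ {m} → Fin m → Fin m → Bool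
i ≟ᵇ j = does (i ≟ᶠ j)

_<ᶠ_ : ∀ {m} → Fin m → Fin m → Bool
i <ᶠ j = toℕ i <ᵇ toℕ j

-- k ≡ 1 (mod d), for k ≥ 1
≡1mod : ℕ → ℕ → Bool
≡1mod d k = does (d ∣? (k ∸ 1))

countᶠ : ∀ m → (Fin m → Bool) → ℕ
countᶠ m p = length (filterᵇ p (allFin m))

noncrossingᵇ : ∀ m → (Fin m → Fin m → Bool) → Bool
noncrossingᵇ m R =
  all (λ a → all (λ b → all (λ c → all (λ e →
    ((a <ᶠ b) ∧ (b <ᶠ c) ∧ (c <ᶠ e) ∧ R a c ∧ R b e) ⇒ᵇ R a b)
    (allFin m)) (allFin m)) (allFin m)) (allFin m)

Rel : ℕ → Set
Rel n = Vec (Vec Bool n) n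

rel : ∀ {n} → Rel n → Fin n → Fin n → Bool
rel M i j = Vec.lookup (Vec.lookup M i) j

isEquivalenceᵇ : ∀ n → Rel n → Bool
isEquivalenceᵇ n M =
  all (λ i → rel M i i) (allFin n) ∧
  all (λ i → all (λ j → rel M i j ⇒ᵇ rel M j i) (allFin n)) (allFin n) ∧
  all (λ i → all (λ j → all (λ k → (rel M i j ∧ rel M j k) ⇒ᵇ rel M i k)
    (allFin n)) (allFin n)) (allFin n)

partitions : ∀ n → List (Rel n)
partitions n = filterᵇ (isEquivalenceᵇ n) (allVecs (allVecs bools n) n)

refinesᵇ : ∀ n → Rel n → Rel n → Bool
refinesᵇ n π σ = all (λ i → all (λ j → rel π i j ⇒ᵇ rel σ i j) (allFin n)) (allFin n)

-- the partition of the 2n points 1,1',2,2',...,n,n' (in this order) whose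
-- blocks are the blocks of π (on unprimed points) and of σ (on primed points)
combined : ∀ n → Rel n → Rel n → Fin (n ℕ.* 2) → Fin (n ℕ.* 2) → Bool
combined n π σ p q with remQuot {n} 2 p | remQuot {n} 2 q
... | i , Fin.zero     | j , Fin.zero     = rel π i j
... | i , Fin.suc Fin.zero | j , Fin.suc Fin.zero = rel σ i j
... | _ , _ | _ , _ = false

compatibleᵇ : ∀ n → Rel n → Rel n → Bool
compatibleᵇ n π σ = noncrossingᵇ (n ℕ.* 2) (combined n π σ)

isKrewerasDualᵇ : ∀ n → Rel n → Rel n → Bool
isKrewerasDualᵇ n π σ =
  compatibleᵇ n π σ ∧
  all (λ τ → compatibleᵇ n π τ ⇒ᵇ refinesᵇ n τ σ) (partitions n)

blocks≡1modᵇ : ∀ n → ℕ → Rel n → Bool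
blocks≡1modᵇ n d π = all (λ i → ≡1mod d (countᶠ n (rel π i))) (allFin n)

isNoncrossingPartitionᵇ : ∀ n → Rel n → Bool
isNoncrossingPartitionᵇ n π = noncrossingᵇ n (rel π)

isIndivisibleNCᵇ : ∀ n → ℕ → Rel n → Bool
isIndivisibleNCᵇ n d π =
  isNoncrossingPartitionᵇ n π ∧ blocks≡1modᵇ n d π ∧
  any (λ σ → isKrewerasDualᵇ n π σ ∧ blocks≡1modᵇ n d σ) (partitions n)

record FinPoset : Set where
  constructor finPoset
  field
    size : ℕ
    leq  : Fin size → Fin size → Bool
open FinPoset public

record _≅_ (P Q : FinPoset) : Set where
  field
    to      : Fin (size P) → Fin (size Q)
    from    : Fin (size Q) → Fin (size P)
    from∘to : ∀ x → from (to x) ≡ x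
    to∘from : ∀ y → to (from y) ≡ y
    pres    : ∀ x y → leq P x y ≡ leq Q (to x) (to y)

unitPoset : FinPoset
unitPoset = finPoset 1 (λ _ _ → true)

_⊗_ : FinPoset → FinPoset → FinPoset
P ⊗ Q = finPoset (size P ℕ.* size Q) le
  where
  le : Fin (size P ℕ.* size Q) → Fin (size P ℕ.* size Q) → Bool
  le a b with remQuot {size P} (size Q) a | remQuot {size P} (size Q) b
  ... | a₁ , a₂ | b₁ , b₂ = leq P a₁ b₁ ∧ leq Q a₂ b₂

prodPosets : List FinPoset → FinPoset
prodPosets = foldr _⊗_ unitPoset

listPoset : ∀ {A : Set} → (A → A → Bool) → List A → FinPoset
listPoset le xs = finPoset (length xs) (λ i j → le (List.lookup xs i) (List.lookup xs j))

interval : (P : FinPoset) → Fin (size P) → Fin (size P) → FinPoset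
interval P x y = listPoset (leq P) (filterᵇ (λ z → leq P x z ∧ leq P z y) (allFin (size P)))

FormalSum : Set
FormalSum = List (ℤ × FinPoset)

sign : ℕ → ℤ
sign zero    = + 1
sign (suc k) = - sign k

IsoInvariant : (FinPoset → ℤ) → Set
IsoInvariant φ = ∀ P Q → P ≅ Q → φ P ≡ φ Q

evalSum : (FinPoset → ℤ) → FormalSum → ℤ
evalSum φ = foldr (λ t acc → proj₁ t ℤ.* φ (proj₂ t) ℤ.+ acc) (+ 0)

-- equality in the Hopf algebra P (free Z-module on isomorphism classes)
_≈P_ : FormalSum → FormalSum → Set
s ≈P t = ∀ (φ : FinPoset → ℤ) → IsoInvariant φ → evalSum φ s ≡ evalSum φ t

module _ (P : FinPoset) where
  private
    n = size P
    _<P_ : Fin n → Fin n → Bool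
    x <P y = leq P x y ∧ not (x ≟ᵇ y)
    isTop isBot : Fin n → Bool
    isTop x = all (λ z → leq P z x) (allFin n)
    isBot x = all (λ z → leq P x z) (allFin n)

  -- chains x = x₀ < x₁ < ⋯ < x_k = 1̂ (at most `fuel` steps), recorded as
  -- (k , [x₀,x₁] ∷ ⋯ ∷ [x_{k-1},x_k])
  chainsFrom : ℕ → Fin n → List (ℕ × List FinPoset)
  chainsFrom fuel x =
    (if isTop x then (0 , []) ∷ [] else []) ++ step fuel
    where
    step : ℕ → List (ℕ × List FinPoset)
    step zero     = []
    step (suc f)  = concatMap (λ y → if x <P y
      then map (λ c → suc (proj₁ c) , interval P x y ∷ proj₂ c) (chainsFrom f y)
      else []) (allFin n)

  -- S(P) = Σ_k Σ_{0̂ = x₀ < ⋯ < x_k = 1̂} (-1)^k [x₀,x₁] ⋯ [x_{k-1},x_k]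
  -- (a strict chain has at most size P steps, so fuel size P suffices)
  antipode : FormalSum
  antipode = concatMap (λ x → if isBot x
    then map (λ c → sign (proj₁ c) , prodPosets (proj₂ c)) (chainsFrom n x)
    else []) (allFin n)

indivisibleNCs : (n d : ℕ) → List (Rel n)
indivisibleNCs n d = filterᵇ (isIndivisibleNCᵇ n d) (partitions n)

NCd : (n d : ℕ) → FinPoset
NCd n d = listPoset (refinesᵇ n) (indivisibleNCs n d)

Edge : ℕ → Set
Edge n = Vec Bool n

Hypergraph : ℕ → Set
Hypergraph n = List (Edge n)

∣_∣ₑ : ∀ {n} → Edge n → ℕ
∣_∣ₑ {n} E = countᶠ n (Vec.lookup E)

-- all hypergraphs on [n] (sets of edges, each edge of cardinality ≥ 2),
-- each listed once, edges without repetition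
hypergraphs : ∀ n → List (Hypergraph n)
hypergraphs n = sublists (filterᵇ (λ E → 2 ≤ᵇ ∣ E ∣ₑ) (allVecs bools n))

module _ {n : ℕ} (H : Hypergraph n) where
  private
    meets : Edge n → (Fin n → Bool) → Bool
    meets E S = any (λ v → Vec.lookup E v ∧ S v) (allFin n)
    grow : (Fin n → Bool) → Fin n → Bool
    grow S v = S v ∨ any (λ E → meets E S ∧ Vec.lookup E v) H
    iter : ℕ → (Fin n → Bool) → Fin n → Bool
    iter zero    S = S
    iter (suc k) S = iter k (grow S)

  -- vertices joined to i by a sequence of edges (paths of length ≤ n suffice)
  reachable : Fin n → Fin n → Bool
  reachable i = iter n (λ v → v ≟ᵇ i)

  isConnectedᵇ : Bool
  isConnectedᵇ = all (λ i → all (λ j → reachable i j) (allFin n)) (allFin n)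

  isHypertreeᵇ : Bool
  isHypertreeᵇ = isConnectedᵇ ∧ (sum (map (λ E → ∣ E ∣ₑ ∸ 1) H) ≡ᵇ n ∸ 1)

  isNoncrossingHypergraphᵇ : Bool
  isNoncrossingHypergraphᵇ =
    all (λ E → all (λ F → not (does (≡-dec Bool._≟_ E F)) ⇒ᵇ
      all (λ i → all (λ j → all (λ k → all (λ l →
        not ((i <ᶠ j) ∧ (j <ᶠ k) ∧ (k <ᶠ l) ∧
             Vec.lookup E i ∧ Vec.lookup E k ∧ Vec.lookup F j ∧ Vec.lookup F l))
        (allFin n)) (allFin n)) (allFin n)) (allFin n)) H) H

ncHypertrees : (n d : ℕ) → List (Hypergraph n)
ncHypertrees n d = filterᵇ (λ T → isHypertreeᵇ T ∧ isNoncrossingHypergraphᵇ T ∧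
  all (λ E → ≡1mod d ∣ E ∣ₑ) T) (hypergraphs n)

hypertreeSum : (n d : ℕ) → FormalSum
hypertreeSum n d = map (λ T → sign (length T) , prodPosets (map (λ E → NCd ∣ E ∣ₑ d) T))
  (ncHypertrees n d)

-- Identify the primed point i′ with i, and for noncrossing x ≤ y let x⁻¹y be the relation y ∧ K(x), the
-- Kreweras dual of x inside the blocks of y.  The identity rank x + rank (x⁻¹y) = rank y makes z ↦ x⁻¹z
-- an isomorphism from [x,y] onto the partitions below x⁻¹y; it also shows that d-indivisibility is passed
-- on, so that [x,y] is the product of the posets NCᵈ of the blocks of x⁻¹y.  Consider noncrossing forests
-- spanning the blocks of K(x).  Adding the nontrivial blocks of x⁻¹y to such a forest T′ for y gives a
-- forest T for x in which the added edges are minimal (at each of their vertices they come last in the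
-- cyclic order), and (y,T′) ↦ (T,A) is a bijection onto the pairs of a forest T for x and a set A of minimal
-- edges of T.  Every nonempty forest has a minimal edge, by counting incidences, so that
-- ∑ (-1)^|A| = 0 over the A ⊆ min T.  Hence the signed forest sums satisfy the recursion of the antipode;
-- for x = 0̂ the forests are the noncrossing hypertrees.
module Submission where

open import Defs
open import Data.Bool using (Bool; true; false; _∧_; _∨_; not; _xor_; if_then_else_; T)
import Data.Bool.Properties as Boolₚ
open import Data.Nat using (ℕ; zero; suc; _+_; _*_; _∸_; _≤_; _<_; z≤n; s≤s; _≤?_; _<?_; _<ᵇ_; _≤ᵇ_)
open import Data.Nat.Properties
open import Data.Nat.Induction using (<-wellFounded)
open import Induction.WellFounded using (Acc; acc)
open import Data.Nat.Divisibility using (_∣_; _∣?_; divides; ∣m∣n⇒∣m+n; ∣m+n∣m⇒∣n; _∣0; n∣m*n)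
open import Data.Nat.Solver using (module +-*-Solver)
open import Data.Fin using (Fin; toℕ; fromℕ<; remQuot; combine) renaming (_<_ to _≺_; _≤_ to _≼_)
open import Data.Fin.Properties using (toℕ-injective; toℕ<n; any?; all?; remQuot-combine; combine-remQuot; toℕ-combine; toℕ-fromℕ<) renaming (_≟_ to _≟ᶠ_)
open import Data.List using (List; []; _∷_; _++_; map; length; filter; filterᵇ; allFin; concatMap; lookup; cartesianProductWith)
open import Data.List.Membership.Propositional using (_∈_; find; lose)
open import Data.List.Membership.Propositional.Properties using (∈-filter⁺; ∈-filter⁻; ∈-map⁺; ∈-map⁻; ∈-allFin; ∈-++⁺ˡ; ∈-++⁺ʳ; ∈-++⁻; ∈-cartesianProductWith⁺; ∈-lookup)
open import Data.List.Relation.Unary.Any using (Any; here; there; index)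
open import Data.List.Relation.Unary.Any.Properties using (lookup-index)
open import Data.List.Relation.Unary.All as All using (All; []; _∷_)
open import Data.List.Relation.Unary.Unique.Propositional using (Unique)
open import Data.Product using (∃; _×_; _,_; proj₁; proj₂; ∃-syntax; uncurry)
open import Data.Sum using (_⊎_; inj₁; inj₂; [_,_]′)
open import Data.Empty using (⊥; ⊥-elim)
open import Data.Unit using (⊤; tt)
open import Function using (_∘_; id)
open import Relation.Nullary using (¬_; Dec; yes; no; does; contradiction)
open import Relation.Nullary.Decidable using (_×-dec_; _⊎-dec_; _→-dec_; ¬?; map′; decidable-stable)
open import Relation.Binary.PropositionalEquality using (_≡_; _≢_; refl; sym; trans; cong; cong₂; subst; subst₂; module ≡-Reasoning)
open import Data.List.Relation.Unary.Unique.Propositional.Properties using (allFin⁺; filter⁺; ++⁺; map⁺; cartesianProductWith⁺)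
open import Data.List.Properties using (length-++; length-tabulate; map-tabulate; tabulate-lookup)
open import Relation.Binary using (IsEquivalence)
open import Data.Vec as Vec using (Vec; []; _∷_)
open import Data.List.Relation.Unary.AllPairs using (AllPairs; []; _∷_)
import Data.List.Relation.Unary.AllPairs.Properties as AllPairs
open import Data.Vec.Properties using (tabulate∘lookup; lookup∘tabulate; tabulate-cong; ≡-dec)
open import Data.List.Relation.Binary.Permutation.Propositional using (_↭_; ↭-sym; ↭-trans; prep; swap) renaming (refl to ↭-refl; trans to ↭-step)
open import Data.List.Relation.Binary.Permutation.Propositional.Properties using (∈-resp-↭; shift; ↭-length)
open import Data.List.Relation.Binary.BagAndSetEquality using (∼bag⇒↭)
open import Data.List.Membership.Propositional.Properties.WithK using (unique∧set⇒bag)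
open import Function.Bundles using (mk⇔)
import Data.List.Relation.Unary.Any as Any
open import Data.Bool.ListAction using (all; any)
open import Data.Nat.ListAction using (sum)
import Data.List.Membership.DecPropositional as DecMembership
open import Data.Integer using (ℤ; -_; 0ℤ; 1ℤ) renaming (_+_ to _+ᶻ_; _*_ to _*ᶻ_)
import Data.Integer.Properties as ℤₚ

-- Sums and counting

-- The rank identity controls only sums over blocks, whereas indivisibility of x⁻¹y concerns every
-- block separately; this is the main obstacle. It is overcome by following positions modulo d. For
-- indivisible y, the identity on suitable intervals of [n] shows that consecutive elements a < b of
-- a block satisfy b ≡ a + 1 and that the largest element of a block is ≡ the least one. Passing to
-- the successor in x⁻¹y means one cyclic step forward in y and one backward in x, so that along a
-- block of x⁻¹y each ascending step again adds 1 and the last position is ≡ the first; hence the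
-- size is ≡ 1. The reverse transfer, from x and x⁻¹z to z, needs only the identity inside one block
-- of z. Equalities between partitions are mostly obtained from one inclusion and a comparison of
-- ranks. Finally, an invariant φ of posets need not be multiplicative; the recursion over chains
-- therefore absorbs the first interval into φ, and the comparison with forests is made for all φ at
-- once.

variable
  A B : Set
  n : ℕ

≡-iff : ∀ {a b : Bool} → (a ≡ true → b ≡ true) → (b ≡ true → a ≡ true) → a ≡ b
≡-iff {true}  {b}     h k = sym (h refl)
≡-iff {false} {true}  h k = k refl
≡-iff {false} {false} h k = refl

∑ : (A → ℕ) → List A → ℕ
∑ f []       = 0
∑ f (x ∷ xs) = f x + ∑ f xs

∑-mono : ∀ {f g : A → ℕ} xs → (∀ x → x ∈ xs → f x ≤ g x) → ∑ f xs ≤ ∑ g xs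
∑-mono []       h = z≤n
∑-mono (x ∷ xs) h = +-mono-≤ (h x (here refl)) (∑-mono xs λ y m → h y (there m))

∑-cong : ∀ {f g : A → ℕ} xs → (∀ x → x ∈ xs → f x ≡ g x) → ∑ f xs ≡ ∑ g xs
∑-cong []       h = refl
∑-cong (x ∷ xs) h = cong₂ _+_ (h x (here refl)) (∑-cong xs λ y m → h y (there m))

∑-mono-< : ∀ {f g : A → ℕ} {xs y} → (∀ x → x ∈ xs → f x ≤ g x) → y ∈ xs → f y < g y → ∑ f xs < ∑ g xs
∑-mono-< {xs = x ∷ xs} h (here refl) lt = +-mono-<-≤ lt (∑-mono xs λ y m → h y (there m))
∑-mono-< {xs = x ∷ xs} h (there m)   lt = +-mono-≤-< (h x (here refl)) (∑-mono-< (λ y m′ → h y (there m′)) m lt)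

∑-+ : ∀ (f g : A → ℕ) xs → ∑ (λ x → f x + g x) xs ≡ ∑ f xs + ∑ g xs
∑-+ f g []       = refl
∑-+ f g (x ∷ xs) = begin
  f x + g x + ∑ (λ y → f y + g y) xs ≡⟨ cong (f x + g x +_) (∑-+ f g xs) ⟩
  f x + g x + (∑ f xs + ∑ g xs)      ≡⟨ solve 4 (λ a b c d → a :+ b :+ (c :+ d) := a :+ c :+ (b :+ d)) refl (f x) (g x) (∑ f xs) (∑ g xs) ⟩
  f x + ∑ f xs + (g x + ∑ g xs)      ∎
  where open ≡-Reasoning
        open +-*-Solver

∑-zero : ∀ {f : A → ℕ} xs → (∀ x → x ∈ xs → f x ≡ 0) → ∑ f xs ≡ 0
∑-zero []       h = refl
∑-zero (x ∷ xs) h = cong₂ _+_ (h x (here refl)) (∑-zero xs λ y m → h y (there m))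

∑-swap : ∀ (f : A → B → ℕ) xs ys → ∑ (λ x → ∑ (f x) ys) xs ≡ ∑ (λ y → ∑ (λ x → f x y) xs) ys
∑-swap f []       ys = sym (∑-zero ys λ _ _ → refl)
∑-swap f (x ∷ xs) ys = trans (cong (∑ (f x) ys +_) (∑-swap f xs ys)) (sym (∑-+ (f x) (λ y → ∑ (λ x′ → f x′ y) xs) ys))

∑-∣ : ∀ {d} {f : A → ℕ} xs → (∀ x → x ∈ xs → d ∣ f x) → d ∣ ∑ f xs
∑-∣ []       h = _ ∣0
∑-∣ (x ∷ xs) h = ∣m∣n⇒∣m+n (h x (here refl)) (∑-∣ xs λ y m → h y (there m))

∈⇒≤∑ : ∀ (f : A → ℕ) {x xs} → x ∈ xs → f x ≤ ∑ f xs
∈⇒≤∑ f (here refl) = m≤m+n _ _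
∈⇒≤∑ f {xs = y ∷ _} (there m) = ≤-trans (∈⇒≤∑ f m) (m≤n+m _ (f y))

∑-map : (f : B → ℕ) (g : A → B) → ∀ xs → ∑ f (map g xs) ≡ ∑ (f ∘ g) xs
∑-map f g []       = refl
∑-map f g (x ∷ xs) = cong (f (g x) +_) (∑-map f g xs)

𝟙 : {P : Set} → Dec P → ℕ
𝟙 d = if does d then 1 else 0

𝟙-yes : {P : Set} (d : Dec P) → P → 𝟙 d ≡ 1
𝟙-yes (yes _) _ = refl
𝟙-yes (no ¬p) p = ⊥-elim (¬p p)

𝟙-no : {P : Set} (d : Dec P) → ¬ P → 𝟙 d ≡ 0
𝟙-no (yes p) ¬p = ⊥-elim (¬p p)
𝟙-no (no _)  _  = refl

𝟙-mono : {P Q : Set} (d : Dec P) (e : Dec Q) → (P → Q) → 𝟙 d ≤ 𝟙 e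
𝟙-mono (no _)  _ _ = z≤n
𝟙-mono (yes p) e h = ≤-reflexive (sym (𝟙-yes e (h p)))

𝟙-cong : {P Q : Set} (d : Dec P) (e : Dec Q) → (P → Q) → (Q → P) → 𝟙 d ≡ 𝟙 e
𝟙-cong d e h k = ≤-antisym (𝟙-mono d e h) (𝟙-mono e d k)

∑-𝟙-≤1 : ∀ {R : A → Set} (R? : ∀ x → Dec (R x)) {xs} → Unique xs →
         (∀ x y → x ∈ xs → y ∈ xs → R x → R y → x ≡ y) → ∑ (λ x → 𝟙 (R? x)) xs ≤ 1
∑-𝟙-≤1 R? [] h = z≤n
∑-𝟙-≤1 R? {x ∷ xs} (x∉ ∷ u) h with R? x
... | no _  = ∑-𝟙-≤1 R? u λ y z m m′ → h y z (there m) (there m′)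
... | yes p = s≤s (≤-reflexive (∑-zero xs λ y m → 𝟙-no (R? y) λ q →
                All.lookup x∉ m (h x y (here refl) (there m) p q)))

length-filterᵇ : ∀ {R : A → Set} (R? : ∀ x → Dec (R x)) (p : A → Bool) xs → (∀ x → R x → p x ≡ true) →
                 (∀ x → p x ≡ true → R x) → length (filterᵇ p xs) ≡ ∑ (λ x → 𝟙 (R? x)) xs
length-filterᵇ R? p []       h k = refl
length-filterᵇ R? p (x ∷ xs) h k with p x in eq
... | true  = cong₂ _+_ (sym (𝟙-yes (R? x) (k x eq))) (length-filterᵇ R? p xs h k)
... | false = cong₂ _+_ (sym (𝟙-no (R? x) λ r → contradiction (trans (sym (h x r)) eq) λ ())) (length-filterᵇ R? p xs h k)

# : {R : Fin n → Set} → (∀ i → Dec (R i)) → ℕ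
# R? = ∑ (λ i → 𝟙 (R? i)) (allFin _)

module _ {R S : Fin n → Set} (R? : ∀ i → Dec (R i)) (S? : ∀ i → Dec (S i)) where

  #-mono : (∀ i → R i → S i) → # R? ≤ # S?
  #-mono h = ∑-mono (allFin _) λ i _ → 𝟙-mono (R? i) (S? i) (h i)

  #-cong : (∀ i → R i → S i) → (∀ i → S i → R i) → # R? ≡ # S?
  #-cong h k = ∑-cong (allFin _) λ i _ → 𝟙-cong (R? i) (S? i) (h i) (k i)

  #-mono-< : (∀ i → R i → S i) → ∀ i → S i → ¬ R i → # R? < # S?
  #-mono-< h i s ¬r = ∑-mono-< (λ j _ → 𝟙-mono (R? j) (S? j) (h j)) (∈-allFin i)
    (subst₂ _<_ (sym (𝟙-no (R? i) ¬r)) (sym (𝟙-yes (S? i) s)) (s≤s z≤n))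

  #-sum : {U : Fin n → Set} (U? : ∀ i → Dec (U i)) → (∀ i → U i → R i ⊎ S i) → (∀ i → R i ⊎ S i → U i) →
          (∀ i → R i → ¬ S i) → # U? ≡ # R? + # S?
  #-sum U? h k disj = trans (∑-cong (allFin _) λ i _ → pointwise i) (∑-+ (λ i → 𝟙 (R? i)) (λ i → 𝟙 (S? i)) (allFin _))
    where
    pointwise : ∀ i → 𝟙 (U? i) ≡ 𝟙 (R? i) + 𝟙 (S? i)
    pointwise i with R? i | S? i
    ... | yes r | yes s = ⊥-elim (disj i r s)
    ... | yes r | no _  = 𝟙-yes (U? i) (k i (inj₁ r))
    ... | no _  | yes s = 𝟙-yes (U? i) (k i (inj₂ s))
    ... | no ¬r | no ¬s = 𝟙-no (U? i) λ u → [ ¬r , ¬s ]′ (h i u)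

#-singleton : (i : Fin n) → # (λ j → j ≟ᶠ i) ≡ 1
#-singleton i = ≤-antisym
  (∑-𝟙-≤1 (_≟ᶠ i) (allFin⁺ _) λ x y _ _ p q → trans p (sym q))
  (≤-trans (≤-reflexive (sym (𝟙-yes (i ≟ᶠ i) refl))) (∈⇒≤∑ (λ j → 𝟙 (j ≟ᶠ i)) (∈-allFin i)))

#-none : {R : Fin n → Set} (R? : ∀ i → Dec (R i)) → (∀ i → ¬ R i) → # R? ≡ 0
#-none R? h = ∑-zero (allFin _) λ i _ → 𝟙-no (R? i) (h i)

#-all : {R : Fin n → Set} (R? : ∀ i → Dec (R i)) → (∀ i → R i) → # R? ≡ n
#-all {n} R? h = trans (∑-cong (allFin n) λ i _ → 𝟙-yes (R? i) (h i)) (trans (∑-one (allFin n)) (length-tabulate {n = n} id))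
  where
  ∑-one : ∀ {A : Set} (xs : List A) → ∑ (λ _ → 1) xs ≡ length xs
  ∑-one []       = refl
  ∑-one (x ∷ xs) = cong suc (∑-one xs)

countᶠ≡# : {R : Fin n → Set} (R? : ∀ i → Dec (R i)) (p : Fin n → Bool) → (∀ i → R i → p i ≡ true) →
           (∀ i → p i ≡ true → R i) → countᶠ n p ≡ # R?
countᶠ≡# R? p h k = length-filterᵇ R? p (allFin _) h k

module _ {R : Fin n → Set} (R? : ∀ i → Dec (R i)) where

  abstract
    greatest : ∃ R → ∃[ i ] R i × (∀ j → R j → j ≼ i)
    greatest (i , r) = go (<-wellFounded (n ∸ toℕ i)) r
      where
      go : ∀ {i} → Acc _<_ (n ∸ toℕ i) → R i → ∃[ i ] R i × (∀ j → R j → j ≼ i)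
      go {i} (acc rs) r with any? (λ j → R? j ×-dec (toℕ i <? toℕ j))
      ... | yes (j , rj , i<j) = go (rs (∸-monoʳ-< i<j (<⇒≤ (toℕ<n j)))) rj
      ... | no none = i , r , λ j rj → ≮⇒≥ λ i<j → none (j , rj , i<j)

    least : ∃ R → ∃[ i ] R i × (∀ j → R j → i ≼ j)
    least (i , r) = go (<-wellFounded (toℕ i)) r
      where
      go : ∀ {i} → Acc _<_ (toℕ i) → R i → ∃[ i ] R i × (∀ j → R j → i ≼ j)
      go {i} (acc rs) r with any? (λ j → R? j ×-dec (toℕ j <? toℕ i))
      ... | yes (j , rj , j<i) = go (rs j<i) rj
      ... | no none = i , r , λ j rj → ≮⇒≥ λ j<i → none (j , rj , j<i)

-- Partitions, rank and joins

#-⊎ : {R S : Fin n → Set} (R? : ∀ i → Dec (R i)) (S? : ∀ i → Dec (S i)) → # (λ i → R? i ⊎-dec S? i) ≤ # R? + # S?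
#-⊎ R? S? = ≤-trans (∑-mono (allFin _) λ i _ → pointwise i) (≤-reflexive (∑-+ (λ i → 𝟙 (R? i)) (λ i → 𝟙 (S? i)) (allFin _)))
  where
  pointwise : ∀ i → 𝟙 (R? i ⊎-dec S? i) ≤ 𝟙 (R? i) + 𝟙 (S? i)
  pointwise i with R? i | S? i
  ... | yes _ | yes _ = s≤s z≤n
  ... | yes _ | no _  = s≤s z≤n
  ... | no _  | yes _ = s≤s z≤n
  ... | no _  | no _  = z≤n

-- Relations are `Set`-valued and decidable, so that meets, joins and duals can be defined by their
-- properties; equality of partitions is then mutual refinement `≗`.
record Part (n : ℕ) : Set₁ where
  field
    _[_~_]        : Fin n → Fin n → Set
    dec           : ∀ i j → Dec (_[_~_] i j)
    isEquivalence : IsEquivalence _[_~_]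
  open IsEquivalence isEquivalence public using () renaming (refl to ~refl; sym to ~sym; trans to ~trans)
open Part public

infix 4 _⊑_ _≗_
_⊑_ _≗_ : Part n → Part n → Set
x ⊑ y = ∀ {i j} → x [ i ~ j ] → y [ i ~ j ]
x ≗ y = x ⊑ y × y ⊑ x

≗-sym : ∀ {x y : Part n} → x ≗ y → y ≗ x
≗-sym (p , q) = q , p

module _ (x : Part n) where

  NonMin : Fin n → Set
  NonMin i = ∃[ j ] j ≺ i × x [ i ~ j ]

  nonMin? : ∀ i → Dec (NonMin i)
  nonMin? i = any? λ j → (toℕ j <? toℕ i) ×-dec dec x i j

  -- The rank in the partition lattice: a block contributes all of its elements but the least one,
  -- so this is `n` minus the number of blocks.
  rank : ℕ
  rank = # nonMin?

  blockSize : Fin n → ℕ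
  blockSize i = # (dec x i)

  blockMin : ∀ i → ∃[ m ] x [ i ~ m ] × (∀ j → x [ i ~ j ] → m ≼ j)
  blockMin i = least (dec x i) (i , ~refl x)

  blockMax : ∀ i → ∃[ m ] x [ i ~ m ] × (∀ j → x [ i ~ j ] → j ≼ m)
  blockMax i = greatest (dec x i) (i , ~refl x)

  blockMin-¬NonMin : ∀ i → ¬ NonMin (proj₁ (blockMin i))
  blockMin-¬NonMin i (j , j<m , m~j) = <⇒≱ j<m (proj₂ (proj₂ (blockMin i)) j (~trans x (proj₁ (proj₂ (blockMin i))) m~j))

module _ {x y : Part n} (x⊑y : x ⊑ y) where

  NonMin-mono : ∀ i → NonMin x i → NonMin y i
  NonMin-mono i (j , j<i , p) = j , j<i , x⊑y p

  rank-mono : rank x ≤ rank y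
  rank-mono = #-mono (nonMin? x) (nonMin? y) NonMin-mono

  -- If no element became nonminimal, the least elements of the `x`-blocks of `i` and `j` would both
  -- be least in one block of `y`, hence equal, and `i`, `j` would already be related in `x`.
  rank-mono-< : ∀ {i j} → y [ i ~ j ] → ¬ x [ i ~ j ] → rank x < rank y
  rank-mono-< {i} {j} yij ¬xij with any? (λ k → nonMin? y k ×-dec ¬? (nonMin? x k))
  ... | yes (k , p , q) = #-mono-< (nonMin? x) (nonMin? y) NonMin-mono k p q
  ... | no none = ⊥-elim (¬xij (~trans x i~m (subst (λ k → x [ k ~ j ]) (sym m≡m′) (~sym x j~m′))))
    where
    m = proj₁ (blockMin x i)
    i~m = proj₁ (proj₂ (blockMin x i))
    m′ = proj₁ (blockMin x j)
    j~m′ = proj₁ (proj₂ (blockMin x j))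
    m~m′ : y [ m ~ m′ ]
    m~m′ = ~trans y (~sym y (x⊑y i~m)) (~trans y yij (x⊑y j~m′))
    min-y : ∀ k → ¬ NonMin y (proj₁ (blockMin x k))
    min-y k p = none (_ , p , blockMin-¬NonMin x k)
    m≡m′ : m ≡ m′
    m≡m′ = toℕ-injective (≤-antisym (≮⇒≥ λ lt → min-y i (m′ , lt , m~m′))
                                    (≮⇒≥ λ lt → min-y j (m , lt , ~sym y m~m′)))

  -- The standard way below to turn an inclusion of partitions into an equality.
  rank-≤⇒⊒ : rank y ≤ rank x → y ⊑ x
  rank-≤⇒⊒ le {i} {j} yij with dec x i j
  ... | yes p = p
  ... | no ¬p = ⊥-elim (<⇒≱ (rank-mono-< yij ¬p) le)

rank-cong : {x y : Part n} → x ≗ y → rank x ≡ rank y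
rank-cong {x = x} {y} (p , q) = ≤-antisym (rank-mono {x = x} {y} p) (rank-mono {x = y} {x} q)

blockSize-cong : {x y : Part n} → x ≗ y → ∀ i → blockSize x i ≡ blockSize y i
blockSize-cong {x = x} {y} (p , q) i = #-cong (dec x i) (dec y i) (λ _ → p) (λ _ → q)

Δ total : Part n
Δ = record { _[_~_] = _≡_ ; dec = _≟ᶠ_ ; isEquivalence = record { refl = refl ; sym = sym ; trans = trans } }
total = record { _[_~_] = λ _ _ → ⊤ ; dec = λ _ _ → yes tt ; isEquivalence = _ }

record Meet (x y : Part n) (i j : Fin n) : Set where
  constructor _,_
  field
    fst : x [ i ~ j ]
    snd : y [ i ~ j ]
open Meet public

infixr 6 _⊓_
_⊓_ : Part n → Part n → Part n
x ⊓ y = record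
  { _[_~_] = Meet x y
  ; dec = λ i j → map′ (λ (p , q) → p , q) (λ (p , q) → p , q) (dec x i j ×-dec dec y i j)
  ; isEquivalence = record
    { refl = ~refl x , ~refl y
    ; sym = λ (p , q) → ~sym x p , ~sym y q
    ; trans = λ (p , q) (r , s) → ~trans x p r , ~trans y q s } }

-- The ground set is kept and the points outside `V` become singletons, so that ranks and duals can
-- be compared without renumbering.
data Restrict (x : Part n) (V : Fin n → Set) (i : Fin n) : Fin n → Set where
  same : Restrict x V i i
  both : ∀ {j} → x [ i ~ j ] → V i → V j → Restrict x V i j

infix 7 _↾_
_↾_ : Part n → {V : Fin n → Set} → (∀ i → Dec (V i)) → Part n
_↾_ {n} x {V} V? = record
  { _[_~_] = Restrict x V
  ; dec = decide
  ; isEquivalence = record { refl = same ; sym = symm ; trans = tran } }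
  where
  decide : ∀ i j → Dec (Restrict x V i j)
  decide i j with i ≟ᶠ j | dec x i j ×-dec V? i ×-dec V? j
  ... | yes refl | _ = yes same
  ... | no _ | yes (p , q , r) = yes (both p q r)
  ... | no i≢j | no ¬pqr = no λ { same → i≢j refl ; (both p q r) → ¬pqr (p , q , r) }
  symm : ∀ {i j} → Restrict x V i j → Restrict x V j i
  symm same = same
  symm (both p q r) = both (~sym x p) r q
  tran : ∀ {i j k} → Restrict x V i j → Restrict x V j k → Restrict x V i k
  tran same q = q
  tran p same = p
  tran (both p q r) (both p′ q′ r′) = both (~trans x p p′) q r′

↾⇒ : ∀ (x : Part n) {V : Fin n → Set} (V? : ∀ i → Dec (V i)) → x ↾ V? ⊑ x
↾⇒ x V? same = ~refl x
↾⇒ x V? (both p _ _) = p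

block : {V : Fin n → Set} → (∀ i → Dec (V i)) → Part n
block V? = total ↾ V?

-- The nonminimal points are those of `V` except the least one; for empty `V` the truncated
-- subtraction gives the correct value 0.
rank-block : {V : Fin n → Set} (V? : ∀ i → Dec (V i)) → rank (block V?) ≡ # V? ∸ 1
rank-block {n} {V} V? with any? V?
... | no none = trans (#-none (nonMin? (block V?)) empty) (sym (cong (_∸ 1) (#-none V? λ i v → none (i , v))))
  where
  empty : ∀ i → ¬ NonMin (block V?) i
  empty i (j , lt , same) = <-irrefl refl lt
  empty i (j , lt , both _ v _) = none (i , v)
... | yes ex = sym (trans (cong (_∸ 1) (#-sum (_≟ᶠ m) (nonMin? (block V?)) V? h k disj))
                          (cong (λ t → t + rank (block V?) ∸ 1) (#-singleton m)))
  where
  m = proj₁ (least V? ex)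
  vm = proj₁ (proj₂ (least V? ex))
  m≤ = proj₂ (proj₂ (least V? ex))
  h : ∀ i → V i → i ≡ m ⊎ NonMin (block V?) i
  h i v with i ≟ᶠ m
  ... | yes eq = inj₁ eq
  ... | no neq = inj₂ (m , ≤∧≢⇒< (m≤ i v) (λ eq → neq (sym (toℕ-injective eq))) , both tt v vm)
  k : ∀ i → i ≡ m ⊎ NonMin (block V?) i → V i
  k i (inj₁ refl) = vm
  k i (inj₂ (j , lt , same)) = ⊥-elim (<-irrefl refl lt)
  k i (inj₂ (j , lt , both _ v _)) = v
  disj : ∀ i → i ≡ m → ¬ NonMin (block V?) i
  disj i refl (j , lt , same) = <-irrefl refl lt
  disj i refl (j , lt , both _ _ v) = <⇒≱ lt (m≤ j v)

data Merge (x : Part n) (p q : Fin n) (r s : Fin n) : Set where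
  old : x [ r ~ s ] → Merge x p q r s
  pq  : x [ r ~ p ] → x [ q ~ s ] → Merge x p q r s
  qp  : x [ r ~ q ] → x [ p ~ s ] → Merge x p q r s

merge : Part n → Fin n → Fin n → Part n
merge {n} x p q = record
  { _[_~_] = Merge x p q
  ; dec = λ r s → map′ to from (dec x r s ⊎-dec (dec x r p ×-dec dec x q s) ⊎-dec (dec x r q ×-dec dec x p s))
  ; isEquivalence = record { refl = old (~refl x) ; sym = symm ; trans = tran } }
  where
  to : ∀ {r s} → x [ r ~ s ] ⊎ (x [ r ~ p ] × x [ q ~ s ]) ⊎ (x [ r ~ q ] × x [ p ~ s ]) → Merge x p q r s
  to (inj₁ a) = old a
  to (inj₂ (inj₁ (a , b))) = pq a b
  to (inj₂ (inj₂ (a , b))) = qp a b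
  from : ∀ {r s} → Merge x p q r s → x [ r ~ s ] ⊎ (x [ r ~ p ] × x [ q ~ s ]) ⊎ (x [ r ~ q ] × x [ p ~ s ])
  from (old a) = inj₁ a
  from (pq a b) = inj₂ (inj₁ (a , b))
  from (qp a b) = inj₂ (inj₂ (a , b))
  symm : ∀ {r s} → Merge x p q r s → Merge x p q s r
  symm (old a) = old (~sym x a)
  symm (pq a b) = qp (~sym x b) (~sym x a)
  symm (qp a b) = pq (~sym x b) (~sym x a)
  tran : ∀ {r s t} → Merge x p q r s → Merge x p q s t → Merge x p q r t
  tran (old a) (old b) = old (~trans x a b)
  tran (old a) (pq b c) = pq (~trans x a b) c
  tran (old a) (qp b c) = qp (~trans x a b) c
  tran (pq a b) (old c) = pq a (~trans x b c)
  tran (pq a b) (pq c d) = pq a d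
  tran (pq a b) (qp c d) = old (~trans x a d)
  tran (qp a b) (old c) = qp a (~trans x b c)
  tran (qp a b) (pq c d) = old (~trans x a d)
  tran (qp a b) (qp c d) = qp a d

-- Only the larger of the least elements of the two merged blocks can become nonminimal.
rank-merge : ∀ (x : Part n) p q → rank (merge x p q) ≤ suc (rank x)
rank-merge x p q = begin
  rank (merge x p q)                    ≤⟨ #-mono (nonMin? (merge x p q)) (λ i → (i ≟ᶠ m) ⊎-dec nonMin? x i) new ⟩
  # (λ i → (i ≟ᶠ m) ⊎-dec nonMin? x i) ≤⟨ #-⊎ (_≟ᶠ m) (nonMin? x) ⟩
  # (_≟ᶠ m) + rank x                    ≡⟨ cong (_+ rank x) (#-singleton m) ⟩
  suc (rank x)                          ∎
  where
  open ≤-Reasoning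
  mp = proj₁ (blockMin x p)
  mq = proj₁ (blockMin x q)
  larger : ∃[ m ] (mq ≺ mp → m ≡ mp) × (mp ≺ mq → m ≡ mq)
  larger with toℕ mq <? toℕ mp
  ... | yes lt = mp , (λ _ → refl) , λ gt → ⊥-elim (<-asym lt gt)
  ... | no ¬lt = mq , (λ lt → ⊥-elim (¬lt lt)) , λ _ → refl
  m = proj₁ larger
  min-unique : ∀ {r t} → ¬ NonMin x r → x [ r ~ t ] → r ≡ proj₁ (blockMin x t)
  min-unique {r} {t} ¬nm rt = toℕ-injective (≤-antisym
    (≮⇒≥ λ lt → ¬nm (_ , lt , ~trans x rt (proj₁ (proj₂ (blockMin x t)))))
    (proj₂ (proj₂ (blockMin x t)) r (~sym x rt)))
  new : ∀ r → NonMin (merge x p q) r → r ≡ m ⊎ NonMin x r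
  new r (s , s<r , c) with nonMin? x r
  ... | yes nm = inj₂ nm
  new r (s , s<r , old a) | no ¬nm = inj₂ (s , s<r , a)
  new r (s , s<r , pq a b) | no ¬nm = inj₁ (trans r≡mp (sym (proj₁ (proj₂ larger) (≤-<-trans (proj₂ (proj₂ (blockMin x q)) s b) (subst (s ≺_) r≡mp s<r)))))
    where r≡mp = min-unique ¬nm a
  new r (s , s<r , qp a b) | no ¬nm = inj₁ (trans r≡mq (sym (proj₂ (proj₂ larger) (≤-<-trans (proj₂ (proj₂ (blockMin x p)) s b) (subst (s ≺_) r≡mq s<r)))))
    where r≡mq = min-unique ¬nm a

private
  joinLinks : Part n → Part n → List (Fin n) → Part n
  joinLinks x v []       = x
  joinLinks x v (i ∷ is) = merge (joinLinks x v is) i (proj₁ (blockMin v i))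

  joinLinks-⊒ : ∀ (x v : Part n) is → x ⊑ joinLinks x v is
  joinLinks-⊒ x v []       p = p
  joinLinks-⊒ x v (i ∷ is) p = old (joinLinks-⊒ x v is p)

  joinLinks-∈ : ∀ (x v : Part n) {i is} → i ∈ is → joinLinks x v is [ i ~ proj₁ (blockMin v i) ]
  joinLinks-∈ x v {is = i ∷ is} (here refl) = pq (~refl (joinLinks x v is)) (~refl (joinLinks x v is))
  joinLinks-∈ x v (there m) = old (joinLinks-∈ x v m)

  joinLinks-least : ∀ (x v : Part n) is {Q : Fin n → Fin n → Set} → IsEquivalence Q →
                    (∀ {i j} → x [ i ~ j ] → Q i j) → (∀ {i j} → v [ i ~ j ] → Q i j) →
                    ∀ {i j} → joinLinks x v is [ i ~ j ] → Q i j
  joinLinks-least x v []       eq h k p = h p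
  joinLinks-least x v (l ∷ is) eq h k (old p) = joinLinks-least x v is eq h k p
  joinLinks-least x v (l ∷ is) eq h k (pq a b) = IsEquivalence.trans eq (joinLinks-least x v is eq h k a)
    (IsEquivalence.trans eq (k (proj₁ (proj₂ (blockMin v l)))) (joinLinks-least x v is eq h k b))
  joinLinks-least x v (l ∷ is) eq h k (qp a b) = IsEquivalence.trans eq (joinLinks-least x v is eq h k a)
    (IsEquivalence.trans eq (IsEquivalence.sym eq (k (proj₁ (proj₂ (blockMin v l))))) (joinLinks-least x v is eq h k b))

  rank-joinLinks : ∀ (x v : Part n) is → rank (joinLinks x v is) ≤ length is + rank x
  rank-joinLinks x v []       = ≤-refl
  rank-joinLinks x v (i ∷ is) = ≤-trans (rank-merge (joinLinks x v is) i _) (s≤s (rank-joinLinks x v is))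

  nonMins : Part n → List (Fin n)
  nonMins v = filterᵇ (λ i → does (nonMin? v i)) (allFin _)

abstract
  -- Built by adding rank v links one at a time, so that the rank bound is immediate.
  join : Part n → Part n → Part n
  join x v = joinLinks x v (nonMins v)

  join-⊒ˡ : ∀ (x v : Part n) → x ⊑ join x v
  join-⊒ˡ x v = joinLinks-⊒ x v (nonMins v)

  join-⊒ʳ : ∀ (x v : Part n) → v ⊑ join x v
  join-⊒ʳ x v {i} {j} p = ~trans (join x v) (toMin i) (subst (λ m → join x v [ m ~ j ]) (sym mi≡mj) (~sym (join x v) (toMin j)))
    where
    toMin : ∀ i → join x v [ i ~ proj₁ (blockMin v i) ]
    toMin i with nonMin? v i in eq
    ... | yes nm = joinLinks-∈ x v (∈-filter⁺ (λ k → Boolₚ.T? (does (nonMin? v k))) (∈-allFin i) (subst (λ d → T (does d)) (sym eq) tt))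
    -- No link was added at such a point, but it is itself the least element of its block.
    ... | no ¬nm = subst (λ m → join x v [ i ~ m ])
                     (toℕ-injective (≤-antisym (≮⇒≥ λ lt → ¬nm (_ , lt , proj₁ (proj₂ (blockMin v i)))) (proj₂ (proj₂ (blockMin v i)) i (~refl v))))
                     (~refl (join x v))
    mi≡mj : proj₁ (blockMin v i) ≡ proj₁ (blockMin v j)
    mi≡mj = toℕ-injective (≤-antisym
      (proj₂ (proj₂ (blockMin v i)) _ (~trans v p (proj₁ (proj₂ (blockMin v j)))))
      (proj₂ (proj₂ (blockMin v j)) _ (~trans v (~sym v p) (proj₁ (proj₂ (blockMin v i))))))

  -- Stated for arbitrary equivalence relations `Q`, so that it serves as an induction principle for
  -- related pairs.
  join-least : ∀ (x v : Part n) {Q : Fin n → Fin n → Set} → IsEquivalence Q →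
               (∀ {i j} → x [ i ~ j ] → Q i j) → (∀ {i j} → v [ i ~ j ] → Q i j) →
               ∀ {i j} → join x v [ i ~ j ] → Q i j
  join-least x v = joinLinks-least x v (nonMins v)

  rank-join : ∀ (x v : Part n) → rank (join x v) ≤ rank x + rank v
  rank-join {n} x v = ≤-trans (rank-joinLinks x v (nonMins v)) (≤-reflexive
    (trans (+-comm _ (rank x)) (cong (rank x +_)
      (length-filterᵇ (nonMin? v) (λ i → does (nonMin? v i)) (allFin n) does-true does-yes))))
    where
    does-true : ∀ i → NonMin v i → does (nonMin? v i) ≡ true
    does-true i nm with nonMin? v i
    ... | yes _ = refl
    ... | no ¬p = ⊥-elim (¬p nm)
    does-yes : ∀ i → does (nonMin? v i) ≡ true → NonMin v i
    does-yes i eq with nonMin? v i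
    does-yes i _  | yes nm = nm
    does-yes i () | no _

join-⊑ : ∀ (x v q : Part n) → x ⊑ q → v ⊑ q → join x v ⊑ q
join-⊑ x v q = join-least x v (isEquivalence q)

-- Noncrossing partitions and the Kreweras dual

module _ {i j : Fin n} where

  <ᶠ-true : i ≺ j → (i <ᶠ j) ≡ true
  <ᶠ-true p with toℕ i <ᵇ toℕ j | <⇒<ᵇ p
  ... | true | _ = refl

  <ᶠ-true⁻ : (i <ᶠ j) ≡ true → i ≺ j
  <ᶠ-true⁻ eq = <ᵇ⇒< (toℕ i) (toℕ j) (subst T (sym eq) tt)

  <ᶠ-false : j ≼ i → (i <ᶠ j) ≡ false
  <ᶠ-false p with i <ᶠ j in eq
  ... | false = refl
  ... | true  = ⊥-elim (<⇒≱ (<ᶠ-true⁻ eq) p)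

≺⊎≽ : ∀ (i j : Fin n) → i ≺ j ⊎ j ≼ i
≺⊎≽ i j with toℕ i <? toℕ j
... | yes p = inj₁ p
... | no ¬p = inj₂ (≮⇒≥ ¬p)

abstract
  -- side a b i tells whether the primed point i′ (which follows i) lies between a and b, that is, on which
  -- side of the chord a–b it lies.  For four distinct points, the chords a–c and b–e cross iff b and e
  -- are on different sides of a–c.
  side : Fin n → Fin n → Fin n → Bool
  side a b i = (i <ᶠ a) xor (i <ᶠ b)

  side-same : ∀ (a i : Fin n) → side a a i ≡ false
  side-same a i = Boolₚ.xor-same (i <ᶠ a)

  side-comm : ∀ (a b i : Fin n) → side a b i ≡ side b a i
  side-comm a b i = Boolₚ.xor-comm (i <ᶠ a) (i <ᶠ b)

  side-in : ∀ {a b i : Fin n} → a ≼ i → i ≺ b → side a b i ≡ true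
  side-in p q = cong₂ _xor_ (<ᶠ-false p) (<ᶠ-true q)

  side-below : ∀ {a b i : Fin n} → i ≺ a → i ≺ b → side a b i ≡ false
  side-below p q = cong₂ _xor_ (<ᶠ-true p) (<ᶠ-true q)

  side-above : ∀ {a b i : Fin n} → a ≼ i → b ≼ i → side a b i ≡ false
  side-above p q = cong₂ _xor_ (<ᶠ-false p) (<ᶠ-false q)

  side-true⁻ : ∀ {a b i : Fin n} → side a b i ≡ true → (a ≼ i × i ≺ b) ⊎ (b ≼ i × i ≺ a)
  side-true⁻ {a = a} {b} {i} eq with ≺⊎≽ i a | ≺⊎≽ i b
  ... | inj₁ p | inj₁ q = contradiction (trans (sym eq) (side-below p q)) λ ()
  ... | inj₁ p | inj₂ q = inj₂ (q , p)
  ... | inj₂ p | inj₁ q = inj₁ (p , q)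
  ... | inj₂ p | inj₂ q = contradiction (trans (sym eq) (side-above p q)) λ ()

  <ᶠ-const : ∀ {a i j : Fin n} → i ≼ j → a ≼ i ⊎ j ≺ a → (i <ᶠ a) ≡ (j <ᶠ a)
  <ᶠ-const i≤j (inj₁ a≤i) = trans (<ᶠ-false a≤i) (sym (<ᶠ-false (≤-trans a≤i i≤j)))
  <ᶠ-const i≤j (inj₂ j<a) = trans (<ᶠ-true (≤-<-trans i≤j j<a)) (sym (<ᶠ-true j<a))

  side-const : ∀ {a b i j : Fin n} → i ≼ j → a ≼ i ⊎ j ≺ a → b ≼ i ⊎ j ≺ b → side a b i ≡ side a b j
  side-const i≤j p q = cong₂ _xor_ (<ᶠ-const i≤j p) (<ᶠ-const i≤j q)

  <ᶠ-flip : ∀ {i j : Fin n} → i ≢ j → (i <ᶠ j) ≡ not (j <ᶠ i)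
  <ᶠ-flip {i = i} {j} i≢j with ≺⊎≽ i j
  ... | inj₁ i<j = trans (<ᶠ-true i<j) (sym (cong not (<ᶠ-false (<⇒≤ i<j))))
  ... | inj₂ j≤i = trans (<ᶠ-false j≤i) (sym (cong not (<ᶠ-true (≤∧≢⇒< j≤i λ eq → i≢j (sym (toℕ-injective eq))))))

  -- Crossing is a symmetric relation between chords: both equations say that the xor of four
  -- comparisons is false, and for distinct points reversing all four comparisons introduces an even
  -- number of negations.
  side-flip : ∀ {a b c e : Fin n} → a ≢ b → a ≢ e → c ≢ b → c ≢ e → side b e a ≡ side b e c → side a c b ≡ side a c e
  side-flip {a = a} {b} {c} {e} a≢b a≢e c≢b c≢e eq
    rewrite <ᶠ-flip a≢b | <ᶠ-flip a≢e | <ᶠ-flip c≢b | <ᶠ-flip c≢e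
    with b <ᶠ a | b <ᶠ c | e <ᶠ a | e <ᶠ c
  ... | true  | true  | true  | true  = refl
  ... | true  | true  | false | false = refl
  ... | true  | false | true  | false = refl
  ... | true  | false | false | true  = refl
  ... | false | true  | true  | false = refl
  ... | false | true  | false | true  = refl
  ... | false | false | true  | true  = refl
  ... | false | false | false | false = refl

  side-embed : ∀ {k} (e : Fin k → Fin n) → (∀ i j → (e i <ᶠ e j) ≡ (i <ᶠ j)) → ∀ a b i → side (e a) (e b) (e i) ≡ side a b i
  side-embed e mono a b i = cong₂ _xor_ (mono i a) (mono i b)

  -- `side` is additive along a path of chords: `side a c` is the xor of `side a b` and `side b c`.
  -- Hence nonseparation by a partition can be tested on generating chords.
  side-isEquivalence : ∀ (i j : Fin n) → IsEquivalence (λ a b → side a b i ≡ side a b j)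
  side-isEquivalence i j = record
    { refl = λ {a} → trans (side-same a i) (sym (side-same a j))
    ; sym = λ {a} {b} eq → trans (side-comm b a i) (trans eq (side-comm a b j))
    ; trans = λ {a} {b} {c} p q → trans (sym (via (i <ᶠ a) (i <ᶠ b) (i <ᶠ c))) (trans (cong₂ _xor_ p q) (via (j <ᶠ a) (j <ᶠ b) (j <ᶠ c))) }
    where
    via : ∀ p q r → (p xor q) xor (q xor r) ≡ p xor r
    via true  true  r = refl
    via true  false r = refl
    via false true  r = Boolₚ.not-involutive r
    via false false r = refl

side-true-≼⁻ : ∀ {a b i : Fin n} → a ≼ b → side a b i ≡ true → a ≼ i × i ≺ b
side-true-≼⁻ a≼b eq with side-true⁻ eq
... | inj₁ p = p
... | inj₂ (b≼i , i≺a) = ⊥-elim (<⇒≱ (≤-<-trans b≼i i≺a) a≼b)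

side-convex : ∀ {p q a b c : Fin n} → a ≺ b → b ≺ c → side p q a ≡ true → side p q c ≡ true → side p q b ≡ true
side-convex {p = p} {q} {a} {b} {c} a<b b<c sa sc with side-true⁻ sa | side-true⁻ sc
... | inj₁ (p≤a , _) | inj₁ (_ , c<q) = side-in (≤-trans p≤a (<⇒≤ a<b)) (<-trans b<c c<q)
... | inj₁ (p≤a , _) | inj₂ (_ , c<p) = ⊥-elim (<-asym (<-trans a<b b<c) (<-≤-trans c<p p≤a))
... | inj₂ (q≤a , _) | inj₁ (_ , c<q) = ⊥-elim (<-asym (<-trans a<b b<c) (<-≤-trans c<q q≤a))
... | inj₂ (q≤a , _) | inj₂ (_ , c<p) = trans (side-comm p q b) (side-in (≤-trans q≤a (<⇒≤ a<b)) (<-trans b<c c<p))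

-- `NCˡⁱⁿ` is the linear condition of the definition, `NC` its cyclic form, suited to computing with
-- `side`. The position of `b` is read off from `b′`, which is harmless since `b` is not an end of
-- the chord `a`-`c`.
NC NCˡⁱⁿ : Part n → Set
NC x = ∀ {a c b e} → x [ a ~ c ] → x [ b ~ e ] → ¬ x [ a ~ b ] → side a c b ≡ side a c e
NCˡⁱⁿ x = ∀ {a b c e} → a ≺ b → b ≺ c → c ≺ e → x [ a ~ c ] → x [ b ~ e ] → x [ a ~ b ]

NC⇒NCˡⁱⁿ : (x : Part n) → NC x → NCˡⁱⁿ x
NC⇒NCˡⁱⁿ x nc {a} {b} {c} {e} a<b b<c c<e ac be with dec x a b
... | yes p = p
... | no ¬p = contradiction (trans (sym (side-in (<⇒≤ a<b) b<c)) (trans (nc ac be ¬p) (side-above (<⇒≤ (<-trans a<b (<-trans b<c c<e))) (<⇒≤ c<e)))) λ ()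

NCˡⁱⁿ⇒NC : (x : Part n) → NCˡⁱⁿ x → NC x
NCˡⁱⁿ⇒NC x nc = result
  where
  crossing₁ : ∀ {a c b e} → x [ a ~ c ] → x [ b ~ e ] → a ≼ b → b ≺ c → side a c e ≡ false → x [ a ~ b ]
  crossing₁ {a} {c} {b} {e} ac be a≤b b<c se with a ≟ᶠ b | ≺⊎≽ e a | ≺⊎≽ e c
  ... | yes refl | _ | _ = ~refl x
  ... | no a≢b | inj₁ e<a | _ = ~trans x (~sym x (nc e<a (≤∧≢⇒< a≤b (a≢b ∘ toℕ-injective)) b<c (~sym x be) ac)) (~sym x be)
  ... | no a≢b | inj₂ a≤e | inj₁ e<c = contradiction (trans (sym se) (side-in a≤e e<c)) λ ()
  ... | no a≢b | inj₂ a≤e | inj₂ c≤e with c ≟ᶠ e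
  ...   | yes refl = ~trans x ac (~sym x be)
  ...   | no c≢e = nc (≤∧≢⇒< a≤b (a≢b ∘ toℕ-injective)) b<c (≤∧≢⇒< c≤e (c≢e ∘ toℕ-injective)) ac be
  crossing : ∀ {a c b e} → x [ a ~ c ] → x [ b ~ e ] → side a c b ≡ true → side a c e ≡ false → x [ a ~ b ]
  crossing {a} {c} {b} {e} ac be sb se with side-true⁻ sb
  ... | inj₁ (a≤b , b<c) = crossing₁ ac be a≤b b<c se
  ... | inj₂ (c≤b , b<a) = ~trans x ac (crossing₁ (~sym x ac) be c≤b b<a (trans (side-comm c a e) se))
  result : ∀ {a c b e} → x [ a ~ c ] → x [ b ~ e ] → ¬ x [ a ~ b ] → side a c b ≡ side a c e
  result {a} {c} {b} {e} ac be ¬ab with side a c b in sb | side a c e in se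
  ... | true  | true  = refl
  ... | false | false = refl
  ... | true  | false = ⊥-elim (¬ab (crossing ac be sb se))
  ... | false | true  = ⊥-elim (¬ab (~trans x (crossing ac (~sym x be) se sb) (~sym x be)))

-- Two primed points can share a block of the dual exactly if no chord inside a block of `x`
-- separates them.
record Unseparated (x : Part n) (i j : Fin n) : Set where
  constructor unsep
  field sameSide : ∀ {a b} → x [ a ~ b ] → side a b i ≡ side a b j
open Unseparated public

-- The Kreweras dual, with the primed point i′ identified with i.
K : Part n → Part n
K x = record
  { _[_~_] = Unseparated x
  ; dec = λ i j → map′ (λ h → unsep λ {a} {b} → h a b) (λ (unsep h) a b → h)
      (all? λ a → all? λ b → dec x a b →-dec (side a b i Boolₚ.≟ side a b j))
  ; isEquivalence = record
    { refl = unsep λ _ → refl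
    ; sym = λ (unsep h) → unsep λ p → sym (h p)
    ; trans = λ (unsep h) (unsep k) → unsep λ p → trans (h p) (k p) } }

K-antitone : (x y : Part n) → x ⊑ y → K y ⊑ K x
K-antitone x y x⊑y (unsep h) = unsep λ p → h (x⊑y p)

-- A chord cuts the primed points into two arcs. If it separates neither `a′` from `c′` nor `b′`
-- from `e′`, the interleaved order of the four points puts them all on one side.
K-NC : (x : Part n) → NC (K x)
K-NC x = NCˡⁱⁿ⇒NC (K x) λ a<b b<c c<e ac be → unsep λ p → helper a<b b<c c<e (sameSide ac p) (sameSide be p)
  where
  helper : ∀ {p q a b c e} → a ≺ b → b ≺ c → c ≺ e → side p q a ≡ side p q c → side p q b ≡ side p q e → side p q a ≡ side p q b
  helper {p} {q} {a} {b} {c} {e} a<b b<c c<e ac be with side p q a in sa | side p q b in sb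
  ... | true  | true  = refl
  ... | false | false = refl
  ... | true  | false = trans (sym (side-convex a<b b<c sa (sym ac))) sb
  ... | false | true  = trans ac (side-convex b<c c<e sb (sym be))

meet-NC : (x y : Part n) → NC x → NC y → NC (x ⊓ y)
meet-NC x y ncx ncy {a} {b = b} (p , q) (p′ , q′) ¬r with dec x a b
... | no ¬xab = ncx p p′ ¬xab
... | yes xab = ncy q q′ λ yab → ¬r (xab , yab)

↾-NC : (x : Part n) {V : Fin n → Set} (V? : ∀ i → Dec (V i)) → NC x → NC (x ↾ V?)
↾-NC x V? nc {a} {b = b} {e} same _ _ = trans (side-same a b) (sym (side-same a e))
↾-NC x V? nc (both _ _ _) same _ = refl
↾-NC x V? nc (both p va vc) (both q vb ve) ¬r = nc p q λ r → ¬r (both r va vb)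

total-NC : NC (total {n})
total-NC _ _ ¬r = ⊥-elim (¬r tt)

block-NC : {V : Fin n → Set} (V? : ∀ i → Dec (V i)) → NC (block V?)
block-NC V? = ↾-NC total V? total-NC

≗-NC : (x y : Part n) → x ≗ y → NC x → NC y
≗-NC x y (p , q) nc a b ¬c = nc (q a) (q b) (λ c → ¬c (p c))

side-flip-part : ∀ (S : Part n) {a b c e} → S [ a ~ c ] → S [ b ~ e ] → ¬ S [ a ~ b ] → side b e a ≡ side b e c → side a c b ≡ side a c e
side-flip-part S ac be ¬ab = side-flip
  (λ { refl → ¬ab (~refl S) }) (λ { refl → ¬ab (~sym S be) }) (λ { refl → ¬ab ac }) (λ { refl → ¬ab (~trans S ac (~sym S be)) })

-- A path that leaves one side of a generating chord must either meet the chord or contain a step crossing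
-- it; this is applied first to the generating chords and then to all chords of S.
generated-NC : (S : Part n) (R : Fin n → Fin n → Set) → (∀ {i j} → R i j → S [ i ~ j ]) →
               (∀ {Q : Fin n → Fin n → Set} → IsEquivalence Q → (∀ {i j} → R i j → Q i j) → ∀ {i j} → S [ i ~ j ] → Q i j) →
               (∀ {a c b e} → R a c → R b e → ¬ S [ a ~ b ] → side a c b ≡ side a c e) → NC S
generated-NC {n} S R R⊆S generated cross ac be ¬ab = chord ac be ¬ab
  where
  Q : Fin n → Fin n → Fin n → Fin n → Set
  Q b e p q = S [ p ~ q ] × (S [ p ~ b ] ⊎ side b e p ≡ side b e q)
  Q-equiv : ∀ b e → IsEquivalence (Q b e)
  Q-equiv b e = record
    { refl = ~refl S , inj₂ refl
    ; sym = λ { (s , inj₁ t) → ~sym S s , inj₁ (~trans S (~sym S s) t) ; (s , inj₂ eq) → ~sym S s , inj₂ (sym eq) }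
    ; trans = λ { (s , inj₁ t) (s′ , _) → ~trans S s s′ , inj₁ t
                ; (s , inj₂ _) (s′ , inj₁ t) → ~trans S s s′ , inj₁ (~trans S s t)
                ; (s , inj₂ eq) (s′ , inj₂ eq′) → ~trans S s s′ , inj₂ (trans eq eq′) } }
  extract : ∀ {a c b e} → Q a c b e → ¬ S [ a ~ b ] → side a c b ≡ side a c e
  extract (_ , inj₁ s) ¬ab = ⊥-elim (¬ab (~sym S s))
  extract (_ , inj₂ eq) _ = eq
  step : ∀ {a c b e} → R a c → S [ b ~ e ] → ¬ S [ a ~ b ] → side a c b ≡ side a c e
  step {a} {c} r s ¬ab = extract (generated (Q-equiv a c) single s) ¬ab
    where
    single : ∀ {p q} → R p q → Q a c p q
    single {p} r′ with dec S p a
    ... | yes t = R⊆S r′ , inj₁ t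
    ... | no ¬t = R⊆S r′ , inj₂ (cross r r′ (¬t ∘ ~sym S))
  chord : ∀ {a c b e} → S [ a ~ c ] → S [ b ~ e ] → ¬ S [ a ~ b ] → side a c b ≡ side a c e
  chord {a} {c} s s′ ¬ab = extract (generated (Q-equiv a c) single s′) ¬ab
    where
    single : ∀ {p q} → R p q → Q a c p q
    single {p} r with dec S p a
    ... | yes t = R⊆S r , inj₁ t
    ... | no ¬t = R⊆S r , inj₂ (side-flip-part S s (R⊆S r) (¬t ∘ ~sym S) (step r s ¬t))

-- The generating chords are those of `x` and those of `v`; mixed pairs do not cross because `v`
-- lies below `K x`.
join-NC : (x v : Part n) → NC x → NC v → v ⊑ K x → NC (join x v)
join-NC {n} x v ncx ncv v⊑Kx = generated-NC S R R⊆S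
  (λ eq h → join-least x v eq (h ∘ inj₁) (h ∘ inj₂)) cross
  where
  S = join x v
  R : Fin n → Fin n → Set
  R i j = x [ i ~ j ] ⊎ v [ i ~ j ]
  R⊆S : ∀ {i j} → R i j → S [ i ~ j ]
  R⊆S = [ join-⊒ˡ x v , join-⊒ʳ x v ]′
  cross : ∀ {a c b e} → R a c → R b e → ¬ S [ a ~ b ] → side a c b ≡ side a c e
  cross (inj₁ p) (inj₁ q) ¬s = ncx p q (¬s ∘ join-⊒ˡ x v)
  cross (inj₂ p) (inj₂ q) ¬s = ncv p q (¬s ∘ join-⊒ʳ x v)
  cross (inj₁ p) (inj₂ q) ¬s = sameSide (v⊑Kx q) p
  cross (inj₂ p) (inj₁ q) ¬s = side-flip-part S (join-⊒ʳ x v p) (join-⊒ˡ x v q) ¬s (sameSide (v⊑Kx p) q)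

-- Only the chords of `x` inside the `y`-block of `i` have to be tested: a chord in another block of
-- `y` does not separate two points of this block, because `y` is noncrossing.
K-local : (x y : Part n) → NC y → x ⊑ y → ∀ {i j} → y [ i ~ j ] →
          (∀ {a b} → x [ a ~ b ] → y [ a ~ i ] → side a b i ≡ side a b j) → K x [ i ~ j ]
K-local x y nc x⊑y {i} {j} yij h = unsep go
  where
  go : ∀ {a b} → x [ a ~ b ] → side a b i ≡ side a b j
  go {a} p with dec y a i
  ... | yes yai = h p yai
  ... | no ¬yai = nc (x⊑y p) yij ¬yai

module _ (x y : Part n) (ncx : NC x) (ncy : NC y) (x⊑y : x ⊑ y) where

  private
    avoid : ∀ {a q i : Fin n} → (∀ k → k ≺ q × y [ q ~ k ] → k ≼ i) → y [ q ~ a ] → ¬ x [ a ~ q ] → a ≼ i ⊎ q ≺ a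
    avoid {a} {q} i-max yqa ¬xaq with ≺⊎≽ a q
    ... | inj₁ a<q = inj₁ (i-max a (a<q , yqa))
    ... | inj₂ q≤a = inj₂ (≤∧≢⇒< q≤a λ eq → ¬xaq (subst (λ k → x [ a ~ k ]) (sym (toℕ-injective eq)) (~refl x)))

  -- The next three lemmas describe the cycles of x⁻¹y: the successor of i is the predecessor, in its
  -- block of x, of the successor q of i in its block of y.
  K-pred : ∀ {i j q} → i ≺ q → y [ q ~ i ] → (∀ k → k ≺ q × y [ q ~ k ] → k ≼ i) →
           j ≺ q → x [ q ~ j ] → (∀ k → k ≺ q × x [ q ~ k ] → k ≼ j) → K x [ j ~ i ]
  K-pred {i} {j} {q} i<q yqi i-max j<q xqj j-max = K-local x y ncy x⊑y (~trans y (~sym y (x⊑y xqj)) yqi) go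
    where
    j≤i : j ≼ i
    j≤i = i-max j (j<q , x⊑y xqj)
    go : ∀ {a b} → x [ a ~ b ] → y [ a ~ j ] → side a b j ≡ side a b i
    go {a} {b} xab yaj with dec x a q
    ... | yes xaq = side-const j≤i (outside (~sym x xaq)) (outside (~trans x (~sym x xaq) xab))
      where
      outside : ∀ {c} → x [ q ~ c ] → c ≼ j ⊎ i ≺ c
      outside {c} xqc with ≺⊎≽ c q
      ... | inj₁ c<q = inj₁ (j-max c (c<q , xqc))
      ... | inj₂ q≤c = inj₂ (<-≤-trans i<q q≤c)
    ... | no ¬xaq = trans (ncx xab (~sym x xqj) (λ xaj → ¬xaq (~trans x xaj (~sym x xqj))))
                          (sym (side-const (<⇒≤ i<q) (avoid i-max yqa ¬xaq) (avoid i-max yqb λ xbq → ¬xaq (~trans x xab xbq))))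
      where
      yqa : y [ q ~ a ]
      yqa = ~trans y (x⊑y xqj) (~sym y yaj)
      yqb : y [ q ~ b ]
      yqb = ~trans y yqa (x⊑y xab)

  K-min : ∀ {i j q} → i ≺ q → y [ q ~ i ] → (∀ k → k ≺ q × y [ q ~ k ] → k ≼ i) →
          x [ q ~ j ] → (∀ k → x [ q ~ k ] → k ≼ j) → ¬ NonMin x q → K x [ i ~ j ]
  K-min {i} {j} {q} i<q yqi i-max xqj j-max q-min = K-local x y ncy x⊑y (~trans y (~sym y yqi) (x⊑y xqj)) go
    where
    go : ∀ {a b} → x [ a ~ b ] → y [ a ~ i ] → side a b i ≡ side a b j
    go {a} {b} xab yai with dec x a q
    ... | yes xaq = trans (side-below (inside (~sym x xaq)) (inside xqb)) (sym (side-above (j-max a (~sym x xaq)) (j-max b xqb)))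
      where
      xqb : x [ q ~ b ]
      xqb = ~trans x (~sym x xaq) xab
      inside : ∀ {c} → x [ q ~ c ] → i ≺ c
      inside {c} xqc = <-≤-trans i<q (≮⇒≥ λ c<q → q-min (c , c<q , xqc))
    ... | no ¬xaq = trans (side-const (<⇒≤ i<q) (avoid i-max yqa ¬xaq) (avoid i-max (~trans y yqa (x⊑y xab)) λ xbq → ¬xaq (~trans x xab xbq)))
                          (ncx xab xqj ¬xaq)
      where
      yqa : y [ q ~ a ]
      yqa = ~trans y yqi (~sym y yai)

  K-wrap : ∀ {i j q} → y [ q ~ i ] → (∀ k → y [ q ~ k ] → k ≼ i) → ¬ NonMin y q →
           x [ q ~ j ] → (∀ k → x [ q ~ k ] → k ≼ j) → K x [ j ~ i ]
  K-wrap {i} {j} {q} yqi i-max q-min xqj j-max = K-local x y ncy x⊑y (~trans y (~sym y (x⊑y xqj)) yqi) go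
    where
    go : ∀ {a b} → x [ a ~ b ] → y [ a ~ j ] → side a b j ≡ side a b i
    go {a} {b} xab yaj with dec x a q
    ... | yes xaq = trans (side-above (j-max a (~sym x xaq)) (j-max b (~trans x (~sym x xaq) xab)))
                          (sym (side-above (i-max a yqa) (i-max b (~trans y yqa (x⊑y xab)))))
      where
      yqa : y [ q ~ a ]
      yqa = ~trans y (x⊑y xqj) (~sym y yaj)
    ... | no ¬xaq = trans (sym (ncx xab xqj ¬xaq)) (trans (side-below (above ¬xaq yqa) (above (λ xbq → ¬xaq (~trans x xab xbq)) yqb))
                          (sym (side-above (i-max a yqa) (i-max b yqb))))
      where
      yqa : y [ q ~ a ]
      yqa = ~trans y (x⊑y xqj) (~sym y yaj)
      yqb : y [ q ~ b ]
      yqb = ~trans y yqa (x⊑y xab)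
      above : ∀ {c} → ¬ x [ c ~ q ] → y [ q ~ c ] → q ≺ c
      above {c} ¬xcq yqc = ≤∧≢⇒< (≮⇒≥ λ c<q → q-min (c , c<q , yqc)) λ eq → ¬xcq (subst (λ k → x [ k ~ q ]) (toℕ-injective eq) (~refl x))

  -- Each `q` is joined to its predecessor `i₀` in its block of `y` by way of `j`, the cyclic
  -- predecessor of `q` in its block of `x`: `q` and `j` are related in `x`, and `j` and `i₀` in
  -- `y ⊓ K x`. Descending along the block of `y` reaches all its smaller elements.
  ⊑-join-K : y ⊑ join x (y ⊓ K x)
  ⊑-join-K = result
    where
    J = join x (y ⊓ K x)
    connected : ∀ {q i} → Acc _<_ (toℕ q) → i ≺ q → y [ i ~ q ] → J [ i ~ q ]
    connected {q} {i} (acc rs) i<q yiq = ~trans J toPred fromPred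
      where
      pred = greatest (λ k → (toℕ k <? toℕ q) ×-dec dec y q k) (i , i<q , ~sym y yiq)
      i₀ = proj₁ pred
      i₀<q = proj₁ (proj₁ (proj₂ pred))
      yqi₀ = proj₂ (proj₁ (proj₂ pred))
      i₀-max = proj₂ (proj₂ pred)
      toPred : J [ i ~ i₀ ]
      toPred with i ≟ᶠ i₀
      ... | yes i≡i₀ = subst (λ k → J [ i ~ k ]) i≡i₀ (~refl J)
      ... | no i≢i₀ = connected (rs i₀<q) (≤∧≢⇒< (i₀-max i (i<q , ~sym y yiq)) (i≢i₀ ∘ toℕ-injective)) (~trans y yiq yqi₀)
      fromPred : J [ i₀ ~ q ]
      fromPred with nonMin? x q
      ... | yes (k , k<q , xqk) = ~trans J (join-⊒ʳ x (y ⊓ K x) (~trans y (~sym y yqi₀) (x⊑y xqj) , ~sym (K x) Kji₀)) (join-⊒ˡ x (y ⊓ K x) (~sym x xqj))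
        where
        pred-x = greatest (λ k → (toℕ k <? toℕ q) ×-dec dec x q k) (k , k<q , xqk)
        xqj = proj₂ (proj₁ (proj₂ pred-x))
        Kji₀ = K-pred i₀<q yqi₀ i₀-max (proj₁ (proj₁ (proj₂ pred-x))) xqj (proj₂ (proj₂ pred-x))
      ... | no q-min = ~trans J (join-⊒ʳ x (y ⊓ K x) (~trans y (~sym y yqi₀) (x⊑y xqj) , K-min i₀<q yqi₀ i₀-max xqj (proj₂ (proj₂ max-x)) q-min)) (join-⊒ˡ x (y ⊓ K x) (~sym x xqj))
        where
        max-x = blockMax x q
        xqj = proj₁ (proj₂ max-x)
    result : ∀ {i q} → y [ i ~ q ] → J [ i ~ q ]
    result {i} {q} yiq with ≺⊎≽ i q | ≺⊎≽ q i
    ... | inj₁ i<q | _ = connected (<-wellFounded (toℕ q)) i<q yiq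
    ... | inj₂ q≤i | inj₁ q<i = ~sym J (connected (<-wellFounded (toℕ i)) q<i (~sym y yiq))
    ... | inj₂ q≤i | inj₂ i≤q = subst (λ k → J [ i ~ k ]) (toℕ-injective (≤-antisym i≤q q≤i)) (~refl J)

rank-removed : (x : Part n) → ∀ {m} → NonMin x m → let x′ = x ↾ (λ i → ¬? (i ≟ᶠ m)) in
               rank x′ < rank x × rank x ≤ suc (rank x′)
rank-removed {n} x {m} nm@(l , l<m , xml) = #-mono-< (nonMin? x′) (nonMin? x) (NonMin-mono {x = x′} {x} (↾⇒ x V?)) m nm removed , (begin
    rank x                                     ≤⟨ #-mono (nonMin? x) (λ i → (i ≟ᶠ m) ⊎-dec nonMin? x′ i) kept ⟩
    # (λ i → (i ≟ᶠ m) ⊎-dec nonMin? x′ i)      ≤⟨ #-⊎ (_≟ᶠ m) (nonMin? x′) ⟩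
    # (_≟ᶠ m) + rank x′                        ≡⟨ cong (_+ rank x′) (#-singleton m) ⟩
    suc (rank x′)                              ∎)
  where
  open ≤-Reasoning
  V? : ∀ (i : Fin n) → Dec (i ≢ m)
  V? i = ¬? (i ≟ᶠ m)
  x′ = x ↾ V?
  removed : ¬ NonMin x′ m
  removed (j , j<m , same) = <-irrefl refl j<m
  removed (j , j<m , both _ m≢m _) = m≢m refl
  kept : ∀ i → NonMin x i → i ≡ m ⊎ NonMin x′ i
  kept i (j , j<i , xij) with i ≟ᶠ m | j ≟ᶠ m
  ... | yes i≡m | _ = inj₁ i≡m
  ... | no i≢m | no j≢m = inj₂ (j , j<i , both xij i≢m j≢m)
  -- If the smaller element in the block of `i` was `m` itself, then `l`, which is smaller still,
  -- takes its place.
  ... | no i≢m | yes refl = inj₂ (l , <-trans l<m j<i , both (~trans x xij xml) i≢m λ { refl → <-irrefl refl l<m })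

-- Isolating a point m of x makes m and its predecessor in the block of y unseparated.
rank-+-K-≤ : (x y : Part n) → NC y → x ⊑ y → rank x + rank (y ⊓ K x) ≤ rank y
rank-+-K-≤ {n} x y ncy x⊑y = go x x⊑y (<-wellFounded (rank x))
  where
  go : ∀ x → x ⊑ y → Acc _<_ (rank x) → rank x + rank (y ⊓ K x) ≤ rank y
  go x x⊑y (acc rs) with any? (nonMin? x)
  ... | no none = subst (λ r → r + rank (y ⊓ K x) ≤ rank y) (sym (#-none (nonMin? x) λ i nm → none (i , nm))) (rank-mono {x = y ⊓ K x} {y} fst)
  ... | yes (m , l , l<m , xml) = begin
    rank x + rank (y ⊓ K x)         ≤⟨ +-monoˡ-≤ _ (proj₂ (rank-removed x (l , l<m , xml))) ⟩
    suc (rank x′) + rank (y ⊓ K x)  ≡⟨ +-suc (rank x′) _ ⟨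
    rank x′ + suc (rank (y ⊓ K x))  ≤⟨ +-monoʳ-≤ (rank x′) (rank-mono-< {x = y ⊓ K x} {y ⊓ K x′}
                                         (λ (p , q) → p , K-antitone x′ x (↾⇒ x V?) q) (~sym y ymi , Kim) ¬Kim) ⟩
    rank x′ + rank (y ⊓ K x′)       ≤⟨ go x′ (x⊑y ∘ ↾⇒ x V?) (rs (proj₁ (rank-removed x (l , l<m , xml)))) ⟩
    rank y                          ∎
    where
    open ≤-Reasoning
    V? : ∀ (i : Fin n) → Dec (i ≢ m)
    V? i = ¬? (i ≟ᶠ m)
    x′ = x ↾ V?
    pred = greatest (λ k → (toℕ k <? toℕ m) ×-dec dec y m k) (l , l<m , x⊑y xml)
    i = proj₁ pred
    i<m = proj₁ (proj₁ (proj₂ pred))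
    ymi = proj₂ (proj₁ (proj₂ pred))
    i-max = proj₂ (proj₂ pred)
    Kim : K x′ [ i ~ m ]
    Kim = K-local x′ y ncy (x⊑y ∘ ↾⇒ x V?) (~sym y ymi) λ
      { same _ → trans (side-same _ i) (sym (side-same _ m))
      ; (both xab a≢m b≢m) yai → side-const (<⇒≤ i<m) (outside (~trans y ymi (~sym y yai)) a≢m)
                                                      (outside (~trans y ymi (~trans y (~sym y yai) (x⊑y xab))) b≢m) }
      where
      outside : ∀ {c} → y [ m ~ c ] → c ≢ m → c ≼ i ⊎ m ≺ c
      outside {c} ymc c≢m with ≺⊎≽ c m
      ... | inj₁ c<m = inj₁ (i-max c (c<m , ymc))
      ... | inj₂ m≤c = inj₂ (≤∧≢⇒< m≤c (c≢m ∘ sym ∘ toℕ-injective))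
    ¬Kim : ¬ (y ⊓ K x) [ i ~ m ]
    -- Before the isolation the chord `l`-`m` of `x` separates `i′`, which lies in the arc from `l`
    -- to `m`, from `m′`, which lies just behind it.
    ¬Kim (_ , k) = contradiction
      (trans (sym (side-in (i-max l (l<m , x⊑y xml)) i<m)) (trans (sameSide k (~sym x xml)) (side-above (<⇒≤ l<m) ≤-refl))) λ ()

module _ (x y : Part n) (ncx : NC x) (ncy : NC y) (x⊑y : x ⊑ y) where

  -- The missing inequality holds because `x` and `y ⊓ K x` generate `y` and ranks are subadditive
  -- under joins.
  rank-+-K : rank x + rank (y ⊓ K x) ≡ rank y
  rank-+-K = ≤-antisym (rank-+-K-≤ x y ncy x⊑y)
    (≤-trans (rank-mono {x = y} {join x (y ⊓ K x)} (⊑-join-K x y ncx ncy x⊑y)) (rank-join x (y ⊓ K x)))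

-- Block sizes modulo d

module _ (x : Part n) where

  blockSize-pred : ∀ m → blockSize x m ∸ 1 ≡ # (λ i → dec x m i ×-dec ¬? (i ≟ᶠ m))
  blockSize-pred m = cong (_∸ 1) (trans
    (#-sum (_≟ᶠ m) (λ i → dec x m i ×-dec ¬? (i ≟ᶠ m)) (dec x m) split join′ (λ i p q → proj₂ q p))
    (cong (_+ # (λ i → dec x m i ×-dec ¬? (i ≟ᶠ m))) (#-singleton m)))
    where
    split : ∀ i → x [ m ~ i ] → i ≡ m ⊎ (x [ m ~ i ] × i ≢ m)
    split i p with i ≟ᶠ m
    ... | yes eq = inj₁ eq
    ... | no neq = inj₂ (p , neq)
    join′ : ∀ i → i ≡ m ⊎ (x [ m ~ i ] × i ≢ m) → x [ m ~ i ]
    join′ i (inj₁ refl) = ~refl x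
    join′ i (inj₂ (p , _)) = p

  private
    IsMinOf : Fin n → Fin n → Set
    IsMinOf m i = ¬ NonMin x m × x [ m ~ i ] × i ≢ m

    isMinOf? : ∀ m i → Dec (IsMinOf m i)
    isMinOf? m i = ¬? (nonMin? x m) ×-dec dec x m i ×-dec ¬? (i ≟ᶠ m)

    nonMin-sum : ∀ i → 𝟙 (nonMin? x i) ≡ ∑ (λ m → 𝟙 (isMinOf? m i)) (allFin n)
    nonMin-sum i with nonMin? x i
    ... | no ¬nm = sym (∑-zero (allFin n) λ m _ → 𝟙-no (isMinOf? m i) λ (m-min , mi , i≢m) →
                     i≢m (toℕ-injective (≤-antisym (≮⇒≥ λ lt → ¬nm (m , lt , ~sym x mi)) (≮⇒≥ λ lt → m-min (i , lt , mi)))))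
    ... | yes (j , j<i , ij) = ≤-antisym
        (subst (_≤ ∑ (λ m → 𝟙 (isMinOf? m i)) (allFin n)) (𝟙-yes (isMinOf? m₀ i) m₀-min) (∈⇒≤∑ (λ m → 𝟙 (isMinOf? m i)) (∈-allFin m₀)))
        (∑-𝟙-≤1 (λ m → isMinOf? m i) (allFin⁺ n) unique)
      where
      m₀ = proj₁ (blockMin x i)
      m₀-min : IsMinOf m₀ i
      m₀-min = blockMin-¬NonMin x i , ~sym x (proj₁ (proj₂ (blockMin x i))) ,
               λ i≡m₀ → <⇒≱ j<i (subst (_≼ j) (sym i≡m₀) (proj₂ (proj₂ (blockMin x i)) j ij))
      unique : ∀ m m′ → m ∈ allFin n → m′ ∈ allFin n → IsMinOf m i → IsMinOf m′ i → m ≡ m′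
      unique m m′ _ _ (min , mi , _) (min′ , mi′ , _) = toℕ-injective (≤-antisym
        (≮⇒≥ λ lt → min (m′ , lt , ~trans x mi (~sym x mi′))) (≮⇒≥ λ lt → min′ (m , lt , ~trans x mi′ (~sym x mi))))

  -- Counts the pairs of a block minimum `m` and another element `i` of its block in two ways; for
  -- fixed minimum `m` the inner sum is the size of the block less 1.
  rank≡∑ : rank x ≡ ∑ (λ m → ∑ (λ i → 𝟙 (isMinOf? m i)) (allFin n)) (allFin n)
  rank≡∑ = trans (∑-cong (allFin n) λ i _ → nonMin-sum i) (∑-swap (λ i m → 𝟙 (isMinOf? m i)) (allFin n) (allFin n))

  sizes⇒∣rank : ∀ {d} → (∀ i → d ∣ blockSize x i ∸ 1) → d ∣ rank x
  sizes⇒∣rank {d} h = subst (d ∣_) (sym rank≡∑) (∑-∣ (allFin n) λ m _ → term m)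
    where
    term : ∀ m → d ∣ # (isMinOf? m)
    term m = go (nonMin? x m)
      where
      go : Dec (NonMin x m) → d ∣ # (isMinOf? m)
      go (yes nm) = subst (d ∣_) (sym (#-none (isMinOf? m) λ _ p → proj₁ p nm)) (d ∣0)
      go (no ¬nm) = subst (d ∣_) (trans (blockSize-pred m)
        (#-cong (λ i → dec x m i ×-dec ¬? (i ≟ᶠ m)) (isMinOf? m) (λ i p → ¬nm , p) (λ i → proj₂))) (h m)

∣blockSize-singleton : ∀ (x : Part n) {d i} → (∀ j → x [ i ~ j ] → j ≡ i) → d ∣ blockSize x i ∸ 1
∣blockSize-singleton x {d} {i} h = subst (λ s → d ∣ s ∸ 1) (sym (trans (#-cong (dec x i) (_≟ᶠ i) h (λ { j refl → ~refl x })) (#-singleton i))) (d ∣0)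

module Modulo (d : ℕ) where

  Sizes : Part n → Set
  Sizes x = ∀ i → d ∣ blockSize x i ∸ 1

  ∣rank : (x : Part n) → Sizes x → d ∣ rank x
  ∣rank x = sizes⇒∣rank x

  Sizes-≗ : (x y : Part n) → x ≗ y → Sizes x → Sizes y
  Sizes-≗ x y eq s i = subst (λ k → d ∣ k ∸ 1) (blockSize-cong {x = x} {y} eq i) (s i)

  Sizes-↾ : (x : Part n) {V : Fin n → Set} (V? : ∀ i → Dec (V i)) → (∀ {i j} → x [ i ~ j ] → V i → V j) → Sizes x → Sizes (x ↾ V?)
  Sizes-↾ {n} x {V} V? closed s i = go (V? i)
    where
    go : Dec (V i) → d ∣ blockSize (x ↾ V?) i ∸ 1
    go (yes v) = subst (λ k → d ∣ k ∸ 1) (#-cong (dec x i) (dec (x ↾ V?) i) (λ j p → both p v (closed p v)) (λ j → ↾⇒ x V?)) (s i)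
    go (no ¬v) = ∣blockSize-singleton (x ↾ V?) λ { j same → refl ; j (both _ v _) → ⊥-elim (¬v v) }

  -- Each block of q is treated separately, by restricting the rank identity to it.
  Sizes-⊓K : (p q : Part n) → NC p → NC q → p ⊑ q → Sizes p → Sizes (q ⊓ K p) → Sizes q
  Sizes-⊓K p q ncp ncq p⊑q sp su i = subst (d ∣_) (trans (rank-+-K (p ↾ V?) (block V?) (↾-NC p V? ncp) (block-NC V?) p⊑b) (rank-block V?))
      (∣m∣n⇒∣m+n (∣rank (p ↾ V?) (Sizes-↾ p V? (λ pij qi → ~trans q qi (p⊑q pij)) sp))
                  (subst (d ∣_) (rank-cong {x = (q ⊓ K p) ↾ V?} {block V? ⊓ K (p ↾ V?)} local)
                    (∣rank ((q ⊓ K p) ↾ V?) (Sizes-↾ (q ⊓ K p) V? (λ u qi → ~trans q qi (fst u)) su))))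
    where
    V? = dec q i
    p⊑b : p ↾ V? ⊑ block V?
    p⊑b same = same
    p⊑b (both _ v w) = both tt v w
    -- Taking the complement commutes with restriction to a block of `q`, by `K-local`.
    local : (q ⊓ K p) ↾ V? ≗ block V? ⊓ K (p ↾ V?)
    local = (λ { same → same , ~refl (K (p ↾ V?)) ; (both (_ , k) v w) → both tt v w , K-antitone (p ↾ V?) p (↾⇒ p V?) k })
          , λ { (same , _) → same
              ; (both tt v w , k) → let qij = ~trans q (~sym q v) w in
                  both (qij , K-local p q ncq p⊑q qij λ pab qai → sameSide k (both pab (~trans q v (~sym q qai)) (~trans q v (~trans q (~sym q qai) (p⊑q pab))))) v w }

  -- Congruence modulo `d`, with multiples added on both sides so as to avoid truncated subtraction.
  infix 4 _≈_
  _≈_ : ℕ → ℕ → Set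
  m ≈ n = ∃[ a ] ∃[ b ] m + a * d ≡ n + b * d

  ≈-refl : ∀ {m} → m ≈ m
  ≈-refl = 0 , 0 , refl

  ≈-reflexive : ∀ {m n} → m ≡ n → m ≈ n
  ≈-reflexive refl = ≈-refl

  ≈-sym : ∀ {m n} → m ≈ n → n ≈ m
  ≈-sym (a , b , eq) = b , a , sym eq

  ≈-trans : ∀ {m n k} → m ≈ n → n ≈ k → m ≈ k
  ≈-trans {m} {n} {k} (a , b , eq) (a′ , b′ , eq′) = a + a′ , b′ + b , (begin
    m + (a + a′) * d       ≡⟨ solve 4 (λ m a a′ d → m :+ (a :+ a′) :* d := (m :+ a :* d) :+ a′ :* d) refl m a a′ d ⟩
    m + a * d + a′ * d     ≡⟨ cong (_+ a′ * d) eq ⟩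
    n + b * d + a′ * d     ≡⟨ solve 4 (λ n b a′ d → n :+ b :* d :+ a′ :* d := (n :+ a′ :* d) :+ b :* d) refl n b a′ d ⟩
    n + a′ * d + b * d     ≡⟨ cong (_+ b * d) eq′ ⟩
    k + b′ * d + b * d     ≡⟨ solve 4 (λ k b′ b d → k :+ b′ :* d :+ b :* d := k :+ (b′ :+ b) :* d) refl k b′ b d ⟩
    k + (b′ + b) * d       ∎)
    where open ≡-Reasoning
          open +-*-Solver

  ≈-+ʳ : ∀ {m n} k → m ≈ n → m + k ≈ n + k
  ≈-+ʳ {m} {n} k (a , b , eq) = a , b , (begin
    m + k + a * d   ≡⟨ solve 3 (λ m k t → m :+ k :+ t := (m :+ t) :+ k) refl m k (a * d) ⟩
    m + a * d + k   ≡⟨ cong (_+ k) eq ⟩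
    n + b * d + k   ≡⟨ solve 3 (λ n k t → n :+ t :+ k := n :+ k :+ t) refl n k (b * d) ⟩
    n + k + b * d   ∎)
    where open ≡-Reasoning
          open +-*-Solver

  ≈-suc⁻ : ∀ {m n} → suc m ≈ suc n → m ≈ n
  ≈-suc⁻ (a , b , eq) = a , b , suc-injective eq

  ∣⇒≈ : ∀ {m k} → d ∣ k → m + k ≈ m
  ∣⇒≈ {m} (divides q refl) = 0 , q , +-identityʳ _

  ≈⇒∣ : ∀ {m k} → m + k ≈ m → d ∣ k
  ≈⇒∣ {m} {k} (a , b , eq) = ∣m+n∣m⇒∣n (subst (d ∣_) (sym eq′) (n∣m*n b)) (n∣m*n a)
    where
    eq′ : a * d + k ≡ b * d
    eq′ = +-cancelˡ-≡ m _ _ (trans (trans (cong (m +_) (+-comm (a * d) k)) (sym (+-assoc m k (a * d)))) eq)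

#-below : ∀ {n} m → m ≤ n → # {n} (λ i → toℕ i <? m) ≡ m
#-below {zero}  .zero z≤n = refl
#-below {suc n} zero z≤n = #-none {suc n} (λ i → toℕ i <? 0) λ i ()
#-below {suc n} (suc m) (s≤s m≤n) = cong suc (trans (∑-suc {n} (λ i → 𝟙 (toℕ i <? suc m)))
    (trans (#-cong {n} (λ i → suc (toℕ i) <? suc m) (λ i → toℕ i <? m) (λ { i (s≤s p) → p }) λ i p → s≤s p) (#-below {n} m m≤n)))
  where
  ∑-suc : ∀ {n} (f : Fin (suc n) → ℕ) → ∑ f (Data.List.tabulate Fin.suc) ≡ ∑ (f ∘ Fin.suc) (allFin n)
  ∑-suc {n} f = trans (cong (∑ f) (sym (map-tabulate id Fin.suc))) (∑-map f Fin.suc (allFin n))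

#-interval : ∀ {a b} {R : Fin n → Set} (R? : ∀ i → Dec (R i)) → a ≤ b → b ≤ n →
             (∀ i → R i → a ≤ toℕ i × toℕ i < b) → (∀ i → a ≤ toℕ i × toℕ i < b → R i) → b ≡ a + # R?
#-interval {n} {a} {b} R? a≤b b≤n h k = begin
  b                              ≡⟨ #-below {n} b b≤n ⟨
  # {n} (λ i → toℕ i <? b)           ≡⟨ #-sum {n} (λ i → toℕ i <? a) R? (λ i → toℕ i <? b) split unsplit (λ i i<a r → <⇒≱ i<a (proj₁ (h i r))) ⟩
  # {n} (λ i → toℕ i <? a) + # R?    ≡⟨ cong (_+ # R?) (#-below {n} a (≤-trans a≤b b≤n)) ⟩
  a + # R?                       ∎
  where
  open ≡-Reasoning
  split : ∀ i → toℕ i < b → toℕ i < a ⊎ _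
  split i i<b with toℕ i <? a
  ... | yes i<a = inj₁ i<a
  ... | no i≮a = inj₂ (k i (≮⇒≥ i≮a , i<b))
  unsplit : ∀ i → toℕ i < a ⊎ _ → toℕ i < b
  unsplit i (inj₁ i<a) = <-≤-trans i<a a≤b
  unsplit i (inj₂ r) = proj₂ (h i r)

-- Indivisible partitions and the sizes of relative complements

module Indivisible (d : ℕ) where
  open Modulo d public

  record Good (x : Part n) : Set where
    constructor good
    field
      nc     : NC x
      sizes  : Sizes x
      sizesK : Sizes (K x)
  open Good public

  module _ (y : Part n) (gy : Good y) where

    private
      -- The rank identity for `y ↾ V?` inside the single block `I`. The closure assumptions make
      -- both summands sums over full blocks of `y` and of `K y`, hence divisible by `d`; the last
      -- assumption identifies the complement with `K y ↾ W?`.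
      ∣interval : {I V W : Fin n → Set} (I? : ∀ i → Dec (I i)) (V? : ∀ i → Dec (V i)) (W? : ∀ i → Dec (W i)) →
                  (∀ {i j} → y [ i ~ j ] → V i → V j) → (∀ {i j} → K y [ i ~ j ] → W i → W j) →
                  (∀ {i} → V i → I i) → (∀ {i} → W i → I i) →
                  (∀ {i j} → I i → I j → K (y ↾ V?) [ i ~ j ] → i ≡ j ⊎ (W i × W j × K y [ i ~ j ])) → d ∣ # I? ∸ 1
      ∣interval I? V? W? V-closed W-closed V⊆I W⊆I h =
        subst (d ∣_) (trans (rank-+-K (y ↾ V?) (block I?) (↾-NC y V? (nc gy)) (block-NC I?) sub) (rank-block I?))
          (∣m∣n⇒∣m+n (∣rank (y ↾ V?) (Sizes-↾ y V? V-closed (sizes gy)))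
                      (subst (d ∣_) (rank-cong {x = K y ↾ W?} {block I? ⊓ K (y ↾ V?)} local) (∣rank (K y ↾ W?) (Sizes-↾ (K y) W? W-closed (sizesK gy)))))
        where
        sub : y ↾ V? ⊑ block I?
        sub same = same
        sub (both _ v w) = both tt (V⊆I v) (V⊆I w)
        back : block I? ⊓ K (y ↾ V?) ⊑ K y ↾ W?
        back (same , _) = same
        back {i} {j} (both tt v w , k) with h v w k
        ... | inj₁ refl = same
        ... | inj₂ (a , b , c) = both c a b
        local : K y ↾ W? ≗ block I? ⊓ K (y ↾ V?)
        local = (λ { same → same , ~refl (K (y ↾ V?)) ; (both k v w) → both tt (W⊆I v) (W⊆I w) , K-antitone (y ↾ V?) y (↾⇒ y V?) k }) , back

    -- The gap between consecutive elements a, b of a block is a union of blocks of y, and the primed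
    -- points a′, …, (b-1)′ are a union of blocks of K y.
    gap : ∀ {a b} → a ≺ b → y [ a ~ b ] → (∀ k → y [ a ~ k ] → a ≺ k → b ≼ k) → toℕ b ≈ suc (toℕ a)
    gap {a} {b} a<b yab next = ≈-trans (≈-reflexive b≡) (∣⇒≈ (∣interval I? V? I? V-closed I-closed proj₁ id h))
      where
      I V : Fin n → Set
      I k = a ≼ k × k ≺ b
      -- `a` is dropped because its block continues at `b`, outside the interval; the primed point
      -- `a′` stays.
      V k = I k × k ≢ a
      I? : ∀ k → Dec (I k)
      I? k = (toℕ a ≤? toℕ k) ×-dec (toℕ k <? toℕ b)
      V? : ∀ k → Dec (V k)
      V? k = I? k ×-dec ¬? (k ≟ᶠ a)
      b≡ : toℕ b ≡ suc (toℕ a + (# I? ∸ 1))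
      b≡ = trans count (trans (cong (toℕ a +_) (sym (m+[n∸m]≡n #I>0))) (+-suc (toℕ a) (# I? ∸ 1)))
        where
        count : toℕ b ≡ toℕ a + # I?
        count = #-interval I? (<⇒≤ a<b) (<⇒≤ (toℕ<n b)) (λ _ → id) (λ _ → id)
        #I>0 : 1 ≤ # I?
        #I>0 = ≤-trans (≤-reflexive (sym (𝟙-yes (I? a) (≤-refl , a<b)))) (∈⇒≤∑ (λ k → 𝟙 (I? k)) (∈-allFin a))
      V⇒¬y : ∀ {k} → V k → ¬ y [ a ~ k ]
      V⇒¬y ((a≤k , k<b) , k≢a) yak = <⇒≱ k<b (next _ yak (≤∧≢⇒< a≤k λ eq → k≢a (sym (toℕ-injective eq))))
      V-closed : ∀ {i j} → y [ i ~ j ] → V i → V j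
      V-closed yij v@((a≤i , i<b) , _) = side-true-≼⁻ (<⇒≤ a<b) (trans (sym (nc gy yab yij (V⇒¬y v))) (side-in a≤i i<b)) ,
                                         λ { refl → V⇒¬y v (~sym y yij) }
      I-closed : ∀ {i j} → K y [ i ~ j ] → I i → I j
      I-closed k (a≤i , i<b) = side-true-≼⁻ (<⇒≤ a<b) (trans (sym (sameSide k yab)) (side-in a≤i i<b))
      h : ∀ {i j} → I i → I j → K (y ↾ V?) [ i ~ j ] → i ≡ j ⊎ (I i × I j × K y [ i ~ j ])
      h {i} {j} Ii Ij k = inj₂ (Ii , Ij , unsep all-chords)
        where
        far : ∀ {c} → ¬ V c → toℕ c ≤ toℕ a ⊎ toℕ b ≤ toℕ c
        far {c} ¬v with ≺⊎≽ c b | ≺⊎≽ a c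
        ... | inj₂ b≤c | _ = inj₂ b≤c
        ... | inj₁ c<b | inj₂ c≤a = inj₁ c≤a
        ... | inj₁ c<b | inj₁ a<c = ⊥-elim (¬v ((<⇒≤ a<c , c<b) , λ { refl → <-irrefl refl a<c }))
        narrow : ∀ {c i j} → I i → I j → toℕ c ≤ toℕ a ⊎ toℕ b ≤ toℕ c → c ≼ i ⊎ j ≺ c
        narrow (a≤i , _) _ (inj₁ c≤a) = inj₁ (≤-trans c≤a a≤i)
        narrow _ (_ , j<b) (inj₂ b≤c) = inj₂ (<-≤-trans j<b b≤c)
        all-chords : ∀ {c e} → y [ c ~ e ] → side c e i ≡ side c e j
        all-chords {c} {e} yce with V? c | ≺⊎≽ i j
        ... | yes v | _ = sameSide k (both yce v (V-closed yce v))
        ... | no ¬v | inj₁ i<j = side-const (<⇒≤ i<j) (narrow Ii Ij (far ¬v)) (narrow Ii Ij (far (¬v ∘ V-closed (~sym y yce))))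
        ... | no ¬v | inj₂ j≤i = sym (side-const j≤i (narrow Ij Ii (far ¬v)) (narrow Ij Ii (far (¬v ∘ V-closed (~sym y yce)))))

    -- The points from `a` to `b`, both included, form a union of blocks of `y`. The chord `a`-`b`
    -- cuts off `b′`, so on the primed side only `a′` up to the point before `b′` form a union of
    -- blocks of `K y`, and `b′` becomes a singleton.
    hull : ∀ {a b} → y [ a ~ b ] → (∀ k → y [ a ~ k ] → a ≼ k × k ≼ b) → toℕ b ≈ toℕ a
    hull {a} {b} yab extremes = ≈-trans (≈-reflexive b≡) (∣⇒≈ (∣interval I? I? W? I-closed W-closed id (λ (a≤k , k<b) → a≤k , <⇒≤ k<b) h))
      where
      a≤b : a ≼ b
      a≤b = proj₁ (extremes b yab)
      I W : Fin n → Set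
      I k = a ≼ k × k ≼ b
      W k = a ≼ k × k ≺ b
      I? : ∀ k → Dec (I k)
      I? k = (toℕ a ≤? toℕ k) ×-dec (toℕ k ≤? toℕ b)
      W? : ∀ k → Dec (W k)
      W? k = (toℕ a ≤? toℕ k) ×-dec (toℕ k <? toℕ b)
      b≡ : toℕ b ≡ toℕ a + (# I? ∸ 1)
      b≡ = suc-injective (trans count (trans (cong (toℕ a +_) (sym (m+[n∸m]≡n #I>0))) (+-suc (toℕ a) (# I? ∸ 1))))
        where
        count : suc (toℕ b) ≡ toℕ a + # I?
        count = #-interval I? (m≤n⇒m≤1+n a≤b) (toℕ<n b) (λ k (p , q) → p , s≤s q) (λ { k (p , s≤s q) → p , q })
        #I>0 : 1 ≤ # I?
        #I>0 = ≤-trans (≤-reflexive (sym (𝟙-yes (I? a) (≤-refl , a≤b)))) (∈⇒≤∑ (λ k → 𝟙 (I? k)) (∈-allFin a))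
      I-closed : ∀ {i j} → y [ i ~ j ] → I i → I j
      I-closed {i} {j} yij (a≤i , i≤b) with dec y a i
      ... | yes yai = extremes j (~trans y yai yij)
      ... | no ¬yai = let (a≤j , j<b) = side-true-≼⁻ a≤b (trans (sym (nc gy yab yij ¬yai)) (side-in a≤i i<b)) in a≤j , <⇒≤ j<b
        where
        i<b : i ≺ b
        i<b = ≤∧≢⇒< i≤b λ eq → ¬yai (subst (λ k → y [ a ~ k ]) (sym (toℕ-injective eq)) yab)
      W-closed : ∀ {i j} → K y [ i ~ j ] → W i → W j
      W-closed k (a≤i , i<b) = side-true-≼⁻ a≤b (trans (sym (sameSide k yab)) (side-in a≤i i<b))
      h : ∀ {i j} → I i → I j → K (y ↾ I?) [ i ~ j ] → i ≡ j ⊎ (W i × W j × K y [ i ~ j ])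
      h {i} {j} Ii@(a≤i , i≤b) Ij@(a≤j , j≤b) k with ≺⊎≽ i b | ≺⊎≽ j b
      ... | inj₂ b≤i | inj₂ b≤j = inj₁ (toℕ-injective (trans (≤-antisym i≤b b≤i) (≤-antisym b≤j j≤b)))
      ... | inj₁ i<b | inj₂ b≤j = contradiction (trans (sym (side-in a≤i i<b)) (trans (sameSide k (both yab (≤-refl , a≤b) (a≤b , ≤-refl))) (side-above a≤j b≤j))) λ ()
      ... | inj₂ b≤i | inj₁ j<b = contradiction (trans (sym (side-in a≤j j<b)) (trans (sym (sameSide k (both yab (≤-refl , a≤b) (a≤b , ≤-refl)))) (side-above a≤i b≤i))) λ ()
      ... | inj₁ i<b | inj₁ j<b = inj₂ ((a≤i , i<b) , (a≤j , j<b) , unsep all-chords)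
        where
        narrow : ∀ {c i j} → I i → I j → ¬ I c → c ≼ i ⊎ j ≺ c
        narrow {c} (a≤i , _) (_ , j≤b) ¬Ic with ≺⊎≽ c a | ≺⊎≽ b c
        ... | inj₁ c<a | _ = inj₁ (≤-trans (<⇒≤ c<a) a≤i)
        ... | inj₂ a≤c | inj₁ b<c = inj₂ (≤-<-trans j≤b b<c)
        ... | inj₂ a≤c | inj₂ c≤b = ⊥-elim (¬Ic (a≤c , c≤b))
        all-chords : ∀ {c e} → y [ c ~ e ] → side c e i ≡ side c e j
        all-chords {c} {e} yce with I? c | ≺⊎≽ i j
        ... | yes v | _ = sameSide k (both yce v (I-closed yce v))
        ... | no ¬v | inj₁ i<j = side-const (<⇒≤ i<j) (narrow Ii Ij ¬v) (narrow Ii Ij (¬v ∘ I-closed (~sym y yce)))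
        ... | no ¬v | inj₂ j≤i = sym (side-const j≤i (narrow Ij Ii ¬v) (narrow Ij Ii (¬v ∘ I-closed (~sym y yce))))

  module _ (x y : Part n) (gx : Good x) (gy : Good y) (x⊑y : x ⊑ y) where

    private
      u = y ⊓ K x

      module Next {i} (above : ∃[ k ] y [ i ~ k ] × i ≺ k) where
        next = least (λ k → dec y i k ×-dec (toℕ i <? toℕ k)) above
        q = proj₁ next
        yiq = proj₁ (proj₁ (proj₂ next))
        i<q = proj₂ (proj₁ (proj₂ next))
        q-least : ∀ k → y [ i ~ k ] → i ≺ k → q ≼ k
        q-least k p l = proj₂ (proj₂ next) k (p , l)
        i-max : ∀ k → k ≺ q × y [ q ~ k ] → k ≼ i
        i-max k (k<q , yqk) = ≮⇒≥ λ i<k → <⇒≱ k<q (q-least k (~trans y yiq yqk) i<k)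
        q≈i+1 : toℕ q ≈ suc (toℕ i)
        q≈i+1 = gap y gy i<q yiq q-least

      -- Let `q` be the element after `i` in its block of `y`. If `q` were not least in its block of
      -- `x`, the chord from `q` to its predecessor there would separate `i` from `i′`. Hence `q` is
      -- least, and `i′` turns out to be the largest element of the same block of `x`; now `gap` for
      -- `y` and `hull` for `x` combine.
      consecutive : ∀ {i i′} → i ≺ i′ → u [ i ~ i′ ] → (∀ k → u [ i ~ k ] → i ≺ k → i′ ≼ k) → toℕ i′ ≈ suc (toℕ i)
      consecutive {i} {i′} i<i′ uii′ i′-least with nonMin? x q
        where open Next {i} (i′ , fst uii′ , i<i′)
      ... | yes (l , l<q , xql) = contradiction
              (trans (sym (side-in j≤i i<q)) (trans (sameSide (snd uii′) (~sym x xqj)) (side-above (≤-trans j≤i (<⇒≤ i<i′)) q≤i′))) λ ()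
        where
        open Next {i} (i′ , fst uii′ , i<i′)
        pred = greatest (λ k → (toℕ k <? toℕ q) ×-dec dec x q k) (l , l<q , xql)
        j = proj₁ pred
        j<q = proj₁ (proj₁ (proj₂ pred))
        xqj = proj₂ (proj₁ (proj₂ pred))
        j≤i : j ≼ i
        j≤i = i-max j (j<q , x⊑y xqj)
        q≤i′ : q ≼ i′
        q≤i′ = q-least i′ (fst uii′) i<i′
      ... | no q-min = ≈-trans (≈-reflexive (cong toℕ i′≡j)) (≈-trans
              (hull x gx xqj λ k xqk → ≮⇒≥ (λ k<q → q-min (k , k<q , xqk)) , j-max k xqk) q≈i+1)
        where
        open Next {i} (i′ , fst uii′ , i<i′)
        j = proj₁ (blockMax x q)
        xqj = proj₁ (proj₂ (blockMax x q))
        j-max = proj₂ (proj₂ (blockMax x q))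
        Kij : K x [ i ~ j ]
        Kij = K-min x y (nc gx) (nc gy) x⊑y i<q (~sym y yiq) i-max xqj j-max q-min
        i<j : i ≺ j
        i<j = <-≤-trans i<q (j-max q (~refl x))
        i′≤j : i′ ≼ j
        i′≤j = i′-least j (~trans y yiq (x⊑y xqj) , Kij) i<j
        i′≡j : i′ ≡ j
        i′≡j = toℕ-injective (≤-antisym i′≤j (≮⇒≥ λ i′<j → contradiction
          (trans (sym (side-in (q-least i′ (fst uii′) i<i′) i′<j)) (trans (sym (sameSide (snd uii′) xqj)) (side-below i<q i<j))) λ ()))

      -- The cyclic successor of `hi` is `lo`. If `hi` is largest in its block of `y`, then `lo` is
      -- largest in the block of `x` that contains the least element of this block, and `hull`
      -- applies to `x` and to `y`. Otherwise `lo` is the predecessor in `x` of the element after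
      -- `hi` in `y`, and the two instances of `gap` cancel.
      extremes : ∀ {lo hi} → u [ lo ~ hi ] → (∀ k → u [ hi ~ k ] → lo ≼ k × k ≼ hi) → toℕ hi ≈ toℕ lo
      extremes {lo} {hi} u-lohi bounds with any? (λ k → dec y hi k ×-dec (toℕ hi <? toℕ k))
      ... | no none = ≈-trans (hull y gy yq-hi λ k yqk → proj₂ (proj₂ (blockMin y hi)) k (~trans y (~sym y yq-hi) yqk) , hi-max k yqk)
                     (≈-trans (≈-sym (hull x gx xqj λ k xqk → ≮⇒≥ (λ k<q → q-min (k , k<q , x⊑y xqk)) , j-max k xqk))
                              (≈-reflexive (cong toℕ j≡lo)))
        where
        q = proj₁ (blockMin y hi)
        yq-hi = ~sym y (proj₁ (proj₂ (blockMin y hi)))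
        q-min = blockMin-¬NonMin y hi
        hi-max : ∀ k → y [ q ~ k ] → k ≼ hi
        hi-max k yqk = ≮⇒≥ λ hi<k → none (k , ~trans y (~sym y yq-hi) yqk , hi<k)
        j = proj₁ (blockMax x q)
        xqj = proj₁ (proj₂ (blockMax x q))
        j-max = proj₂ (proj₂ (blockMax x q))
        K-j-hi : K x [ j ~ hi ]
        K-j-hi = K-wrap x y (nc gx) (nc gy) x⊑y yq-hi hi-max q-min xqj j-max
        j≡lo : j ≡ lo
        j≡lo = toℕ-injective (≤-antisym
          (≮⇒≥ λ lo<j → contradiction
            (trans (sym (side-in (proj₂ (proj₂ (blockMin y hi)) lo (~sym y (fst u-lohi))) lo<j))
              (trans (sameSide (snd u-lohi) xqj) (side-above (hi-max q (~refl y)) (hi-max j (x⊑y xqj))))) λ ())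
          (proj₁ (bounds j (~trans y (~sym y yq-hi) (x⊑y xqj) , ~sym (K x) K-j-hi))))
      ... | yes above with nonMin? x (Next.q above)
      ...   | no q-min = ⊥-elim (<⇒≱ (<-≤-trans i<q (j-max q (~refl x))) (proj₂ (bounds j (~trans y yiq (x⊑y xqj) ,
                K-min x y (nc gx) (nc gy) x⊑y i<q (~sym y yiq) i-max xqj j-max q-min))))
        where
        open Next above
        j = proj₁ (blockMax x q)
        xqj = proj₁ (proj₂ (blockMax x q))
        j-max = proj₂ (proj₂ (blockMax x q))
      ...   | yes (l , l<q , xql) = ≈-trans (≈-suc⁻ (≈-trans (≈-sym q≈i+1) (gap x gx j<q (~sym x xqj) q-next))) (≈-reflexive (cong toℕ j≡lo))
        where
        open Next above
        pred = greatest (λ k → (toℕ k <? toℕ q) ×-dec dec x q k) (l , l<q , xql)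
        j = proj₁ pred
        j<q = proj₁ (proj₁ (proj₂ pred))
        xqj = proj₂ (proj₁ (proj₂ pred))
        q-next : ∀ k → x [ j ~ k ] → j ≺ k → q ≼ k
        q-next k xjk j<k = ≮⇒≥ λ k<q → <⇒≱ j<k (proj₂ (proj₂ pred) k (k<q , ~trans x xqj xjk))
        j≤hi : j ≼ hi
        j≤hi = i-max j (j<q , x⊑y xqj)
        j≡lo : j ≡ lo
        j≡lo = toℕ-injective (≤-antisym
          (≮⇒≥ λ lo<j → contradiction
            (trans (sym (side-in j≤hi i<q)) (trans (sym (sameSide (snd u-lohi) (~sym x xqj))) (side-below lo<j (<-trans lo<j j<q)))) λ ())
          (proj₁ (bounds j (~trans y yiq (x⊑y xqj) ,
            ~sym (K x) (K-pred x y (nc gx) (nc gy) x⊑y i<q (~sym y yiq) i-max j<q xqj (proj₂ (proj₂ pred)))))))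

      above# : Fin n → ℕ
      above# i = # (λ r → dec u i r ×-dec (toℕ i <? toℕ r))

      telescope : ∀ {i hi} → Acc _<_ (n ∸ toℕ i) → u [ i ~ hi ] → (∀ k → u [ i ~ k ] → k ≼ hi) → toℕ hi ≈ toℕ i + above# i
      telescope {i} {hi} (acc rs) ui-hi hi-max with any? (λ k → dec u i k ×-dec (toℕ i <? toℕ k))
      ... | no none = ≈-reflexive (trans (≤-antisym (≮⇒≥ λ lt → none (hi , ui-hi , lt)) (hi-max i (~refl u)))
                        (sym (trans (cong (toℕ i +_) (#-none (λ r → dec u i r ×-dec (toℕ i <? toℕ r)) λ k p → none (k , p))) (+-identityʳ _))))
      ... | yes above = ≈-trans (telescope (rs (∸-monoʳ-< i<i′ (<⇒≤ (toℕ<n i′)))) (~trans u (~sym u uii′) ui-hi) λ k p → hi-max k (~trans u uii′ p))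
              (≈-trans (≈-+ʳ (above# i′) (consecutive i<i′ uii′ i′-least))
                (≈-reflexive (trans (sym (+-suc (toℕ i) _)) (cong (toℕ i +_) (sym (trans
                  (#-sum (_≟ᶠ i′) (λ r → dec u i′ r ×-dec (toℕ i′ <? toℕ r)) (λ r → dec u i r ×-dec (toℕ i <? toℕ r)) split unsplit (λ { k refl (_ , lt) → <-irrefl refl lt }))
                  (cong (_+ above# i′) (#-singleton i′))))))))
        where
        next = least (λ k → dec u i k ×-dec (toℕ i <? toℕ k)) above
        i′ = proj₁ next
        uii′ = proj₁ (proj₁ (proj₂ next))
        i<i′ = proj₂ (proj₁ (proj₂ next))
        i′-least : ∀ k → u [ i ~ k ] → i ≺ k → i′ ≼ k
        i′-least k p l = proj₂ (proj₂ next) k (p , l)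
        split : ∀ r → u [ i ~ r ] × i ≺ r → r ≡ i′ ⊎ (u [ i′ ~ r ] × i′ ≺ r)
        split r (uir , i<r) with r ≟ᶠ i′
        ... | yes eq = inj₁ eq
        ... | no r≢i′ = inj₂ (~trans u (~sym u uii′) uir , ≤∧≢⇒< (i′-least r uir i<r) λ eq → r≢i′ (sym (toℕ-injective eq)))
        unsplit : ∀ r → r ≡ i′ ⊎ (u [ i′ ~ r ] × i′ ≺ r) → u [ i ~ r ] × i ≺ r
        unsplit r (inj₁ refl) = uii′ , i<i′
        unsplit r (inj₂ (p , l)) = ~trans u uii′ p , <-trans i<i′ l

    -- Going up through a block adds 1 modulo `d` at each step, and the last position is congruent
    -- to the first; so the number of steps, which is the size less 1, is divisible by `d`.
    Sizes-complement : Sizes (y ⊓ K x)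
    Sizes-complement i = subst (d ∣_) above#≡ (≈⇒∣ (≈-trans (≈-sym (telescope (<-wellFounded (n ∸ toℕ lo)) u-lohi λ k p → hi-max k (~trans u ui-lo p)))
        (extremes u-lohi λ k p → lo-min k (~trans u ui-hi p) , hi-max k (~trans u ui-hi p))))
      where
      lo = proj₁ (blockMin u i)
      hi = proj₁ (blockMax u i)
      ui-lo = proj₁ (proj₂ (blockMin u i))
      ui-hi = proj₁ (proj₂ (blockMax u i))
      lo-min = proj₂ (proj₂ (blockMin u i))
      hi-max = proj₂ (proj₂ (blockMax u i))
      u-lohi : u [ lo ~ hi ]
      u-lohi = ~trans u (~sym u ui-lo) ui-hi
      above#≡ : above# lo ≡ blockSize u i ∸ 1
      above#≡ = trans (#-cong (λ r → dec u lo r ×-dec (toℕ lo <? toℕ r)) (λ r → dec u lo r ×-dec ¬? (r ≟ᶠ lo))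
                        (λ { r (p , lt) → p , λ { refl → <-irrefl refl lt } })
                        (λ r (p , r≢lo) → p , ≤∧≢⇒< (lo-min r (~trans u ui-lo p)) λ eq → r≢lo (sym (toℕ-injective eq))))
                (trans (sym (blockSize-pred u lo))
                       (cong (_∸ 1) (#-cong (dec u lo) (dec u i) (λ r p → ~trans u ui-lo p) (λ r p → ~trans u (~sym u ui-lo) p))))

-- Intervals of noncrossing partitions

≗-trans : (x y z : Part n) → x ≗ y → y ≗ z → x ≗ z
≗-trans x y z (p , q) (p′ , q′) = p′ ∘ p , q ∘ q′

K-cong : (x y : Part n) → x ≗ y → K x ≗ K y
K-cong x y (p , q) = K-antitone y x q , K-antitone x y p

total⊓ : (x : Part n) → total ⊓ x ≗ x
total⊓ x = snd , (tt ,_)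

rank-total : rank (total {n}) ≡ n ∸ 1
rank-total {n} = trans (rank-cong {n} {total} {block {V = λ _ → ⊤} (λ _ → yes tt)} ((λ _ → both tt tt tt) , λ _ → tt))
  (trans (rank-block {n} {λ _ → ⊤} (λ _ → yes tt)) (cong (_∸ 1) (#-all {n} (λ _ → yes tt) λ _ → tt)))

rank-K : (x : Part n) → NC x → rank x + rank (K x) ≡ n ∸ 1
rank-K {n} x nc = trans (cong (rank x +_) (sym (rank-cong {x = total ⊓ K x} {K x} (total⊓ (K x)))))
  (trans (rank-+-K x total nc total-NC (λ _ → tt)) (rank-total {n}))

-- z⁻¹y = (x⁻¹z)⁻¹(x⁻¹y)
complement-complement : (x z y : Part n) → NC x → NC z → NC y → x ⊑ z → z ⊑ y →
                        y ⊓ K z ≗ (y ⊓ K x) ⊓ K (z ⊓ K x)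
complement-complement x z y ncx ncz ncy x⊑z z⊑y = sub , rank-≤⇒⊒ {x = y ⊓ K z} {u ⊓ K v} sub (≤-reflexive (sym ranks))
  where
  u = y ⊓ K x
  v = z ⊓ K x
  sub : y ⊓ K z ⊑ u ⊓ K v
  sub (p , k) = (p , K-antitone x z x⊑z k) , K-antitone v z fst k
  ranks : rank (y ⊓ K z) ≡ rank (u ⊓ K v)
  ranks = +-cancelˡ-≡ (rank x + rank v) _ _ (begin
    rank x + rank v + rank (y ⊓ K z)   ≡⟨ cong (_+ rank (y ⊓ K z)) (rank-+-K x z ncx ncz x⊑z) ⟩
    rank z + rank (y ⊓ K z)            ≡⟨ rank-+-K z y ncz ncy z⊑y ⟩
    rank y                             ≡⟨ rank-+-K x y ncx ncy (z⊑y ∘ x⊑z) ⟨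
    rank x + rank u                    ≡⟨ cong (rank x +_) (rank-+-K v u (meet-NC z (K x) ncz (K-NC x)) (meet-NC y (K x) ncy (K-NC x)) (λ (p , k) → z⊑y p , k)) ⟨
    rank x + (rank v + rank (u ⊓ K v)) ≡⟨ +-assoc (rank x) (rank v) _ ⟨
    rank x + rank v + rank (u ⊓ K v)   ∎)
    where open ≡-Reasoning

-- The case of `complement-complement` in which the upper partition is `total`.
K-of-complement : (x y : Part n) → NC x → NC y → x ⊑ y → K y ≗ K x ⊓ K (y ⊓ K x)
K-of-complement x y ncx ncy x⊑y = ≗-trans (K y) (total ⊓ K y) (K x ⊓ K (y ⊓ K x)) (≗-sym {x = total ⊓ K y} {K y} (total⊓ (K y)))
  (≗-trans (total ⊓ K y) ((total ⊓ K x) ⊓ K (y ⊓ K x)) (K x ⊓ K (y ⊓ K x))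
    (complement-complement x y total ncx ncy total-NC x⊑y (λ _ → tt))
    ((λ ((_ , p) , k) → p , k) , λ (p , k) → (tt , p) , k))

-- Together with `complement-join` this makes `z ⊓ K x` and `join x v` inverse to each other. The
-- reverse of the evident inclusion follows from the bound `rank x + rank v` for the rank of the
-- join.
join-complement : (x v : Part n) → NC x → NC v → v ⊑ K x → join x v ⊓ K x ≗ v
join-complement x v ncx ncv v⊑Kx = rank-≤⇒⊒ {x = v} {z ⊓ K x} sub (+-cancelˡ-≤ (rank x) _ _
    (≤-trans (≤-reflexive (rank-+-K x z ncx (join-NC x v ncx ncv v⊑Kx) (join-⊒ˡ x v))) (rank-join x v))) , sub
  where
  z = join x v
  sub : v ⊑ z ⊓ K x
  sub p = join-⊒ʳ x v p , v⊑Kx p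

complement-join : (x z : Part n) → NC x → NC z → x ⊑ z → join x (z ⊓ K x) ≗ z
complement-join x z ncx ncz x⊑z = join-⊑ x (z ⊓ K x) z x⊑z fst , ⊑-join-K x z ncx ncz x⊑z

module _ (d : ℕ) where
  open Indivisible d

  Good-≗ : (x y : Part n) → x ≗ y → Good x → Good y
  Good-≗ x y eq g = good (≗-NC x y eq (nc g)) (Sizes-≗ x y eq (sizes g)) (Sizes-≗ (K x) (K y) (K-cong x y eq) (sizesK g))

  -- The counterpart of `Good` relative to `u`: the dual of `v` is taken inside `u`.
  record Below (u v : Part n) : Set where
    field
      ncᵇ    : NC v
      below  : v ⊑ u
      sizesᵇ : Sizes v
      sizesᶜ : Sizes (u ⊓ K v)
  open Below public

  module _ (x y : Part n) (gx : Good x) (gy : Good y) (x⊑y : x ⊑ y) where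

    complement-Below : (z : Part n) → Good z → x ⊑ z → z ⊑ y → Below (y ⊓ K x) (z ⊓ K x)
    complement-Below z gz x⊑z z⊑y = record
      { ncᵇ = meet-NC z (K x) (nc gz) (K-NC x)
      ; below = λ (p , k) → z⊑y p , k
      ; sizesᵇ = Sizes-complement x z gx gz x⊑z
      ; sizesᶜ = Sizes-≗ (y ⊓ K z) ((y ⊓ K x) ⊓ K (z ⊓ K x)) (complement-complement x z y (nc gx) (nc gz) (nc gy) x⊑z z⊑y)
                   (Sizes-complement z y gz gy z⊑y) }

    module _ (v : Part n) (b : Below (y ⊓ K x) v) where

      private
        z = join x v
        v⊑Kx : v ⊑ K x
        v⊑Kx = snd ∘ below b
        ncz : NC z
        ncz = join-NC x v (nc gx) (ncᵇ b) v⊑Kx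
        z∖x≗v : z ⊓ K x ≗ v
        z∖x≗v = join-complement x v (nc gx) (ncᵇ b) v⊑Kx

      join-below : join x v ⊑ y
      join-below = join-⊑ x v y x⊑y (fst ∘ below b)

      -- `Sizes-⊓K` is applied twice: from `x` and `v` to the join `z`, and from z⁻¹y and `K y` to
      -- `K z`, since `K y` is the complement of z⁻¹y in `K z`.
      join-Good : Good (join x v)
      join-Good = good ncz
        (Sizes-⊓K x z (nc gx) ncz (join-⊒ˡ x v) (sizes gx) (Sizes-≗ v (z ⊓ K x) (≗-sym {x = z ⊓ K x} {v} z∖x≗v) (sizesᵇ b)))
        (Sizes-⊓K c (K z) (meet-NC y (K z) (nc gy) (K-NC z)) (K-NC z) snd sizes-c
          (Sizes-≗ (K y) (K z ⊓ K c) (K-of-complement z y ncz (nc gy) join-below) (sizesK gy)))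
        where
        c = y ⊓ K z
        sizes-c : Sizes c
        sizes-c = Sizes-≗ ((y ⊓ K x) ⊓ K v) c
          ( (λ (p , k) → proj₂ c≗ (p , proj₂ (K-cong (z ⊓ K x) v z∖x≗v) k))
          , (λ p → let (q , k) = proj₁ c≗ p in q , proj₁ (K-cong (z ⊓ K x) v z∖x≗v) k))
          (sizesᶜ b)
          where c≗ = complement-complement x z y (nc gx) ncz (nc gy) (join-⊒ˡ x v) join-below

-- Edges, and partitions restricted to an edge

AllPairs-lookup : ∀ {A : Set} {R : A → A → Set} {xs : List A} → AllPairs R xs → ∀ {i j} → i ≺ j → R (lookup xs i) (lookup xs j)
AllPairs-lookup (px ∷ pxs) {Fin.zero}  {Fin.suc j} _       = All.lookup px (∈-lookup j)
AllPairs-lookup (px ∷ pxs) {Fin.suc i} {Fin.suc j} (s≤s p) = AllPairs-lookup pxs p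

lookup-injective : ∀ {A : Set} {xs : List A} → Unique xs → ∀ {i j} → lookup xs i ≡ lookup xs j → i ≡ j
lookup-injective u {i} {j} eq with ≺⊎≽ i j | ≺⊎≽ j i
... | inj₁ i<j | _ = ⊥-elim (AllPairs-lookup u i<j eq)
... | inj₂ _ | inj₁ j<i = ⊥-elim (AllPairs-lookup u j<i (sym eq))
... | inj₂ j≤i | inj₂ i≤j = toℕ-injective (≤-antisym i≤j j≤i)

infix 4 _∈ₑ_
_∈ₑ_ : Fin n → Edge n → Set
i ∈ₑ E = Vec.lookup E i ≡ true

_∈ₑ?_ : ∀ (i : Fin n) E → Dec (i ∈ₑ E)
i ∈ₑ? E = Vec.lookup E i Boolₚ.≟ true

≡true⇒T : ∀ {b} → b ≡ true → T b
≡true⇒T refl = tt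

T⇒≡true : ∀ {b} → T b → b ≡ true
T⇒≡true {true} _ = refl

module _ {n : ℕ} (E : Edge n) where

  vertices : List (Fin n)
  vertices = filterᵇ (Vec.lookup E) (allFin n)

  vertex : Fin ∣ E ∣ₑ → Fin n
  vertex = lookup vertices

  vertex-∈ : ∀ a → vertex a ∈ₑ E
  vertex-∈ a = T⇒≡true (proj₂ (∈-filter⁻ (Boolₚ.T? ∘ Vec.lookup E) {xs = allFin n} (∈-lookup a)))

  vertex⁻¹ : ∀ {i} → i ∈ₑ E → ∃[ a ] vertex a ≡ i
  vertex⁻¹ {i} p = index m , sym (lookup-index m)
    where m = ∈-filter⁺ (Boolₚ.T? ∘ Vec.lookup E) (∈-allFin i) (≡true⇒T p)

  vertices-sorted : AllPairs (λ i j → i ≺ j) vertices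
  vertices-sorted = AllPairs.filter⁺ (Boolₚ.T? ∘ Vec.lookup E) {xs = allFin n} (AllPairs.tabulate⁺-< {f = id} λ i<j → i<j)

  vertex-mono : ∀ a b → (vertex a <ᶠ vertex b) ≡ (a <ᶠ b)
  vertex-mono a b with ≺⊎≽ a b | ≺⊎≽ b a
  ... | inj₁ a<b | _ = trans (<ᶠ-true (AllPairs-lookup vertices-sorted a<b)) (sym (<ᶠ-true a<b))
  ... | inj₂ b≤a | inj₁ b<a = trans (<ᶠ-false (<⇒≤ (AllPairs-lookup vertices-sorted b<a))) (sym (<ᶠ-false b≤a))
  ... | inj₂ b≤a | inj₂ a≤b with toℕ-injective (≤-antisym a≤b b≤a)
  ...   | refl = trans (<ᶠ-false {i = vertex a} {vertex a} ≤-refl) (sym (<ᶠ-false {i = a} {a} ≤-refl))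

  ∣_∣ₑ≡# : ∣ E ∣ₑ ≡ # (_∈ₑ? E)
  ∣_∣ₑ≡# = countᶠ≡# (_∈ₑ? E) (Vec.lookup E) (λ _ p → p) (λ _ p → p)

  #-vertex : {R : Fin n → Set} (R? : ∀ i → Dec (R i)) → (∀ i → R i → i ∈ₑ E) → # (R? ∘ vertex) ≡ # R?
  #-vertex R? R⊆E = trans (sym (∑-map (λ i → 𝟙 (R? i)) vertex (allFin ∣ E ∣ₑ)))
    (trans (cong (∑ (λ i → 𝟙 (R? i))) (trans (map-tabulate id vertex) (tabulate-lookup vertices))) (∑-filter (allFin n)))
    where
    ∑-filter : ∀ xs → ∑ (λ i → 𝟙 (R? i)) (filterᵇ (Vec.lookup E) xs) ≡ ∑ (λ i → 𝟙 (R? i)) xs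
    ∑-filter [] = refl
    ∑-filter (x ∷ xs) with Vec.lookup E x in eq
    ... | true  = cong (𝟙 (R? x) +_) (∑-filter xs)
    ... | false = trans (∑-filter xs) (cong (_+ ∑ (λ i → 𝟙 (R? i)) xs) (sym (𝟙-no (R? x) λ r → contradiction (trans (sym eq) (R⊆E x r)) λ ())))

  pull : Part n → Part ∣ E ∣ₑ
  pull v = record
    { _[_~_] = λ a b → v [ vertex a ~ vertex b ]
    ; dec = λ a b → dec v (vertex a) (vertex b)
    ; isEquivalence = record { refl = ~refl v ; sym = ~sym v ; trans = ~trans v } }

  IsBlockOf : Part n → Set
  IsBlockOf u = ∀ {i j} → i ∈ₑ E → (u [ i ~ j ] → j ∈ₑ E) × (j ∈ₑ E → u [ i ~ j ])

  pull-NC : (v : Part n) → NC v → NC (pull v)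
  pull-NC v nc {a} {c} {b} {e} p q ¬r =
    trans (sym (side-embed vertex vertex-mono a c b)) (trans (nc p q ¬r) (side-embed vertex vertex-mono a c e))

  blockSize-pull : (v : Part n) → (∀ {i j} → v [ i ~ j ] → i ∈ₑ E → j ∈ₑ E) → ∀ a → blockSize (pull v) a ≡ blockSize v (vertex a)
  blockSize-pull v closed a = #-vertex (dec v (vertex a)) λ j p → closed p (vertex-∈ a)

  -- By `K-local` only the chords of `v` inside the block `E` matter, and these are the images of
  -- the chords of `pull v`; the increasing enumeration of `E` preserves sides.
  K-pull : (u v : Part n) → IsBlockOf u → NC u → v ⊑ u → K (pull v) ≗ pull (u ⊓ K v)
  K-pull u v isBlock ncu v⊑u = to , λ { (_ , k) → unsep λ {p} {q} vpq → trans (sym (side-embed vertex vertex-mono p q _)) (trans (sameSide k vpq) (side-embed vertex vertex-mono p q _)) }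
    where
    to : K (pull v) ⊑ pull (u ⊓ K v)
    to {a} {b} k = uab , K-local v u ncu v⊑u uab chords
      where
      uab = proj₂ (isBlock (vertex-∈ a)) (vertex-∈ b)
      chords : ∀ {p q} → v [ p ~ q ] → u [ p ~ vertex a ] → side p q (vertex a) ≡ side p q (vertex b)
      chords {p} {q} vpq upa with vertex⁻¹ {p} (proj₁ (isBlock (vertex-∈ a)) (~sym u upa))
                                 | vertex⁻¹ {q} (proj₁ (isBlock (vertex-∈ a)) (~trans u (~sym u upa) (v⊑u vpq)))
      ... | p′ , refl | q′ , refl = trans (side-embed vertex vertex-mono p′ q′ a)
              (trans (sameSide k vpq) (sym (side-embed vertex vertex-mono p′ q′ b)))

module _ (d : ℕ) where
  open Indivisible d

  module _ (u v : Part n) (ncu : NC u) (v⊑u : v ⊑ u) where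

    private
      sizes-pull : (E : Edge n) → IsBlockOf E u → (w : Part n) → w ⊑ u → ∀ a → blockSize (pull E w) a ≡ blockSize w (vertex E a)
      sizes-pull E isBlock w w⊑u = blockSize-pull E w λ p i∈E → proj₁ (isBlock i∈E) (w⊑u p)

    Below⇒Good-pull : (E : Edge n) → IsBlockOf E u → Below d u v → Good (pull E v)
    Below⇒Good-pull E isBlock b = good (pull-NC E v (ncᵇ b))
      (λ a → subst (λ s → d ∣ s ∸ 1) (sym (sizes-pull E isBlock v v⊑u a)) (sizesᵇ b (vertex E a)))
      (Sizes-≗ (pull E (u ⊓ K v)) (K (pull E v)) (≗-sym {x = K (pull E v)} {pull E (u ⊓ K v)} (K-pull E u v isBlock ncu v⊑u))
        λ a → subst (λ s → d ∣ s ∸ 1) (sym (sizes-pull E isBlock (u ⊓ K v) fst a)) (sizesᶜ b (vertex E a)))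

    -- Each condition is checked on the edge through the point in question. A point on no edge is a
    -- singleton of `u`, and its block size 1 satisfies the congruence.
    Good-pull⇒Below : (A : List (Edge n)) → (∀ E → E ∈ A → IsBlockOf E u) → (∀ {i j} → u [ i ~ j ] → i ≢ j → ∃[ E ] E ∈ A × i ∈ₑ E) →
                      (∀ E → E ∈ A → Good (pull E v)) → Below d u v
    Good-pull⇒Below A isBlock cover g = record { ncᵇ = nc-v ; below = v⊑u ; sizesᵇ = sizes-v ; sizesᶜ = sizes-uKv }
      where
      nc-v : NC v
      nc-v {a} {c} {b} {e} vac vbe ¬vab with a ≟ᶠ c | dec u a b
      ... | yes refl | _ = trans (side-same a b) (sym (side-same a e))
      ... | no a≢c | no ¬uab = ncu (v⊑u vac) (v⊑u vbe) ¬uab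
      ... | no a≢c | yes uab with cover (v⊑u vac) a≢c
      ...   | E , E∈A , a∈E with vertex⁻¹ E a∈E | vertex⁻¹ E (proj₁ (isBlock E E∈A a∈E) (v⊑u vac))
                               | vertex⁻¹ E (proj₁ (isBlock E E∈A a∈E) uab) | vertex⁻¹ E (proj₁ (isBlock E E∈A a∈E) (~trans u uab (v⊑u vbe)))
      ...     | a′ , refl | c′ , refl | b′ , refl | e′ , refl =
                trans (side-embed (vertex E) (vertex-mono E) a′ c′ b′) (trans (nc (g E E∈A) vac vbe ¬vab) (sym (side-embed (vertex E) (vertex-mono E) a′ c′ e′)))
      sizes-of : (w : Part n) → w ⊑ u → (∀ E → E ∈ A → Sizes (pull E w)) → Sizes w
      sizes-of w w⊑u h i with any? (λ j → dec w i j ×-dec ¬? (j ≟ᶠ i))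
      ... | no none = ∣blockSize-singleton w λ j p → decidable-stable (j ≟ᶠ i) λ neq → none (j , p , neq)
      ... | yes (j , wij , j≢i) with cover (w⊑u wij) (j≢i ∘ sym)
      ...   | E , E∈A , i∈E with vertex⁻¹ E i∈E
      ...     | a , refl = subst (λ s → d ∣ s ∸ 1) (sizes-pull E (isBlock E E∈A) w w⊑u a) (h E E∈A a)
      sizes-v : Sizes v
      sizes-v = sizes-of v v⊑u λ E E∈A → sizes (g E E∈A)
      sizes-uKv : Sizes (u ⊓ K v)
      sizes-uKv = sizes-of (u ⊓ K v) fst λ E E∈A →
        Sizes-≗ (K (pull E v)) (pull E (u ⊓ K v)) (K-pull E u v (isBlock E E∈A) ncu v⊑u) (sizesK (g E E∈A))

-- Noncrossing hypertrees

∑-++ : ∀ (f : A → ℕ) xs ys → ∑ f (xs ++ ys) ≡ ∑ f xs + ∑ f ys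
∑-++ f []       ys = refl
∑-++ f (x ∷ xs) ys = trans (cong (f x +_) (∑-++ f xs ys)) (sym (+-assoc (f x) _ _))

∑-↭ : ∀ (f : A → ℕ) {xs ys} → xs ↭ ys → ∑ f xs ≡ ∑ f ys
∑-↭ f ↭-refl       = refl
∑-↭ f (prep x p)   = cong (f x +_) (∑-↭ f p)
∑-↭ f (swap {xs = xs} {ys} x y p) = trans (cong (λ s → f x + (f y + s)) (∑-↭ f p))
  (trans (sym (+-assoc (f x) (f y) _)) (trans (cong (_+ ∑ f ys) (+-comm (f x) (f y))) (+-assoc (f y) (f x) _)))
∑-↭ f (↭-step p q) = trans (∑-↭ f p) (∑-↭ f q)

unique-↭ : ∀ {xs ys : List A} → Unique xs → Unique ys → (∀ {x} → x ∈ xs → x ∈ ys) → (∀ {x} → x ∈ ys → x ∈ xs) → xs ↭ ys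
unique-↭ u v h k = ∼bag⇒↭ (unique∧set⇒bag u v (mk⇔ h k))

filter-↭ : ∀ {R : A → Set} (R? : ∀ x → Dec (R x)) xs → xs ↭ filter R? xs ++ filter (λ x → ¬? (R? x)) xs
filter-↭ R? [] = ↭-refl
filter-↭ R? (x ∷ xs) with R? x
... | yes _ = prep x (filter-↭ R? xs)
... | no _  = ↭-trans (prep x (filter-↭ R? xs)) (↭-sym (shift x (filter R? xs) _))

_≟ₑ_ : (E F : Edge n) → Dec (E ≡ F)
_≟ₑ_ = ≡-dec Boolₚ._≟_

Vec-ext : {E F : Vec A n} → (∀ i → Vec.lookup E i ≡ Vec.lookup F i) → E ≡ F
Vec-ext {E = E} {F} h = trans (sym (tabulate∘lookup E)) (trans (tabulate-cong h) (tabulate∘lookup F))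

Edge-ext : {E F : Edge n} → (∀ {i} → i ∈ₑ E → i ∈ₑ F) → (∀ {i} → i ∈ₑ F → i ∈ₑ E) → E ≡ F
Edge-ext h k = Vec-ext λ i → ≡-iff (h {i}) (k {i})

edgePart : Edge n → Part n
edgePart E = block (_∈ₑ? E)

rank-edgePart : (E : Edge n) → rank (edgePart E) ≡ ∣ E ∣ₑ ∸ 1
rank-edgePart E = trans (rank-block (_∈ₑ? E)) (cong (_∸ 1) (sym (∣_∣ₑ≡# E)))

two-vertices : (E : Edge n) → 2 ≤ ∣ E ∣ₑ → ∃[ a ] ∃[ b ] a ∈ₑ E × b ∈ₑ E × a ≺ b
two-vertices E 2≤ = vertex E (fromℕ< (<⇒≤ 2≤)) , vertex E (fromℕ< 2≤) , vertex-∈ E _ , vertex-∈ E _ ,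
  AllPairs-lookup (vertices-sorted E) (subst₂ _<_ (sym (toℕ-fromℕ< (<⇒≤ 2≤))) (sym (toℕ-fromℕ< 2≤)) (s≤s z≤n))

other-vertex : (E : Edge n) → 2 ≤ ∣ E ∣ₑ → ∀ v → ∃[ b ] b ∈ₑ E × b ≢ v
other-vertex E 2≤ v with two-vertices E 2≤
... | a , b , a∈E , b∈E , a<b with a ≟ᶠ v
...   | no a≢v = a , a∈E , a≢v
...   | yes refl = b , b∈E , λ { refl → <-irrefl refl a<b }

weight : List (Edge n) → ℕ
weight = ∑ (λ E → ∣ E ∣ₑ ∸ 1)

-- Since `p` already connects `u` with `v`, adding `E` without `u` connects as much, at a cost lower
-- by one.
rank-join-edge-< : (p : Part n) (E : Edge n) → ∀ {u v} → u ∈ₑ E → v ∈ₑ E → u ≢ v → p [ u ~ v ] →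
                   rank (join p (edgePart E)) < ∣ E ∣ₑ ∸ 1 + rank p
rank-join-edge-< {n} p E {u} {v} u∈E v∈E u≢v puv = begin-strict
  rank (join p (edgePart E))    ≤⟨ rank-mono {x = join p (edgePart E)} {q} (join-⊑ p (edgePart E) q (join-⊒ˡ p (block V?)) edge⊑q) ⟩
  rank q                        ≤⟨ rank-join p (block V?) ⟩
  rank p + rank (block V?)      ≡⟨ +-comm (rank p) _ ⟩
  rank (block V?) + rank p      ≡⟨ cong (_+ rank p) (rank-block V?) ⟩
  # V? ∸ 1 + rank p             <⟨ +-monoˡ-< (rank p) (∸-monoʳ-< {o = 0} (s≤s z≤n) 1≤#V) ⟩
  # V? + rank p                 ≡⟨ cong (λ k → k ∸ 1 + rank p) #E ⟨
  ∣ E ∣ₑ ∸ 1 + rank p           ∎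
  where
  open ≤-Reasoning
  V : Fin n → Set
  V i = i ∈ₑ E × i ≢ u
  V? : ∀ i → Dec (V i)
  V? i = (i ∈ₑ? E) ×-dec ¬? (i ≟ᶠ u)
  q = join p (block V?)
  v∈V : V v
  v∈V = v∈E , u≢v ∘ sym
  1≤#V : 1 ≤ # V?
  1≤#V = ≤-trans (≤-reflexive (sym (𝟙-yes (V? v) v∈V))) (∈⇒≤∑ (λ i → 𝟙 (V? i)) (∈-allFin v))
  split : ∀ i → i ∈ₑ E → i ≡ u ⊎ V i
  split i i∈E with i ≟ᶠ u
  ... | yes eq = inj₁ eq
  ... | no neq = inj₂ (i∈E , neq)
  #E : ∣ E ∣ₑ ≡ suc (# V?)
  #E = trans (∣_∣ₑ≡# E) (trans (#-sum (_≟ᶠ u) V? (_∈ₑ? E) split (λ { i (inj₁ refl) → u∈E ; i (inj₂ (m , _)) → m }) (λ { i refl (_ , neq) → neq refl }))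
         (cong (_+ # V?) (#-singleton u)))
  to-v : ∀ {i} → i ∈ₑ E → q [ i ~ v ]
  to-v {i} i∈E with split i i∈E
  ... | inj₁ refl = join-⊒ˡ p (block V?) puv
  ... | inj₂ w = join-⊒ʳ p (block V?) (both tt w v∈V)
  edge⊑q : edgePart E ⊑ q
  edge⊑q same = ~refl q
  edge⊑q (both _ a b) = ~trans q (to-v a) (~sym q (to-v b))

abstract
  -- The partition into connected components. Adding one edge at a time bounds its rank by the
  -- weight; equality characterizes forests.
  comp : List (Edge n) → Part n
  comp []      = Δ
  comp (E ∷ T) = join (comp T) (edgePart E)

  comp-edge : ∀ {T : List (Edge n)} {E i j} → E ∈ T → i ∈ₑ E → j ∈ₑ E → comp T [ i ~ j ]
  comp-edge {T = E ∷ T} (here refl) p q = join-⊒ʳ (comp T) (edgePart E) (both tt p q)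
  comp-edge {T = E ∷ T} (there m)   p q = join-⊒ˡ (comp T) (edgePart E) (comp-edge m p q)

  comp-least : ∀ (T : List (Edge n)) {Q : Fin n → Fin n → Set} → IsEquivalence Q →
               (∀ {E i j} → E ∈ T → i ∈ₑ E → j ∈ₑ E → Q i j) → ∀ {i j} → comp T [ i ~ j ] → Q i j
  comp-least [] eq h refl = IsEquivalence.refl eq
  comp-least (E ∷ T) eq h = join-least (comp T) (edgePart E) eq (comp-least T eq (h ∘ there))
    λ { same → IsEquivalence.refl eq ; (both _ p q) → h (here refl) p q }

  rank-comp : (T : List (Edge n)) → rank (comp T) ≤ weight T
  rank-comp {n} [] = ≤-reflexive (#-none (nonMin? (Δ {n})) λ { i (j , j<i , refl) → <-irrefl refl j<i })
  rank-comp (E ∷ T) = begin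
    rank (join (comp T) (edgePart E))     ≤⟨ rank-join (comp T) (edgePart E) ⟩
    rank (comp T) + rank (edgePart E)     ≡⟨ +-comm (rank (comp T)) _ ⟩
    rank (edgePart E) + rank (comp T)     ≤⟨ +-mono-≤ (≤-reflexive (rank-edgePart E)) (rank-comp T) ⟩
    ∣ E ∣ₑ ∸ 1 + weight T                 ∎
    where open ≤-Reasoning

  -- Two edges with two common vertices form a cycle: whichever of them is added later finds two of
  -- its vertices already connected.
  rank-comp-< : ∀ {T : List (Edge n)} {E F u v} → E ∈ T → F ∈ T → E ≢ F → u ∈ₑ E → u ∈ₑ F → v ∈ₑ E → v ∈ₑ F → u ≢ v → rank (comp T) < weight T
  rank-comp-< (here refl) (here refl) E≢F _ _ _ _ _ = ⊥-elim (E≢F refl)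
  rank-comp-< {T = E ∷ T} (here refl) (there F∈T) E≢F uE uF vE vF u≢v =
    <-≤-trans (rank-join-edge-< (comp T) E uE vE u≢v (comp-edge F∈T uF vF)) (+-monoʳ-≤ _ (rank-comp T))
  rank-comp-< {T = F ∷ T} (there E∈T) (here refl) E≢F uE uF vE vF u≢v =
    <-≤-trans (rank-join-edge-< (comp T) F uF vF u≢v (comp-edge E∈T uE vE)) (+-monoʳ-≤ _ (rank-comp T))
  rank-comp-< {T = G ∷ T} (there E∈T) (there F∈T) E≢F uE uF vE vF u≢v = begin-strict
    rank (join (comp T) (edgePart G))   ≤⟨ rank-join (comp T) (edgePart G) ⟩
    rank (comp T) + rank (edgePart G)   ≡⟨ +-comm (rank (comp T)) _ ⟩
    rank (edgePart G) + rank (comp T)   ≡⟨ cong (_+ rank (comp T)) (rank-edgePart G) ⟩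
    ∣ G ∣ₑ ∸ 1 + rank (comp T)          <⟨ +-monoʳ-< (∣ G ∣ₑ ∸ 1) (rank-comp-< E∈T F∈T E≢F uE uF vE vF u≢v) ⟩
    ∣ G ∣ₑ ∸ 1 + weight T               ∎
    where open ≤-Reasoning

comp-⊑ : ∀ (T : List (Edge n)) (q : Part n) → (∀ {E i j} → E ∈ T → i ∈ₑ E → j ∈ₑ E → q [ i ~ j ]) → comp T ⊑ q
comp-⊑ T q = comp-least T (isEquivalence q)

comp-mono : ∀ {T T′ : List (Edge n)} → (∀ {E} → E ∈ T → E ∈ T′) → comp T ⊑ comp T′
comp-mono {T = T} {T′} h = comp-⊑ T (comp T′) λ m p q → comp-edge (h m) p q

rank-comp-++ : ∀ {T : List (Edge n)} A B → T ↭ A ++ B → rank (comp T) ≤ rank (comp A) + rank (comp B)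
rank-comp-++ {T = T} A B T↭ = ≤-trans
  (rank-mono {x = comp T} {join (comp A) (comp B)} (comp-⊑ T (join (comp A) (comp B)) λ m p q → edge (∈-++⁻ A (∈-resp-↭ T↭ m)) p q))
  (rank-join (comp A) (comp B))
  where
  edge : ∀ {E i j} → E ∈ A ⊎ E ∈ B → i ∈ₑ E → j ∈ₑ E → join (comp A) (comp B) [ i ~ j ]
  edge (inj₁ m) p q = join-⊒ˡ (comp A) (comp B) (comp-edge m p q)
  edge (inj₂ m) p q = join-⊒ʳ (comp A) (comp B) (comp-edge m p q)

weight-++ : ∀ {T : List (Edge n)} A B → T ↭ A ++ B → weight T ≡ weight A + weight B
weight-++ A B T↭ = trans (∑-↭ (λ E → ∣ E ∣ₑ ∸ 1) T↭) (∑-++ (λ E → ∣ E ∣ₑ ∸ 1) A B)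

-- Weights are additive and ranks subadditive, so equality for the whole forces equality for both
-- parts.
acyclic-++ : ∀ {T : List (Edge n)} A B → T ↭ A ++ B → rank (comp T) ≡ weight T → rank (comp A) ≡ weight A × rank (comp B) ≡ weight B
acyclic-++ {T = T} A B T↭ eq = tight (rank-comp A) (rank-comp B)
  (≤-trans (≤-reflexive (trans (sym (weight-++ A B T↭)) (sym eq))) (rank-comp-++ A B T↭))
  where
  tight : ∀ {a b c d} → a ≤ c → b ≤ d → c + d ≤ a + b → a ≡ c × b ≡ d
  tight {a} {b} {c} {d} a≤c b≤d le =
    ≤-antisym a≤c (+-cancelʳ-≤ d c a (≤-trans le (+-monoʳ-≤ a b≤d))) ,
    ≤-antisym b≤d (+-cancelˡ-≤ c d b (≤-trans le (+-monoˡ-≤ b a≤c)))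

Noncrossing : List (Edge n) → Set
Noncrossing T = ∀ {E F} → E ∈ T → F ∈ T → E ≢ F → ∀ {a c b e} → a ∈ₑ E → c ∈ₑ E → b ∈ₑ F → e ∈ₑ F →
                a ≢ b → a ≢ e → c ≢ b → c ≢ e → side a c b ≡ side a c e

comp-NC : (T : List (Edge n)) → Noncrossing T → NC (comp T)
comp-NC {n} T ncT = generated-NC (comp T) R (λ (E , m , p , q) → comp-edge m p q) (λ eq h → comp-least T eq λ m p q → h (_ , m , p , q)) cross
  where
  R : Fin n → Fin n → Set
  R i j = ∃[ E ] E ∈ T × i ∈ₑ E × j ∈ₑ E
  cross : ∀ {a c b e} → R a c → R b e → ¬ comp T [ a ~ b ] → side a c b ≡ side a c e
  cross (E , m , p , q) (F , m′ , p′ , q′) ¬ab with E ≟ₑ F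
  ... | yes refl = ⊥-elim (¬ab (comp-edge m p p′))
  ... | no E≢F = ncT m m′ E≢F p q p′ q′
    (λ { refl → ¬ab (~refl (comp T)) }) (λ { refl → ¬ab (comp-edge m′ q′ p′) }) (λ { refl → ¬ab (comp-edge m p q) })
    (λ { refl → ¬ab (~trans (comp T) (comp-edge m p q) (comp-edge m′ q′ p′)) })

module _ (d : ℕ) where
  open Indivisible d

  -- The edges `T₁` that meet the component `C` of `i` are again acyclic and have `C` as their only
  -- component with an edge. Hence the size of `C` less 1 is the weight of `T₁`.
  acyclic⇒Sizes : (T : List (Edge n)) → rank (comp T) ≡ weight T → (∀ E → E ∈ T → d ∣ ∣ E ∣ₑ ∸ 1) → Sizes (comp T)
  acyclic⇒Sizes {n} T acyclic sizesT i = subst (d ∣_)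
    (trans (sym (proj₁ (acyclic-++ T₁ (filter (λ E → ¬? (inC? E)) T) (filter-↭ inC? T) acyclic))) (trans (rank-cong {x = comp T₁} {block C?} (T₁⊑ , ⊑T₁)) (rank-block C?)))
    (∑-∣ T₁ λ E m → sizesT E (proj₁ (∈-filter⁻ inC? {xs = T} m)))
    where
    C : Fin n → Set
    C k = comp T [ i ~ k ]
    C? = dec (comp T) i
    inC? : (E : Edge n) → Dec (∃[ k ] k ∈ₑ E × C k)
    inC? E = any? λ k → (k ∈ₑ? E) ×-dec C? k
    T₁ = filter inC? T
    T₁⊑ : comp T₁ ⊑ block C?
    T₁⊑ = comp-⊑ T₁ (block C?) λ m p q → let (m′ , k , k∈E , Ck) = ∈-filter⁻ inC? {xs = T} m in
      both tt (~trans (comp T) Ck (comp-edge m′ k∈E p)) (~trans (comp T) Ck (comp-edge m′ k∈E q))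
    -- All points outside `C` are lumped together, so that the edges missing `C` respect `Q` and
    -- `comp-least` yields connections by edges of `T₁` within `C`.
    Q : Fin n → Fin n → Set
    Q a b = comp T₁ [ a ~ b ] ⊎ (¬ C a × ¬ C b)
    T₁⊑T : comp T₁ ⊑ comp T
    T₁⊑T = comp-mono λ m → proj₁ (∈-filter⁻ inC? {xs = T} m)
    Q-equiv : IsEquivalence Q
    Q-equiv = record
      { refl = inj₁ (~refl (comp T₁))
      ; sym = λ { (inj₁ p) → inj₁ (~sym (comp T₁) p) ; (inj₂ (p , q)) → inj₂ (q , p) }
      ; trans = λ { (inj₁ p) (inj₁ q) → inj₁ (~trans (comp T₁) p q)
                  ; (inj₁ p) (inj₂ (q , r)) → inj₂ ((λ Ca → q (~trans (comp T) Ca (T₁⊑T p))) , r)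
                  ; (inj₂ (p , q)) (inj₁ r) → inj₂ (p , λ Cc → q (~trans (comp T) Cc (~sym (comp T) (T₁⊑T r))))
                  ; (inj₂ (p , _)) (inj₂ (_ , r)) → inj₂ (p , r) } }
    edge-Q : ∀ {E a b} → E ∈ T → a ∈ₑ E → b ∈ₑ E → Q a b
    edge-Q {E} {a} {b} m p q with inC? E
    ... | yes inC = inj₁ (comp-edge (∈-filter⁺ inC? m inC) p q)
    ... | no ¬inC = inj₂ ((λ Ca → ¬inC (a , p , Ca)) , λ Cb → ¬inC (b , q , Cb))
    from-i : ∀ {a} → C a → comp T₁ [ i ~ a ]
    from-i Ca with comp-least T Q-equiv edge-Q Ca
    ... | inj₁ p = p
    ... | inj₂ (_ , ¬Ca) = ⊥-elim (¬Ca Ca)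
    ⊑T₁ : block C? ⊑ comp T₁
    ⊑T₁ same = ~refl (comp T₁)
    ⊑T₁ (both _ p q) = ~trans (comp T₁) (~sym (comp T₁) (from-i p)) (from-i q)

-- Compatible edges, forests and minimal edges

side-separates : ∀ {a b : Fin n} → a ≢ b → side a b a ≢ side a b b
side-separates {a = a} {b} a≢b eq with ≺⊎≽ a b
... | inj₁ a<b = contradiction (trans (sym (side-in ≤-refl a<b)) (trans eq (side-above (<⇒≤ a<b) ≤-refl))) λ ()
... | inj₂ b≤a = contradiction (trans (sym (side-above ≤-refl b≤a)) (trans eq (trans (side-comm a b b) (side-in ≤-refl b<a)))) λ ()
  where b<a = ≤∧≢⇒< b≤a λ e → a≢b (sym (toℕ-injective e))

-- Compatible E F says that E (on unprimed points) and F (on primed points) do not cross.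
Compatible : Edge n → Edge n → Set
Compatible E F = ∀ {a b i j} → a ∈ₑ E → b ∈ₑ E → i ∈ₑ F → j ∈ₑ F → side a b i ≡ side a b j

-- In a noncrossing hypergraph the condition holds for edges disjoint from `E` anyway; its content
-- lies at the vertices that `E` shares with other edges.
Minimal : List (Edge n) → Edge n → Set
Minimal T E = ∀ {F} → F ∈ T → F ≢ E → Compatible E F

-- As `v′` comes directly after `v`, compatibility of `E` with `F` at a common vertex `v` means
-- that, cyclically from `v`, the other vertices of `F` precede those of `E`. This cannot hold in
-- both directions.
Compatible-disjoint : (E F : Edge n) → 2 ≤ ∣ E ∣ₑ → 2 ≤ ∣ F ∣ₑ → Compatible E F → Compatible F E → ∀ {v} → v ∈ₑ E → ¬ v ∈ₑ F
Compatible-disjoint E F 2≤E 2≤F EF FE {v} v∈E v∈F with other-vertex E 2≤E v | other-vertex F 2≤F v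
... | b , b∈E , b≢v | j , j∈F , j≢v with b ≟ᶠ j
...   | yes refl = side-separates (b≢v ∘ sym) (EF v∈E b∈E v∈F j∈F)
...   | no b≢j = cases (≺⊎≽ v b) (≺⊎≽ v j)
  where
  strict : ∀ {a c : Fin _} → a ≼ c → a ≢ c → a ≺ c
  strict a≤c a≢c = ≤∧≢⇒< a≤c (a≢c ∘ toℕ-injective)
  eq₁ : side v b v ≡ side v b j
  eq₁ = EF v∈E b∈E v∈F j∈F
  eq₂ : side v j v ≡ side v j b
  eq₂ = FE v∈F j∈F v∈E b∈E
  cases : v ≺ b ⊎ b ≼ v → v ≺ j ⊎ j ≼ v → ⊥
  cases (inj₁ v<b) (inj₁ v<j) = <-asym (proj₂ (side-true-≼⁻ (<⇒≤ v<b) (trans (sym eq₁) (side-in ≤-refl v<b))))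
                                       (proj₂ (side-true-≼⁻ (<⇒≤ v<j) (trans (sym eq₂) (side-in ≤-refl v<j))))
  cases (inj₁ v<b) (inj₂ j≤v) = contradiction (trans (sym (side-in ≤-refl v<b)) (trans eq₁ (side-below (strict j≤v j≢v) (≤-<-trans j≤v v<b)))) λ ()
  cases (inj₂ b≤v) (inj₁ v<j) = contradiction (trans (sym (side-in ≤-refl v<j)) (trans eq₂ (side-below (strict b≤v b≢v) (≤-<-trans b≤v v<j)))) λ ()
  cases (inj₂ b≤v) (inj₂ j≤v) with ≺⊎≽ b j
  ... | inj₁ b<j = contradiction (trans (sym (side-above ≤-refl b≤v)) (trans eq₁ (trans (side-comm v b j) (side-in (<⇒≤ b<j) (strict j≤v j≢v))))) λ ()
  ... | inj₂ j≤b = contradiction (trans (sym (side-above ≤-refl j≤v)) (trans eq₂ (trans (side-comm v j b) (side-in j≤b (strict b≤v b≢v))))) λ ()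

module _ (d : ℕ) where
  open Indivisible d

  record Forest (T : List (Edge n)) (w : Part n) : Set where
    field
      noncrossing : Noncrossing T
      spans       : comp T ≗ w
      -- In the presence of `spans` this is acyclicity; for `w = total` it is the numerical
      -- condition on hypertrees.
      weight≡rank : weight T ≡ rank w
      edgeSizes   : ∀ E → E ∈ T → d ∣ ∣ E ∣ₑ ∸ 1
      edge≥2      : ∀ E → E ∈ T → 2 ≤ ∣ E ∣ₑ

    acyclic : rank (comp T) ≡ weight T
    acyclic = trans (rank-cong {x = comp T} {w} spans) (sym weight≡rank)
  open Forest public

  -- `A` lists the nontrivial blocks of `u`: `block≥2` excludes the singletons and also the empty
  -- edge, for which `IsBlockOf` holds vacuously.
  record Blocks (A : List (Edge n)) (u : Part n) : Set where
    field
      unique  : Unique A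
      isBlock : ∀ E → E ∈ A → IsBlockOf E u
      cover   : ∀ {i j} → u [ i ~ j ] → i ≢ j → ∃[ E ] E ∈ A × i ∈ₑ E
      block≥2 : ∀ E → E ∈ A → 2 ≤ ∣ E ∣ₑ
  open Blocks public

  block-unique : {u : Part n} {E F : Edge n} → IsBlockOf E u → IsBlockOf F u → ∀ {a b} → a ∈ₑ E → b ∈ₑ F → u [ a ~ b ] → E ≡ F
  block-unique {u = u} bE bF a∈E b∈F uab = Edge-ext
    (λ i∈E → proj₁ (bF b∈F) (~trans u (~sym u uab) (proj₂ (bE a∈E) i∈E)))
    (λ i∈F → proj₁ (bE a∈E) (~trans u uab (proj₂ (bF b∈F) i∈F)))

  -- The weight is at most the rank since a nonminimal element of `u` lies on at most one listed
  -- edge, and at least the rank since the edges generate `u`.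
  Blocks⇒weight : (A : List (Edge n)) (u : Part n) → Blocks A u → weight A ≡ rank u
  Blocks⇒weight {n} A u B = ≤-antisym upper (≤-trans (rank-mono {x = u} {comp A} u⊑) (rank-comp A))
    where
    u⊑ : u ⊑ comp A
    u⊑ {i} {j} uij with i ≟ᶠ j
    ... | yes refl = ~refl (comp A)
    ... | no i≢j = let (E , m , i∈E) = cover B uij i≢j in comp-edge m i∈E (proj₁ (isBlock B E m i∈E) uij)
    nm∈? : ∀ E i → Dec (i ∈ₑ E × NonMin u i)
    nm∈? E i = (i ∈ₑ? E) ×-dec nonMin? u i
    inEdge : ∀ E → E ∈ A → ∀ i → NonMin (edgePart E) i → i ∈ₑ E × NonMin u i
    inEdge E m i (j , j<i , same) = ⊥-elim (<-irrefl refl j<i)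
    inEdge E m i (j , j<i , both _ p q) = p , j , j<i , proj₂ (isBlock B E m p) q
    atMostOne : ∀ i → ∑ (λ E → 𝟙 (nm∈? E i)) A ≤ 𝟙 (nonMin? u i)
    atMostOne i = go (nonMin? u i)
      where
      go : (nm : Dec (NonMin u i)) → ∑ (λ E → 𝟙 (nm∈? E i)) A ≤ 𝟙 nm
      go (no ¬nm) = ≤-reflexive (∑-zero A λ E _ → 𝟙-no (nm∈? E i) (¬nm ∘ proj₂))
      go (yes nm) = ∑-𝟙-≤1 (λ E → nm∈? E i) (unique B) λ E F m m′ (p , _) (q , _) → block-unique {u = u} (isBlock B E m) (isBlock B F m′) p q (~refl u)
    upper : weight A ≤ rank u
    upper = begin
      weight A                                                 ≡⟨ ∑-cong A (λ E _ → sym (rank-edgePart E)) ⟩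
      ∑ (λ E → rank (edgePart E)) A                            ≤⟨ ∑-mono A (λ E m → #-mono (nonMin? (edgePart E)) (nm∈? E) (inEdge E m)) ⟩
      ∑ (λ E → ∑ (λ i → 𝟙 (nm∈? E i)) (allFin n)) A            ≡⟨ ∑-swap (λ E i → 𝟙 (nm∈? E i)) A (allFin n) ⟩
      ∑ (λ i → ∑ (λ E → 𝟙 (nm∈? E i)) A) (allFin n)            ≤⟨ ∑-mono (allFin n) (λ i _ → atMostOne i) ⟩
      rank u                                                   ∎
      where open ≤-Reasoning

  module _ (x : Part n) (gx : Good x) {T A T′ : List (Edge n)} (T↭ : T ↭ A ++ T′) where

    private
      A⊆T : ∀ {E} → E ∈ A → E ∈ T
      A⊆T m = ∈-resp-↭ (↭-sym T↭) (∈-++⁺ˡ m)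
      T′⊆T : ∀ {E} → E ∈ T′ → E ∈ T
      T′⊆T m = ∈-resp-↭ (↭-sym T↭) (∈-++⁺ʳ A m)
      T⊆ : ∀ {E} → E ∈ T → E ∈ A ⊎ E ∈ T′
      T⊆ m = ∈-++⁻ A (∈-resp-↭ T↭ m)

    module _ (y : Part n) (gy : Good y) (x⊑y : x ⊑ y) (B : Blocks A (y ⊓ K x)) (F′ : Forest T′ (K y)) where

      private
        u = y ⊓ K x
        ncu : NC u
        ncu = meet-NC y (K x) (nc gy) (K-NC x)

        T′⊑Ky : ∀ {E i j} → E ∈ T′ → i ∈ₑ E → j ∈ₑ E → K y [ i ~ j ]
        T′⊑Ky m p q = proj₁ (spans F′) (comp-edge m p q)

        A-T′ : ∀ {E F} → E ∈ A → F ∈ T′ → Compatible E F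
        A-T′ {E} m m′ a b i j = sameSide (T′⊑Ky m′ i j) (fst (proj₂ (isBlock B E m a) b))

        A-A : ∀ {E F} → E ∈ A → F ∈ A → E ≢ F → Compatible E F
        A-A {E} {F} m m′ E≢F a b i j = ncu (proj₂ (isBlock B E m a) b) (proj₂ (isBlock B F m′ i) j)
          λ uai → E≢F (block-unique {u = u} (isBlock B E m) (isBlock B F m′) a i uai)

      -- Pairs of points of `E` are chords of `y`, which do not separate the edges of `T′` because
      -- these lie in blocks of `K y`; another edge of `A` is a different block of the noncrossing
      -- partition `u`.
      glue-minimal : ∀ {E} → E ∈ A → Minimal T E
      glue-minimal m m′ F≢E with T⊆ m′
      ... | inj₁ F∈A  = A-A m F∈A (F≢E ∘ sym)
      ... | inj₂ F∈T′ = A-T′ m F∈T′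

      glue-forest : Forest T (K x)
      glue-forest = record
        { noncrossing = nct
        ; spans = comp-⊑ T (K x) (λ m p q → edge⊑ (T⊆ m) p q) , Kx⊑
        ; weight≡rank = begin
            weight T                   ≡⟨ weight-++ A T′ T↭ ⟩
            weight A + weight T′       ≡⟨ cong₂ _+_ (Blocks⇒weight A u B) (weight≡rank F′) ⟩
            rank u + rank (K y)        ≡⟨ cong (rank u +_) (rank-cong {x = K y} {K x ⊓ K u} Ky≗) ⟩
            rank u + rank (K x ⊓ K u)  ≡⟨ rank-+-K u (K x) ncu (K-NC x) snd ⟩
            rank (K x)                 ∎
        ; edgeSizes = λ E m → sizesT E (T⊆ m)
        ; edge≥2 = λ E m → [ block≥2 B E , edge≥2 F′ E ]′ (T⊆ m) }
        where
        open ≡-Reasoning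
        Ky≗ : K y ≗ K x ⊓ K u
        Ky≗ = K-of-complement x y (nc gx) (nc gy) x⊑y
        nct : Noncrossing T
        nct m m′ E≢F p q p′ q′ a≢b a≢e c≢b c≢e with T⊆ m | T⊆ m′
        ... | inj₁ mA | _ = glue-minimal mA m′ (E≢F ∘ sym) p q p′ q′
        ... | inj₂ mT | inj₁ mA = side-flip a≢b a≢e c≢b c≢e (A-T′ mA mT p′ q′ p q)
        ... | inj₂ mT | inj₂ mT′ = noncrossing F′ mT mT′ E≢F p q p′ q′ a≢b a≢e c≢b c≢e
        edge⊑ : ∀ {E i j} → E ∈ A ⊎ E ∈ T′ → i ∈ₑ E → j ∈ₑ E → K x [ i ~ j ]
        edge⊑ {E} (inj₁ m) p q = snd (proj₂ (isBlock B E m p) q)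
        edge⊑ (inj₂ m) p q = K-antitone x y x⊑y (T′⊑Ky m p q)
        u⊑T : u ⊑ comp T
        u⊑T {i} {j} uij with i ≟ᶠ j
        ... | yes refl = ~refl (comp T)
        ... | no i≢j = let (E , m , i∈E) = cover B uij i≢j in comp-edge (A⊆T m) i∈E (proj₁ (isBlock B E m i∈E) uij)
        Kx⊑ : K x ⊑ comp T
        Kx⊑ p = join-⊑ u (K x ⊓ K u) (comp T) u⊑T (λ q → comp-mono T′⊆T (proj₂ (spans F′) (proj₂ Ky≗ q))) (⊑-join-K u (K x) ncu (K-NC x) snd p)
        sizesT : ∀ E → E ∈ A ⊎ E ∈ T′ → d ∣ ∣ E ∣ₑ ∸ 1
        sizesT E (inj₂ m) = edgeSizes F′ E m
        sizesT E (inj₁ m) with two-vertices E (block≥2 B E m)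
        ... | a , _ , a∈E , _ = subst (λ k → d ∣ k ∸ 1)
          (trans (#-cong (dec u a) (_∈ₑ? E) (λ j → proj₁ (isBlock B E m a∈E)) (λ j → proj₂ (isBlock B E m a∈E))) (sym (∣_∣ₑ≡# E)))
          (Sizes-complement x y gx gy x⊑y a)

    module _ (uniqueA : Unique A) (A∩T′ : ∀ {E} → E ∈ A → ¬ E ∈ T′) (FT : Forest T (K x)) (minA : ∀ {E} → E ∈ A → Minimal T E) where

      -- The `y` recovered from `T` and `A`, with `comp A` as x⁻¹y. Minimal edges are pairwise
      -- disjoint, so the edges of `A` become exactly the nontrivial blocks of x⁻¹y.
      cut : Part n
      cut = join x (comp A)

      private
        ncA : NC (comp A)
        ncA = comp-NC A λ m m′ → noncrossing FT (A⊆T m) (A⊆T m′)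
        A⊑Kx : comp A ⊑ K x
        A⊑Kx p = proj₁ (spans FT) (comp-mono A⊆T p)
        ncy : NC cut
        ncy = join-NC x (comp A) (nc gx) ncA A⊑Kx
        acyclicA : rank (comp A) ≡ weight A
        acyclicA = proj₁ (acyclic-++ A T′ T↭ (acyclic FT))
        acyclicT′ : rank (comp T′) ≡ weight T′
        acyclicT′ = proj₂ (acyclic-++ A T′ T↭ (acyclic FT))

        disjoint : ∀ {E F v} → E ∈ A → F ∈ A → v ∈ₑ E → v ∈ₑ F → E ≡ F
        disjoint {E} {F} m m′ p q with E ≟ₑ F
        ... | yes eq = eq
        ... | no E≢F = ⊥-elim (Compatible-disjoint E F (edge≥2 FT E (A⊆T m)) (edge≥2 FT F (A⊆T m′))
                                 (minA m (A⊆T m′) (E≢F ∘ sym)) (minA m′ (A⊆T m) E≢F) p q)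

      cut-complement : cut ⊓ K x ≗ comp A
      cut-complement = join-complement x (comp A) (nc gx) ncA A⊑Kx

      -- An edge of `T′` is separated neither by chords of `x`, since it lies in a block of `K x`,
      -- nor by edges of `A`, since these are minimal; by `side-isEquivalence` this extends to all
      -- chords of `cut`. The other inclusion follows by comparing ranks.
      cut-spans : comp T′ ≗ K cut
      cut-spans = sub , rank-≤⇒⊒ {x = comp T′} {K cut} sub (≤-reflexive ranks)
        where
        sub : comp T′ ⊑ K cut
        sub = comp-⊑ T′ (K cut) λ {F} {i} {j} m p q → unsep (join-least x (comp A) (side-isEquivalence i j)
          (sameSide (proj₁ (spans FT) (comp-edge (T′⊆T m) p q)))
          (comp-least A (side-isEquivalence i j) λ {E} m′ a b → minA m′ (T′⊆T m) (λ { refl → A∩T′ m′ m }) a b p q))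
        ranks : rank (K cut) ≡ rank (comp T′)
        ranks = +-cancelˡ-≡ (rank (comp A)) _ _ (begin
          rank (comp A) + rank (K cut)         ≡⟨ cong₂ _+_ (rank-cong {x = comp A} {u} (≗-sym {x = u} {comp A} cut-complement))
                                                             (rank-cong {x = K cut} {K x ⊓ K u} (K-of-complement x cut (nc gx) ncy (join-⊒ˡ x (comp A)))) ⟩
          rank u + rank (K x ⊓ K u)            ≡⟨ rank-+-K u (K x) (meet-NC cut (K x) ncy (K-NC x)) (K-NC x) snd ⟩
          rank (K x)                           ≡⟨ weight≡rank FT ⟨
          weight T                             ≡⟨ weight-++ A T′ T↭ ⟩
          weight A + weight T′                 ≡⟨ cong₂ _+_ acyclicA acyclicT′ ⟨
          rank (comp A) + rank (comp T′)       ∎)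
          where
          open ≡-Reasoning
          u = cut ⊓ K x

      cut-forest : Forest T′ (K cut)
      cut-forest = record
        { noncrossing = λ m m′ → noncrossing FT (T′⊆T m) (T′⊆T m′)
        ; spans = cut-spans
        ; weight≡rank = trans (sym acyclicT′) (rank-cong {x = comp T′} {K cut} cut-spans)
        ; edgeSizes = λ E m → edgeSizes FT E (T′⊆T m)
        ; edge≥2 = λ E m → edge≥2 FT E (T′⊆T m) }

      cut-Good : Good cut
      cut-Good = good ncy
        (Sizes-⊓K x cut (nc gx) ncy (join-⊒ˡ x (comp A)) (sizes gx)
          (Sizes-≗ (comp A) (cut ⊓ K x) (≗-sym {x = cut ⊓ K x} {comp A} cut-complement)
            (acyclic⇒Sizes d A acyclicA λ E m → edgeSizes FT E (A⊆T m))))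
        (Sizes-≗ (comp T′) (K cut) cut-spans (acyclic⇒Sizes d T′ acyclicT′ λ E m → edgeSizes FT E (T′⊆T m)))

      cut-blocks : Blocks A (cut ⊓ K x)
      cut-blocks = record
        { unique = uniqueA
        ; isBlock = λ E m i∈E → (λ p → proj₁ (comp-least A Q-equiv edge-Q (proj₁ cut-complement p) m) i∈E) , λ j∈E → proj₂ cut-complement (comp-edge m i∈E j∈E)
        ; cover = λ p i≢j → covered i≢j (comp-least A S-equiv (λ m p q → inj₂ ((_ , m , p) , (_ , m , q))) (proj₁ cut-complement p))
        ; block≥2 = λ E m → edge≥2 FT E (A⊆T m) }
        where
        Q : Fin n → Fin n → Set
        Q i j = ∀ {E} → E ∈ A → (i ∈ₑ E → j ∈ₑ E) × (j ∈ₑ E → i ∈ₑ E)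
        Q-equiv : IsEquivalence Q
        Q-equiv = record { refl = λ _ → id , id ; sym = λ h m → let (p , q) = h m in q , p
                         ; trans = λ h k m → let (p , q) = h m in let (p′ , q′) = k m in p′ ∘ p , q ∘ q′ }
        edge-Q : ∀ {F i j} → F ∈ A → i ∈ₑ F → j ∈ₑ F → Q i j
        edge-Q {F} {i} {j} m p q m′ = (λ i∈E → subst (j ∈ₑ_) (disjoint m m′ p i∈E) q) , (λ j∈E → subst (i ∈ₑ_) (disjoint m m′ q j∈E) p)
        Supp : Fin n → Set
        Supp i = ∃[ E ] E ∈ A × i ∈ₑ E
        S-equiv : IsEquivalence (λ i j → i ≡ j ⊎ (Supp i × Supp j))
        S-equiv = record
          { refl = inj₁ refl ; sym = λ { (inj₁ refl) → inj₁ refl ; (inj₂ (p , q)) → inj₂ (q , p) }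
          ; trans = λ { (inj₁ refl) q → q ; (inj₂ p) (inj₁ refl) → inj₂ p ; (inj₂ (p , _)) (inj₂ (_ , q)) → inj₂ (p , q) } }
        covered : ∀ {i j} → i ≢ j → i ≡ j ⊎ (Supp i × Supp j) → Supp i
        covered i≢j (inj₁ eq) = ⊥-elim (i≢j eq)
        covered i≢j (inj₂ (p , _)) = p

  module _ (T : List (Edge n)) (w : Part n) (F : Forest T w) where

    private
      -- The edge G comes after E in the cyclic order of the edges at v.
      Before : Fin n → Edge n → Edge n → Set
      Before v E G = G ≢ E × v ∈ₑ G × ∃[ b ] ∃[ j ] b ∈ₑ E × j ∈ₑ G × side v b v ≢ side v b j

      NotLast : Edge n → Fin n → Set
      NotLast E v = v ∈ₑ E × Any (Before v E) T

      notLast? : ∀ E v → Dec (NotLast E v)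
      notLast? E v = (v ∈ₑ? E) ×-dec Any.any? (λ G → ¬? (G ≟ₑ E) ×-dec (v ∈ₑ? G) ×-dec any? λ b → any? λ j →
        (b ∈ₑ? E) ×-dec (j ∈ₑ? G) ×-dec ¬? (side v b v Boolₚ.≟ side v b j)) T

      -- For four distinct points compatibility is part of noncrossing, so a violation involves a
      -- vertex common to `E` and `G`, and `E` is not last there.
      lastEverywhere⇒Minimal : ∀ {E} → E ∈ T → (∀ v → ¬ NotLast E v) → Minimal T E
      lastEverywhere⇒Minimal {E} E∈T none {G} G∈T G≢E {a} {b} {i} {j} a∈E b∈E i∈G j∈G =
        decidable-stable (side a b i Boolₚ.≟ side a b j) absurd
        where
        before : ∀ {v b j} → v ∈ₑ E → v ∈ₑ G → b ∈ₑ E → j ∈ₑ G → side v b v ≢ side v b j → ⊥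
        before {v} {b} {j} v∈E v∈G b∈E j∈G neq = none v (v∈E , lose G∈T (G≢E , v∈G , b , j , b∈E , j∈G , neq))
        absurd : ¬ side a b i ≢ side a b j
        absurd neq with a ≟ᶠ i | a ≟ᶠ j | b ≟ᶠ i | b ≟ᶠ j
        ... | yes refl | _ | _ | _ = before a∈E i∈G b∈E j∈G neq
        ... | no _ | yes refl | _ | _ = before a∈E j∈G b∈E i∈G (neq ∘ sym)
        ... | no _ | no _ | yes refl | _ = before b∈E i∈G a∈E j∈G λ eq → neq (trans (side-comm a b b) (trans eq (side-comm b a j)))
        ... | no _ | no _ | no _ | yes refl = before b∈E j∈G a∈E i∈G λ eq → neq (trans (side-comm a b i) (trans (sym eq) (side-comm b a b)))
        ... | no a≢i | no a≢j | no b≢i | no b≢j = neq (noncrossing F E∈T G∈T (G≢E ∘ sym) a∈E b∈E i∈G j∈G a≢i a≢j b≢i b≢j)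

      share≤1 : ∀ {E G u v} → E ∈ T → G ∈ T → E ≢ G → u ∈ₑ E → u ∈ₑ G → v ∈ₑ E → v ∈ₑ G → u ≢ v → ⊥
      share≤1 E∈T G∈T E≢G uE uG vE vG u≢v = <-irrefl (acyclic F) (rank-comp-< E∈T G∈T E≢G uE uG vE vG u≢v)

      Supp : Fin n → Set
      Supp v = Any (v ∈ₑ_) T

      Neighbour : Fin n → Fin n → Set
      Neighbour v u = u ≢ v × Any (λ G → v ∈ₑ G × u ∈ₑ G) T

      neighbour? : ∀ v u → Dec (Neighbour v u)
      neighbour? v u = ¬? (u ≟ᶠ v) ×-dec Any.any? (λ G → (v ∈ₑ? G) ×-dec (u ∈ₑ? G)) T

      -- Cyclically from `v`, the last neighbour is the greatest one below `v` or, if there is none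
      -- below, the greatest one overall.
      lastNeighbour : ∀ v → Supp v → ∃[ u ] Neighbour v u × (∀ j → Neighbour v j → j ≢ u → side v u v ≡ side v u j)
      lastNeighbour v s with any? (λ u → neighbour? v u ×-dec (toℕ u <? toℕ v))
      ... | yes below-v with greatest (λ u → neighbour? v u ×-dec (toℕ u <? toℕ v)) below-v
      ...   | u , (nbr , u<v) , u-max = u , nbr , later
        where
        later : ∀ j → Neighbour v j → j ≢ u → side v u v ≡ side v u j
        later j nj@(j≢v , _) j≢u with ≺⊎≽ j v
        ... | inj₁ j<v = trans (side-above ≤-refl (<⇒≤ u<v)) (sym (side-below j<v (≤∧≢⇒< (u-max j (nj , j<v)) (j≢u ∘ toℕ-injective))))
        ... | inj₂ v≤j = trans (side-above ≤-refl (<⇒≤ u<v)) (sym (side-above v≤j (≤-trans (<⇒≤ u<v) v≤j)))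
      lastNeighbour v s | no none with greatest (neighbour? v) (someNeighbour (find s))
        where
        someNeighbour : (∃[ G ] G ∈ T × v ∈ₑ G) → ∃[ u ] Neighbour v u
        someNeighbour (G , m , v∈G) = let (b , b∈G , b≢v) = other-vertex G (edge≥2 F G m) v in b , b≢v , lose m (v∈G , b∈G)
      ... | u , nbr , u-max = u , nbr , later
        where
        above-v : ∀ {j} → Neighbour v j → v ≺ j
        above-v {j} nj@(j≢v , _) = ≤∧≢⇒< (≮⇒≥ λ j<v → none (j , nj , j<v)) (j≢v ∘ sym ∘ toℕ-injective)
        later : ∀ j → Neighbour v j → j ≢ u → side v u v ≡ side v u j
        later j nj j≢u = trans (side-in ≤-refl (above-v nbr)) (sym (side-in (<⇒≤ (above-v nj)) (≤∧≢⇒< (u-max j nj) (j≢u ∘ toℕ-injective))))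

      Last : Fin n → Edge n → Set
      Last v E = v ∈ₑ E × ¬ NotLast E v

      last? : ∀ v E → Dec (Last v E)
      last? v E = (v ∈ₑ? E) ×-dec ¬? (notLast? E v)

      -- Take an edge `E` through `v` and its last neighbour `u`. Another edge `G` at `v` shares no
      -- second vertex with `E` and does not cross it, so what holds for `u` carries over to every
      -- other vertex `b` of `E`.
      existsLast : ∀ v → Supp v → ∃[ E ] E ∈ T × Last v E
      existsLast v s with lastNeighbour v s
      ... | u , (u≢v , nbr) , later with find nbr
      ...   | E , E∈T , v∈E , u∈E = E , E∈T , v∈E , λ (_ , bad) → absurd (find bad)
        where
        absurd : ¬ (∃[ G ] G ∈ T × Before v E G)
        absurd (G , G∈T , G≢E , v∈G , b , j , b∈E , j∈G , neq) with b ≟ᶠ v | j ≟ᶠ v | j ≟ᶠ u | b ≟ᶠ j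
        ... | yes refl | _ | _ | _ = neq (trans (side-same v v) (sym (side-same v j)))
        ... | no _ | yes refl | _ | _ = neq refl
        ... | no _ | no _ | yes refl | _ = share≤1 E∈T G∈T (G≢E ∘ sym) v∈E v∈G u∈E j∈G (u≢v ∘ sym)
        ... | no b≢v | no _ | no _ | yes refl = share≤1 E∈T G∈T (G≢E ∘ sym) v∈E v∈G b∈E j∈G (b≢v ∘ sym)
        ... | no b≢v | no j≢v | no j≢u | no b≢j = neq (IsEquivalence.trans (side-isEquivalence v j) {v} {u} {b} (later j (j≢v , lose G∈T (v∈G , j∈G)) j≢u)
                (noncrossing F E∈T G∈T (G≢E ∘ sym) u∈E b∈E v∈G j∈G u≢v (j≢u ∘ sym) b≢v b≢j))

      supp? : ∀ v → Dec (Supp v)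
      supp? v = Any.any? (v ∈ₑ?_) T

      -- Every nonminimal point of `w` lies on an edge, and so does the least element of the
      -- component of `E₀`, which is not counted by the rank.
      rank<support : ∀ {E₀} → E₀ ∈ T → rank w < # supp?
      rank<support {E₀} E₀∈T with two-vertices E₀ (edge≥2 F E₀ E₀∈T)
      ... | a , _ , a∈E₀ , _ = #-mono-< (nonMin? w) supp? nonMin⇒Supp m m∈Supp (blockMin-¬NonMin w a)
        where
        m = proj₁ (blockMin w a)
        S-equiv : IsEquivalence (λ i j → i ≡ j ⊎ (Supp i × Supp j))
        S-equiv = record
          { refl = inj₁ refl ; sym = λ { (inj₁ refl) → inj₁ refl ; (inj₂ (p , q)) → inj₂ (q , p) }
          ; trans = λ { (inj₁ refl) q → q ; (inj₂ p) (inj₁ refl) → inj₂ p ; (inj₂ (p , _)) (inj₂ (_ , q)) → inj₂ (p , q) } }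
        related : ∀ {i j} → w [ i ~ j ] → i ≡ j ⊎ (Supp i × Supp j)
        related p = comp-least T S-equiv (λ m p q → inj₂ (lose m p , lose m q)) (proj₂ (spans F) p)
        nonMin⇒Supp : ∀ i → NonMin w i → Supp i
        nonMin⇒Supp i (j , j<i , p) with related p
        ... | inj₁ refl = ⊥-elim (<-irrefl refl j<i)
        ... | inj₂ (q , _) = q
        m∈Supp : Supp m
        m∈Supp with related (proj₁ (proj₂ (blockMin w a)))
        ... | inj₁ eq = subst Supp eq (lose E₀∈T a∈E₀)
        ... | inj₂ (_ , q) = q

    -- At every vertex of the support some edge is last; if every edge failed to be last at one of its
    -- vertices, there would be more incidences than ∑ ∣ E ∣ₑ = length T + rank w.
    exists-minimal : ∀ {E₀} → E₀ ∈ T → ∃[ E ] E ∈ T × Minimal T E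
    exists-minimal {E₀} E₀∈T with Any.any? (λ E → ¬? (any? (notLast? E))) T
    ... | yes found with find found
    ...   | E , E∈T , none = E , E∈T , lastEverywhere⇒Minimal E∈T λ v p → none (v , p)
    exists-minimal {E₀} E₀∈T | no none = ⊥-elim (<⇒≱ (rank<support E₀∈T) (+-cancelˡ-≤ (∑ (λ _ → 1) T) _ _ (begin
        ∑ (λ _ → 1) T + # supp?
          ≤⟨ +-mono-≤ (∑-mono T λ E m → hasNotLast E m) (∑-mono (allFin n) λ v _ → hasLast v) ⟩
        ∑ (λ E → # (notLast? E)) T + ∑ (λ v → ∑ (λ E → 𝟙 (last? v E)) T) (allFin n)
          ≡⟨ cong (∑ (λ E → # (notLast? E)) T +_) (∑-swap (λ v E → 𝟙 (last? v E)) (allFin n) T) ⟩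
        ∑ (λ E → # (notLast? E)) T + ∑ (λ E → # (λ v → last? v E)) T
          ≡⟨ ∑-+ (λ E → # (notLast? E)) (λ E → # (λ v → last? v E)) T ⟨
        ∑ (λ E → # (notLast? E) + # (λ v → last? v E)) T
          ≡⟨ ∑-cong T (λ E m → trans (sym (incidences E)) (sym (m+[n∸m]≡n (<⇒≤ (edge≥2 F E m))))) ⟩
        ∑ (λ E → 1 + (∣ E ∣ₑ ∸ 1)) T
          ≡⟨ ∑-+ (λ _ → 1) (λ E → ∣ E ∣ₑ ∸ 1) T ⟩
        ∑ (λ _ → 1) T + weight T
          ≡⟨ cong (∑ (λ _ → 1) T +_) (weight≡rank F) ⟩
        ∑ (λ _ → 1) T + rank w ∎)))
      where
      open ≤-Reasoning
      hasNotLast : ∀ E → E ∈ T → 1 ≤ # (notLast? E)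
      hasNotLast E m with any? (notLast? E)
      ... | yes (v , p) = ≤-trans (≤-reflexive (sym (𝟙-yes (notLast? E v) p))) (∈⇒≤∑ (λ v → 𝟙 (notLast? E v)) (∈-allFin v))
      ... | no ¬p = ⊥-elim (none (lose m ¬p))
      hasLast : ∀ v → 𝟙 (supp? v) ≤ ∑ (λ E → 𝟙 (last? v E)) T
      hasLast v = go (supp? v)
        where
        go : (s : Dec (Supp v)) → 𝟙 s ≤ ∑ (λ E → 𝟙 (last? v E)) T
        go (no _) = z≤n
        go (yes s) = let (E , m , p) = existsLast v s in ≤-trans (≤-reflexive (sym (𝟙-yes (last? v E) p))) (∈⇒≤∑ (λ E → 𝟙 (last? v E)) m)
      incidences : ∀ E → ∣ E ∣ₑ ≡ # (notLast? E) + # (λ v → last? v E)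
      incidences E = trans (∣_∣ₑ≡# E) (#-sum (notLast? E) (λ v → last? v E) (_∈ₑ? E) split (λ v → [ proj₁ , proj₁ ]′) λ v p q → proj₂ q p)
        where
        split : ∀ v → v ∈ₑ E → NotLast E v ⊎ Last v E
        split v m with notLast? E v
        ... | yes p = inj₁ p
        ... | no ¬p = inj₂ (m , ¬p)

-- Boolean definitions of noncrossing partitions

∧⁻ : ∀ a {b} → a ∧ b ≡ true → a ≡ true × b ≡ true
∧⁻ true eq = refl , eq

∧⁺ : ∀ {a b} → a ≡ true → b ≡ true → a ∧ b ≡ true
∧⁺ refl refl = refl

⇒ᵇ⁻ : ∀ a {b} → (a ⇒ᵇ b) ≡ true → a ≡ true → b ≡ true
⇒ᵇ⁻ true eq refl = eq

⇒ᵇ⁺ : ∀ a {b} → (a ≡ true → b ≡ true) → (a ⇒ᵇ b) ≡ true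
⇒ᵇ⁺ true  h = h refl
⇒ᵇ⁺ false h = refl

does⁺ : ∀ {P : Set} (P? : Dec P) → P → does P? ≡ true
does⁺ (yes _) _ = refl
does⁺ (no ¬p) p = ⊥-elim (¬p p)

does⁻ : ∀ {P : Set} (P? : Dec P) → does P? ≡ true → P
does⁻ (yes p) _ = p

all⁻ : ∀ (p : A → Bool) {xs x} → all p xs ≡ true → x ∈ xs → p x ≡ true
all⁻ p {y ∷ _} h (here refl) = proj₁ (∧⁻ (p y) h)
all⁻ p {y ∷ _} h (there m)   = all⁻ p (proj₂ (∧⁻ (p y) h)) m

all⁺ : ∀ (p : A → Bool) xs → (∀ x → x ∈ xs → p x ≡ true) → all p xs ≡ true
all⁺ p []       h = refl
all⁺ p (x ∷ xs) h = ∧⁺ (h x (here refl)) (all⁺ p xs λ y m → h y (there m))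

any⁻ : ∀ (p : A → Bool) xs → any p xs ≡ true → ∃[ x ] x ∈ xs × p x ≡ true
any⁻ p (x ∷ xs) h with p x in eq
... | true  = x , here refl , eq
... | false = let (y , m , q) = any⁻ p xs h in y , there m , q

any⁺ : ∀ (p : A → Bool) {xs x} → x ∈ xs → p x ≡ true → any p xs ≡ true
any⁺ p {y ∷ _} (here refl) eq rewrite eq = refl
any⁺ p {y ∷ _} (there m) eq = trans (cong (p y ∨_) (any⁺ p m eq)) (Boolₚ.∨-zeroʳ (p y))

allᶠ⁻ : ∀ (p : Fin n → Bool) → all p (allFin n) ≡ true → ∀ i → p i ≡ true
allᶠ⁻ p h i = all⁻ p h (∈-allFin i)

allᶠ⁺ : ∀ (p : Fin n → Bool) → (∀ i → p i ≡ true) → all p (allFin n) ≡ true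
allᶠ⁺ p h = all⁺ p (allFin _) λ i _ → h i

∈-filterᵇ⁺ : ∀ (p : A → Bool) {xs x} → x ∈ xs → p x ≡ true → x ∈ filterᵇ p xs
∈-filterᵇ⁺ p m eq = ∈-filter⁺ (Boolₚ.T? ∘ p) m (≡true⇒T eq)

∈-filterᵇ⁻ : ∀ (p : A → Bool) xs {x} → x ∈ filterᵇ p xs → x ∈ xs × p x ≡ true
∈-filterᵇ⁻ p xs m = let (m′ , t) = ∈-filter⁻ (Boolₚ.T? ∘ p) {xs = xs} m in m′ , T⇒≡true t

Unique-filterᵇ : ∀ (p : A → Bool) {xs} → Unique xs → Unique (filterᵇ p xs)
Unique-filterᵇ p = filter⁺ (Boolₚ.T? ∘ p)

concatMap≡cartesianProductWith : ∀ {C : Set} (f : A → B → C) xs ys → concatMap (λ x → map (f x) ys) xs ≡ cartesianProductWith f xs ys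
concatMap≡cartesianProductWith f []       ys = refl
concatMap≡cartesianProductWith f (x ∷ xs) ys = cong (map (f x) ys ++_) (concatMap≡cartesianProductWith f xs ys)

∈-allVecs : ∀ {xs : List A} (v : Vec A n) → (∀ i → Vec.lookup v i ∈ xs) → v ∈ allVecs xs n
∈-allVecs []      h = here refl
∈-allVecs {n = suc n} {xs = xs} (x ∷ v) h = subst (x ∷ v ∈_) (sym (concatMap≡cartesianProductWith _∷_ xs (allVecs xs n)))
  (∈-cartesianProductWith⁺ _∷_ (h Fin.zero) (∈-allVecs v (h ∘ Fin.suc)))

Unique-allVecs : ∀ {xs : List A} n → Unique xs → Unique (allVecs xs n)
Unique-allVecs zero    u = [] ∷ []
Unique-allVecs {xs = xs} (suc n) u = subst Unique (sym (concatMap≡cartesianProductWith _∷_ xs (allVecs xs n)))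
  (cartesianProductWith⁺ _∷_ (λ { refl → refl , refl }) u (Unique-allVecs n u))

∈-bools : ∀ b → b ∈ bools
∈-bools false = here refl
∈-bools true  = there (here refl)

Unique-bools : Unique bools
Unique-bools = ((λ ()) ∷ []) ∷ [] ∷ []

∈-allRels : (M : Rel n) → M ∈ allVecs (allVecs bools n) n
∈-allRels M = ∈-allVecs M λ i → ∈-allVecs (Vec.lookup M i) λ j → ∈-bools _

Unique-partitions : ∀ n → Unique (partitions n)
Unique-partitions n = Unique-filterᵇ (isEquivalenceᵇ n) (Unique-allVecs n (Unique-allVecs n Unique-bools))

IsPartition : Rel n → Set
IsPartition {n} M = isEquivalenceᵇ n M ≡ true

module _ {n} (M : Rel n) where

  IsPartition⁻ : IsPartition M → IsEquivalence (λ i j → rel M i j ≡ true)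
  IsPartition⁻ p with ∧⁻ (all (λ i → rel M i i) (allFin n)) p
  ... | r , st with ∧⁻ (all (λ i → all (λ j → rel M i j ⇒ᵇ rel M j i) (allFin n)) (allFin n)) st
  ...   | s , t = record
    { refl = λ {i} → allᶠ⁻ _ r i
    ; sym = λ {i} {j} q → ⇒ᵇ⁻ (rel M i j) (allᶠ⁻ _ (allᶠ⁻ _ s i) j) q
    ; trans = λ {i} {j} {k} q q′ → ⇒ᵇ⁻ (rel M i j ∧ rel M j k) (allᶠ⁻ _ (allᶠ⁻ _ (allᶠ⁻ _ t i) j) k) (∧⁺ q q′) }

  IsPartition⁺ : IsEquivalence (λ i j → rel M i j ≡ true) → IsPartition M
  IsPartition⁺ eq = ∧⁺ (allᶠ⁺ {n} _ λ i → IsEquivalence.refl eq)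
    (∧⁺ (allᶠ⁺ {n} _ λ i → allᶠ⁺ {n} _ λ j → ⇒ᵇ⁺ (rel M i j) (IsEquivalence.sym eq))
        (allᶠ⁺ {n} _ λ i → allᶠ⁺ {n} _ λ j → allᶠ⁺ {n} _ λ k → ⇒ᵇ⁺ (rel M i j ∧ rel M j k) λ q →
          let (q₁ , q₂) = ∧⁻ (rel M i j) q in IsEquivalence.trans eq q₁ q₂))

abstract
  -- Junk value Δ when M is not an equivalence relation.
  part : Rel n → Part n
  part {n} M with isEquivalenceᵇ n M Boolₚ.≟ true
  ... | yes p = record { _[_~_] = λ i j → rel M i j ≡ true ; dec = λ i j → rel M i j Boolₚ.≟ true ; isEquivalence = IsPartition⁻ M p }
  ... | no _  = Δ

  part⁺ : (M : Rel n) → IsPartition M → ∀ {i j} → rel M i j ≡ true → part M [ i ~ j ]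
  part⁺ {n} M p q with isEquivalenceᵇ n M Boolₚ.≟ true
  ... | yes _ = q
  ... | no ¬p = ⊥-elim (¬p p)

  part⁻ : (M : Rel n) → IsPartition M → ∀ {i j} → part M [ i ~ j ] → rel M i j ≡ true
  part⁻ {n} M p q with isEquivalenceᵇ n M Boolₚ.≟ true
  ... | yes _ = q
  ... | no ¬p = ⊥-elim (¬p p)

  toRel : Part n → Rel n
  toRel x = Vec.tabulate λ i → Vec.tabulate λ j → does (dec x i j)

  rel-toRel : (x : Part n) → ∀ i j → rel (toRel x) i j ≡ does (dec x i j)
  rel-toRel x i j = trans (cong (λ v → Vec.lookup v j) (lookup∘tabulate _ i)) (lookup∘tabulate _ j)

toRel⁺ : (x : Part n) → ∀ {i j} → x [ i ~ j ] → rel (toRel x) i j ≡ true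
toRel⁺ x {i} {j} p = trans (rel-toRel x i j) (does⁺ (dec x i j) p)

toRel⁻ : (x : Part n) → ∀ {i j} → rel (toRel x) i j ≡ true → x [ i ~ j ]
toRel⁻ x {i} {j} eq = does⁻ (dec x i j) (trans (sym (rel-toRel x i j)) eq)

toRel-IsPartition : (x : Part n) → IsPartition (toRel x)
toRel-IsPartition x = IsPartition⁺ (toRel x) (record
  { refl = toRel⁺ x (~refl x)
  ; sym = λ p → toRel⁺ x (~sym x (toRel⁻ x p))
  ; trans = λ p q → toRel⁺ x (~trans x (toRel⁻ x p) (toRel⁻ x q)) })

part-toRel : (x : Part n) → part (toRel x) ≗ x
part-toRel x = toRel⁻ x ∘ part⁻ (toRel x) (toRel-IsPartition x) , part⁺ (toRel x) (toRel-IsPartition x) ∘ toRel⁺ x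

part-injective : (M N : Rel n) → IsPartition M → IsPartition N → part M ≗ part N → M ≡ N
part-injective M N pM pN (f , g) = Vec-ext λ i → Vec-ext λ j →
  ≡-iff (part⁻ N pN ∘ f ∘ part⁺ M pM) (part⁻ M pM ∘ g ∘ part⁺ N pN)

refines⁺ : (M N : Rel n) → IsPartition M → IsPartition N → part M ⊑ part N → refinesᵇ n M N ≡ true
refines⁺ M N pM pN f = allᶠ⁺ _ λ i → allᶠ⁺ _ λ j → ⇒ᵇ⁺ (rel M i j) (part⁻ N pN ∘ f ∘ part⁺ M pM)

refines⁻ : (M N : Rel n) → IsPartition M → IsPartition N → refinesᵇ n M N ≡ true → part M ⊑ part N
refines⁻ M N pM pN h {i} {j} p = part⁺ N pN (⇒ᵇ⁻ (rel M i j) (allᶠ⁻ _ (allᶠ⁻ _ h i) j) (part⁻ M pM p))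

module _ {m} (R : Fin m → Fin m → Bool) where

  noncrossing⁻ : noncrossingᵇ m R ≡ true → ∀ {a b c e} → a ≺ b → b ≺ c → c ≺ e → R a c ≡ true → R b e ≡ true → R a b ≡ true
  noncrossing⁻ h {a} {b} {c} {e} a<b b<c c<e p q = ⇒ᵇ⁻ _ (allᶠ⁻ _ (allᶠ⁻ _ (allᶠ⁻ _ (allᶠ⁻ _ h a) b) c) e)
    (∧⁺ {a <ᶠ b} (<ᶠ-true a<b) (∧⁺ {b <ᶠ c} (<ᶠ-true b<c) (∧⁺ {c <ᶠ e} (<ᶠ-true c<e) (∧⁺ p q))))

  noncrossing⁺ : (∀ {a b c e} → a ≺ b → b ≺ c → c ≺ e → R a c ≡ true → R b e ≡ true → R a b ≡ true) → noncrossingᵇ m R ≡ true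
  noncrossing⁺ h = allᶠ⁺ _ λ a → allᶠ⁺ _ λ b → allᶠ⁺ _ λ c → allᶠ⁺ _ λ e → ⇒ᵇ⁺ _ λ t →
    let (a<b , t₁) = ∧⁻ (a <ᶠ b) t
        (b<c , t₂) = ∧⁻ (b <ᶠ c) t₁
        (c<e , t₃) = ∧⁻ (c <ᶠ e) t₂
        (p , q) = ∧⁻ (R a c) t₃
    in h (<ᶠ-true⁻ a<b) (<ᶠ-true⁻ b<c) (<ᶠ-true⁻ c<e) p q

isNCP⁻ : (M : Rel n) → IsPartition M → isNoncrossingPartitionᵇ n M ≡ true → NC (part M)
isNCP⁻ M pM h = NCˡⁱⁿ⇒NC (part M) λ a<b b<c c<e p q → part⁺ M pM (noncrossing⁻ (rel M) h a<b b<c c<e (part⁻ M pM p) (part⁻ M pM q))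

isNCP⁺ : (M : Rel n) → IsPartition M → NC (part M) → isNoncrossingPartitionᵇ n M ≡ true
isNCP⁺ M pM nc = noncrossing⁺ (rel M) λ a<b b<c c<e p q → part⁻ M pM (NC⇒NCˡⁱⁿ (part M) nc a<b b<c c<e (part⁺ M pM p) (part⁺ M pM q))

data Point (n : ℕ) : Fin (n * 2) → Set where
  unprimed : (i : Fin n) → Point n (combine i Fin.zero)
  primed   : (i : Fin n) → Point n (combine i (Fin.suc Fin.zero))

point : (p : Fin (n * 2)) → Point n p
point {n} p with remQuot {n} 2 p in eq
... | i , ε = subst (Point n) (trans (cong (uncurry combine) (sym eq)) (combine-remQuot {n} 2 p)) (from i ε)
  where
  from : (i : Fin n) (ε : Fin 2) → Point n (combine i ε)
  from i Fin.zero = unprimed i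
  from i (Fin.suc Fin.zero) = primed i

module _ {n} (π σ : Rel n) where

  private
    _+0 _+1 : Fin n → Fin (n * 2)
    i +0 = combine i Fin.zero
    i +1 = combine i (Fin.suc Fin.zero)
    C = combined n π σ

  combined-00 : ∀ i j → C (i +0) (j +0) ≡ rel π i j
  combined-00 i j rewrite remQuot-combine {n} {2} i Fin.zero | remQuot-combine {n} {2} j Fin.zero = refl

  combined-11 : ∀ i j → C (i +1) (j +1) ≡ rel σ i j
  combined-11 i j rewrite remQuot-combine {n} {2} i (Fin.suc Fin.zero) | remQuot-combine {n} {2} j (Fin.suc Fin.zero) = refl

  combined-01 : ∀ i j → C (i +0) (j +1) ≡ false
  combined-01 i j rewrite remQuot-combine {n} {2} i Fin.zero | remQuot-combine {n} {2} j (Fin.suc Fin.zero) = refl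

  combined-10 : ∀ i j → C (i +1) (j +0) ≡ false
  combined-10 i j rewrite remQuot-combine {n} {2} i (Fin.suc Fin.zero) | remQuot-combine {n} {2} j Fin.zero = refl

  private
    toℕ-+0 : ∀ (i : Fin n) → toℕ (i +0) ≡ 2 * toℕ i
    toℕ-+0 i = trans (toℕ-combine {n} {2} i Fin.zero) (+-identityʳ _)
    toℕ-+1 : ∀ (i : Fin n) → toℕ (i +1) ≡ suc (2 * toℕ i)
    toℕ-+1 i = trans (toℕ-combine {n} {2} i (Fin.suc Fin.zero)) (+-comm _ 1)

    <-00 : ∀ {i j : Fin n} → i +0 ≺ j +0 → i ≺ j
    <-00 {i} {j} p = *-cancelˡ-< 2 (toℕ i) (toℕ j) (subst₂ _<_ (toℕ-+0 i) (toℕ-+0 j) p)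
    <-11 : ∀ {i j : Fin n} → i +1 ≺ j +1 → i ≺ j
    <-11 {i} {j} p = *-cancelˡ-< 2 (toℕ i) (toℕ j) (≤-pred (subst₂ _<_ (toℕ-+1 i) (toℕ-+1 j) p))
    <-10 : ∀ {i j : Fin n} → i +1 ≺ j +0 → i ≺ j
    <-10 {i} {j} p = *-cancelˡ-< 2 (toℕ i) (toℕ j) (<-trans (n<1+n _) (subst₂ _<_ (toℕ-+1 i) (toℕ-+0 j) p))
    -- Only a weak inequality, because `i′` comes directly after `i`. This matches the half-open
    -- arcs in `side-in`.
    <-01 : ∀ {i j : Fin n} → i +0 ≺ j +1 → i ≼ j
    <-01 {i} {j} p = *-cancelˡ-≤ 2 (≤-pred (subst₂ _<_ (toℕ-+0 i) (toℕ-+1 j) p))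

    <-10⁺ : ∀ {i j : Fin n} → i ≺ j → i +1 ≺ j +0
    <-10⁺ {i} {j} p = subst₂ _<_ (sym (toℕ-+1 i)) (sym (toℕ-+0 j))
      (≤-trans (≤-reflexive (sym (*-suc 2 (toℕ i)))) (*-monoʳ-≤ 2 p))
    <-01⁺ : ∀ {i j : Fin n} → i ≼ j → i +0 ≺ j +1
    <-01⁺ {i} {j} p = subst₂ _<_ (sym (toℕ-+0 i)) (sym (toℕ-+1 j)) (s≤s (*-monoʳ-≤ 2 p))

  module _ (pπ : IsPartition π) (pσ : IsPartition σ) where

    -- A chord of `π` that separates two related primed points produces a crossing; the noncrossing
    -- condition would then relate an unprimed with a primed point, which `combined` never does.
    compatible⇒⊑K : compatibleᵇ n π σ ≡ true → part σ ⊑ K (part π)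
    compatible⇒⊑K h {i} {j} sij = unsep λ {a} {b} pab → same-side a b pab (side a b i) (side a b j) refl refl
      where
      nc : ∀ {a b c e} → a ≺ b → b ≺ c → c ≺ e → C a c ≡ true → C b e ≡ true → C a b ≡ true
      nc = noncrossing⁻ C h
      C00 : ∀ {a b} → part π [ a ~ b ] → C (a +0) (b +0) ≡ true
      C00 p = trans (combined-00 _ _) (part⁻ π pπ p)
      C11 : ∀ {a b} → part σ [ a ~ b ] → C (a +1) (b +1) ≡ true
      C11 p = trans (combined-11 _ _) (part⁻ σ pσ p)
      crossing : ∀ {a b i j} → part π [ a ~ b ] → part σ [ i ~ j ] → a ≼ i → i ≺ b → side a b j ≡ false → ⊥
      crossing {a} {b} {i} {j} pab sij a≤i i<b sj with ≺⊎≽ j a | ≺⊎≽ j b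
      ... | inj₁ j<a | _ = contradiction (trans (sym (nc (<-10⁺ j<a) (<-01⁺ a≤i) (<-10⁺ i<b) (C11 (~sym (part σ) sij)) (C00 pab))) (combined-10 j a)) λ ()
      ... | inj₂ a≤j | inj₂ b≤j = contradiction (trans (sym (nc (<-01⁺ a≤i) (<-10⁺ i<b) (<-01⁺ b≤j) (C00 pab) (C11 sij))) (combined-01 a i)) λ ()
      ... | inj₂ a≤j | inj₁ j<b = contradiction (trans (sym sj) (side-in a≤j j<b)) λ ()
      crosses : ∀ {a b i j} → part π [ a ~ b ] → part σ [ i ~ j ] → side a b i ≡ true → side a b j ≡ false → ⊥
      crosses {a} {b} {i} {j} pab sij si sj with side-true⁻ si
      ... | inj₁ (a≤i , i<b) = crossing pab sij a≤i i<b sj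
      ... | inj₂ (b≤i , i<a) = crossing (~sym (part π) pab) sij b≤i i<a (trans (side-comm b a j) sj)
      same-side : ∀ a b → part π [ a ~ b ] → ∀ s t → side a b i ≡ s → side a b j ≡ t → side a b i ≡ side a b j
      same-side a b pab true  true  p q = trans p (sym q)
      same-side a b pab false false p q = trans p (sym q)
      same-side a b pab true  false p q = ⊥-elim (crosses pab sij p q)
      same-side a b pab false true  p q = ⊥-elim (crosses pab (~sym (part σ) sij) q p)

    ⊑K⇒compatible : NC (part π) → NC (part σ) → part σ ⊑ K (part π) → compatibleᵇ n π σ ≡ true
    ⊑K⇒compatible ncπ ncσ σ⊑K = noncrossing⁺ C λ {a} {b} {c} {e} → go (point a) (point b) (point c) (point e)
      where
      go : ∀ {a b c e} → Point n a → Point n b → Point n c → Point n e → a ≺ b → b ≺ c → c ≺ e → C a c ≡ true → C b e ≡ true → C a b ≡ true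
      go (unprimed a) _ (primed c) _ _ _ _ p _ = contradiction (trans (sym p) (combined-01 a c)) λ ()
      go (primed a) _ (unprimed c) _ _ _ _ p _ = contradiction (trans (sym p) (combined-10 a c)) λ ()
      go _ (unprimed b) _ (primed e) _ _ _ _ q = contradiction (trans (sym q) (combined-01 b e)) λ ()
      go _ (primed b) _ (unprimed e) _ _ _ _ q = contradiction (trans (sym q) (combined-10 b e)) λ ()
      go (unprimed a) (unprimed b) (unprimed c) (unprimed e) a<b b<c c<e p q = trans (combined-00 a b) (part⁻ π pπ
        (NC⇒NCˡⁱⁿ (part π) ncπ (<-00 a<b) (<-00 b<c) (<-00 c<e) (part⁺ π pπ (trans (sym (combined-00 a c)) p)) (part⁺ π pπ (trans (sym (combined-00 b e)) q))))
      go (primed a) (primed b) (primed c) (primed e) a<b b<c c<e p q = trans (combined-11 a b) (part⁻ σ pσ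
        (NC⇒NCˡⁱⁿ (part σ) ncσ (<-11 a<b) (<-11 b<c) (<-11 c<e) (part⁺ σ pσ (trans (sym (combined-11 a c)) p)) (part⁺ σ pσ (trans (sym (combined-11 b e)) q))))
      go (unprimed a) (primed b) (unprimed c) (primed e) a<b b<c c<e p q = contradiction
        (trans (sym (side-in (<-01 a<b) (<-10 b<c))) (trans (sameSide (σ⊑K (part⁺ σ pσ (trans (sym (combined-11 b e)) q))) (part⁺ π pπ (trans (sym (combined-00 a c)) p)))
          (side-above (≤-trans (<-01 a<b) (<⇒≤ (<-≤-trans (<-10 b<c) (<-01 c<e)))) (<-01 c<e)))) λ ()
      go (primed a) (unprimed b) (primed c) (unprimed e) a<b b<c c<e p q = contradiction
        (trans (sym (side-in (<-01 b<c) (<-10 c<e))) (trans (sym (sameSide (σ⊑K (part⁺ σ pσ (trans (sym (combined-11 a c)) p))) (part⁺ π pπ (trans (sym (combined-00 b e)) q))))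
          (side-below (<-10 a<b) (<-trans (<-≤-trans (<-10 a<b) (<-01 b<c)) (<-10 c<e))))) λ ()

∈-partitions⁻ : {M : Rel n} → M ∈ partitions n → IsPartition M
∈-partitions⁻ {n} m = proj₂ (∈-filterᵇ⁻ (isEquivalenceᵇ n) (allVecs (allVecs bools n) n) m)

toRel-∈-partitions : (x : Part n) → toRel x ∈ partitions n
toRel-∈-partitions {n} x = ∈-filterᵇ⁺ (isEquivalenceᵇ n) (∈-allRels (toRel x)) (toRel-IsPartition x)

module _ {n} (π : Rel n) (pπ : IsPartition π) (ncπ : NC (part π)) where

  private
    κ = toRel (K (part π))
    part-κ : part κ ≗ K (part π)
    part-κ = part-toRel (K (part π))

  -- Compatibility puts `part σ` below `K (part π)`. The latter is itself compatible with `π`, so it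
  -- lies below the coarsest compatible partition.
  isKrewerasDual⁻ : (σ : Rel n) → IsPartition σ → isKrewerasDualᵇ n π σ ≡ true → part σ ≗ K (part π)
  isKrewerasDual⁻ σ pσ h with ∧⁻ (compatibleᵇ n π σ) h
  ... | c , coarsest = compatible⇒⊑K π σ pπ pσ c ,
    refines⁻ κ σ (toRel-IsPartition (K (part π))) pσ (⇒ᵇ⁻ (compatibleᵇ n π κ) (all⁻ _ coarsest (toRel-∈-partitions (K (part π)))) κ-compatible) ∘ proj₂ part-κ
    where
    κ-compatible : compatibleᵇ n π κ ≡ true
    κ-compatible = ⊑K⇒compatible π κ pπ (toRel-IsPartition (K (part π))) ncπ (≗-NC (K (part π)) (part κ) (≗-sym {x = part κ} {K (part π)} part-κ) (K-NC (part π))) (proj₁ part-κ)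

  isKrewerasDual⁺ : isKrewerasDualᵇ n π κ ≡ true
  isKrewerasDual⁺ = ∧⁺
    (⊑K⇒compatible π κ pπ (toRel-IsPartition (K (part π))) ncπ (≗-NC (K (part π)) (part κ) (≗-sym {x = part κ} {K (part π)} part-κ) (K-NC (part π))) (proj₁ part-κ))
    (all⁺ _ (partitions n) λ τ m → ⇒ᵇ⁺ (compatibleᵇ n π τ) λ c →
      refines⁺ τ κ (∈-partitions⁻ m) (toRel-IsPartition (K (part π))) (proj₂ part-κ ∘ compatible⇒⊑K π τ pπ (∈-partitions⁻ m) c))

module _ (d : ℕ) where
  open Indivisible d

  blocks≡1mod⁻ : (M : Rel n) → IsPartition M → blocks≡1modᵇ n d M ≡ true → Sizes (part M)
  blocks≡1mod⁻ {n} M pM h i = subst (λ k → d ∣ k ∸ 1) (countᶠ≡# (dec (part M) i) (rel M i) (λ _ → part⁻ M pM) (λ _ → part⁺ M pM))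
    (does⁻ (d ∣? (countᶠ n (rel M i) ∸ 1)) (allᶠ⁻ (λ i → ≡1mod d (countᶠ n (rel M i))) h i))

  blocks≡1mod⁺ : (M : Rel n) → IsPartition M → Sizes (part M) → blocks≡1modᵇ n d M ≡ true
  blocks≡1mod⁺ {n} M pM s = allᶠ⁺ (λ i → ≡1mod d (countᶠ n (rel M i))) λ i → does⁺ (d ∣? (countᶠ n (rel M i) ∸ 1))
    (subst (λ k → d ∣ k ∸ 1) (sym (countᶠ≡# (dec (part M) i) (rel M i) (λ _ → part⁻ M pM) (λ _ → part⁺ M pM))) (s i))

  isIndivisibleNC⁻ : (M : Rel n) → IsPartition M → isIndivisibleNCᵇ n d M ≡ true → Good (part M)
  isIndivisibleNC⁻ {n} M pM h with ∧⁻ (isNoncrossingPartitionᵇ n M) h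
  ... | ncᵇ , h₁ with ∧⁻ (blocks≡1modᵇ n d M) h₁
  ...   | sᵇ , h₂ with any⁻ _ (partitions n) h₂
  ...     | σ , m , h₃ with ∧⁻ (isKrewerasDualᵇ n M σ) h₃
  ...       | kᵇ , sσ = good ncM (blocks≡1mod⁻ M pM sᵇ)
                (Sizes-≗ (part σ) (K (part M)) (isKrewerasDual⁻ M pM ncM σ (∈-partitions⁻ m) kᵇ) (blocks≡1mod⁻ σ (∈-partitions⁻ m) sσ))
    where ncM = isNCP⁻ M pM ncᵇ

  isIndivisibleNC⁺ : (M : Rel n) → IsPartition M → Good (part M) → isIndivisibleNCᵇ n d M ≡ true
  isIndivisibleNC⁺ {n} M pM g = ∧⁺ (isNCP⁺ M pM (nc g)) (∧⁺ (blocks≡1mod⁺ M pM (sizes g))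
    (any⁺ _ (toRel-∈-partitions (K (part M))) (∧⁺ {isKrewerasDualᵇ n M (toRel (K (part M)))} (isKrewerasDual⁺ M pM (nc g))
      (blocks≡1mod⁺ (toRel (K (part M))) (toRel-IsPartition (K (part M)))
        (Sizes-≗ (K (part M)) (part (toRel (K (part M)))) (≗-sym {x = part (toRel (K (part M)))} {K (part M)} (part-toRel (K (part M)))) (sizesK g))))))

  ∈-indivisibleNCs⁻ : {M : Rel n} → M ∈ indivisibleNCs n d → IsPartition M × Good (part M)
  ∈-indivisibleNCs⁻ {n} {M} m = let (m′ , h) = ∈-filterᵇ⁻ (isIndivisibleNCᵇ n d) (partitions n) m
                                    pM = ∈-partitions⁻ m′
                                in pM , isIndivisibleNC⁻ M pM h

  ∈-indivisibleNCs⁺ : (x : Part n) → Good x → toRel x ∈ indivisibleNCs n d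
  ∈-indivisibleNCs⁺ {n} x g = ∈-filterᵇ⁺ (isIndivisibleNCᵇ n d) (toRel-∈-partitions x)
    (isIndivisibleNC⁺ (toRel x) (toRel-IsPartition x) (Good-≗ d x (part (toRel x)) (≗-sym {x = part (toRel x)} {x} (part-toRel x)) g))

  Unique-indivisibleNCs : ∀ n → Unique (indivisibleNCs n d)
  Unique-indivisibleNCs n = Unique-filterᵇ (isIndivisibleNCᵇ n d) (Unique-partitions n)

-- Products of posets

module _ {P Q : FinPoset} where

  -- An isomorphism given by its graph, so that it can be described through coordinates and the
  -- inverse laws reduce to injectivity and functionality.
  ≅-from-relation : (G : Fin (size P) → Fin (size Q) → Set) → (∀ i → ∃ (G i)) → (∀ j → ∃[ i ] G i j) →
                    (∀ {i j j′} → G i j → G i j′ → j ≡ j′) → (∀ {i i′ j} → G i j → G i′ j → i ≡ i′) →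
                    (∀ {i i′ j j′} → G i j → G i′ j′ → leq P i i′ ≡ leq Q j j′) → P ≅ Q
  ≅-from-relation G total′ onto functional injective pres′ = record
    { to = λ i → proj₁ (total′ i)
    ; from = λ j → proj₁ (onto j)
    ; from∘to = λ i → injective (proj₂ (onto _)) (proj₂ (total′ i))
    ; to∘from = λ j → functional (proj₂ (total′ _)) (proj₂ (onto j))
    ; pres = λ i i′ → pres′ (proj₂ (total′ i)) (proj₂ (total′ i′)) }

≅-refl : ∀ {P} → P ≅ P
≅-refl = record { to = id ; from = id ; from∘to = λ _ → refl ; to∘from = λ _ → refl ; pres = λ _ _ → refl }

≅-trans : ∀ {P Q R} → P ≅ Q → Q ≅ R → P ≅ R
≅-trans f g = record
  { to = G.to ∘ F.to ; from = F.from ∘ G.from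
  ; from∘to = λ x → trans (cong F.from (G.from∘to (F.to x))) (F.from∘to x)
  ; to∘from = λ y → trans (cong G.to (F.to∘from (G.from y))) (G.to∘from y)
  ; pres = λ x y → trans (F.pres x y) (G.pres (F.to x) (F.to y)) }
  where module F = _≅_ f
        module G = _≅_ g

module _ (P Q : FinPoset) where

  π₁ : Fin (size (P ⊗ Q)) → Fin (size P)
  π₁ k = proj₁ (remQuot {size P} (size Q) k)

  π₂ : Fin (size (P ⊗ Q)) → Fin (size Q)
  π₂ k = proj₂ (remQuot {size P} (size Q) k)

  pair : Fin (size P) → Fin (size Q) → Fin (size (P ⊗ Q))
  pair = combine

  π₁-pair : ∀ i j → π₁ (pair i j) ≡ i
  π₁-pair i j = cong proj₁ (remQuot-combine {size P} {size Q} i j)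

  π₂-pair : ∀ i j → π₂ (pair i j) ≡ j
  π₂-pair i j = cong proj₂ (remQuot-combine {size P} {size Q} i j)

  π-injective : ∀ {k k′} → π₁ k ≡ π₁ k′ → π₂ k ≡ π₂ k′ → k ≡ k′
  π-injective {k} {k′} p q = trans (sym (combine-remQuot {size P} (size Q) k)) (trans (cong₂ combine p q) (combine-remQuot {size P} (size Q) k′))

  ⊗-leq : ∀ k k′ → leq (P ⊗ Q) k k′ ≡ leq P (π₁ k) (π₁ k′) ∧ leq Q (π₂ k) (π₂ k′)
  ⊗-leq k k′ with remQuot {size P} (size Q) k | remQuot {size P} (size Q) k′
  ... | _ , _ | _ , _ = refl

⊗-congʳ : ∀ P {Q Q′} → Q ≅ Q′ → (P ⊗ Q) ≅ (P ⊗ Q′)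
⊗-congʳ P {Q} {Q′} g = ≅-from-relation (λ k l → π₁ P Q k ≡ π₁ P Q′ l × to (π₂ P Q k) ≡ π₂ P Q′ l)
  (λ k → pair P Q′ (π₁ P Q k) (to (π₂ P Q k)) , sym (π₁-pair P Q′ _ _) , sym (π₂-pair P Q′ _ _))
  (λ l → pair P Q (π₁ P Q′ l) (from (π₂ P Q′ l)) , π₁-pair P Q _ _ , trans (cong to (π₂-pair P Q _ _)) (to∘from _))
  (λ (p , q) (p′ , q′) → π-injective P Q′ (trans (sym p) p′) (trans (sym q) q′))
  (λ (p , q) (p′ , q′) → π-injective P Q (trans p (sym p′)) (trans (sym (from∘to _)) (trans (cong from (trans q (sym q′))) (from∘to _))))
  (λ {k} {k′} {l} {l′} (p , q) (p′ , q′) → trans (⊗-leq P Q k k′) (trans (cong₂ _∧_ (cong₂ (leq P) p p′) (trans (pres _ _) (cong₂ (leq Q′) q q′))) (sym (⊗-leq P Q′ l l′))))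
  where open _≅_ g

⊗-congˡ : ∀ {P P′} Q → P ≅ P′ → (P ⊗ Q) ≅ (P′ ⊗ Q)
⊗-congˡ {P} {P′} Q f = ≅-from-relation (λ k l → to (π₁ P Q k) ≡ π₁ P′ Q l × π₂ P Q k ≡ π₂ P′ Q l)
  (λ k → pair P′ Q (to (π₁ P Q k)) (π₂ P Q k) , sym (π₁-pair P′ Q _ _) , sym (π₂-pair P′ Q _ _))
  (λ l → pair P Q (from (π₁ P′ Q l)) (π₂ P′ Q l) , trans (cong to (π₁-pair P Q _ _)) (to∘from _) , π₂-pair P Q _ _)
  (λ (p , q) (p′ , q′) → π-injective P′ Q (trans (sym p) p′) (trans (sym q) q′))
  (λ (p , q) (p′ , q′) → π-injective P Q (trans (sym (from∘to _)) (trans (cong from (trans p (sym p′))) (from∘to _))) (trans q (sym q′)))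
  (λ {k} {k′} {l} {l′} (p , q) (p′ , q′) → trans (⊗-leq P Q k k′) (trans (cong₂ _∧_ (trans (pres _ _) (cong₂ (leq P′) p p′)) (cong₂ (leq Q) q q′)) (sym (⊗-leq P′ Q l l′))))
  where open _≅_ f

⊗-unitˡ : ∀ P → P ≅ (unitPoset ⊗ P)
⊗-unitˡ P = ≅-from-relation (λ i k → i ≡ π₂ unitPoset P k)
  (λ i → pair unitPoset P Fin.zero i , sym (π₂-pair unitPoset P Fin.zero i))
  (λ k → π₂ unitPoset P k , refl)
  (λ {_} {k} {k′} p q → π-injective unitPoset P (trans (only (π₁ unitPoset P k)) (sym (only (π₁ unitPoset P k′)))) (trans (sym p) q))
  (λ p q → trans p (sym q))
  (λ {_} {_} {k} {k′} p q → trans (cong₂ (leq P) p q) (sym (⊗-leq unitPoset P k k′)))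
  where
  only : (i : Fin 1) → i ≡ Fin.zero
  only Fin.zero = refl

module _ (P Q R : FinPoset) where

  private
    l₁ : Fin (size ((P ⊗ Q) ⊗ R)) → Fin (size P)
    l₁ k = π₁ P Q (π₁ (P ⊗ Q) R k)
    l₂ : Fin (size ((P ⊗ Q) ⊗ R)) → Fin (size Q)
    l₂ k = π₂ P Q (π₁ (P ⊗ Q) R k)
    l₃ : Fin (size ((P ⊗ Q) ⊗ R)) → Fin (size R)
    l₃ k = π₂ (P ⊗ Q) R k
    l-leq : ∀ k k′ → leq ((P ⊗ Q) ⊗ R) k k′ ≡ (leq P (l₁ k) (l₁ k′) ∧ leq Q (l₂ k) (l₂ k′)) ∧ leq R (l₃ k) (l₃ k′)
    l-leq k k′ = trans (⊗-leq (P ⊗ Q) R k k′) (cong (_∧ leq R (l₃ k) (l₃ k′)) (⊗-leq P Q _ _))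

  module Right (P Q R : FinPoset) where
    r₁ : Fin (size (P ⊗ (Q ⊗ R))) → Fin (size P)
    r₁ k = π₁ P (Q ⊗ R) k
    r₂ : Fin (size (P ⊗ (Q ⊗ R))) → Fin (size Q)
    r₂ k = π₁ Q R (π₂ P (Q ⊗ R) k)
    r₃ : Fin (size (P ⊗ (Q ⊗ R))) → Fin (size R)
    r₃ k = π₂ Q R (π₂ P (Q ⊗ R) k)
    triple : Fin (size P) → Fin (size Q) → Fin (size R) → Fin (size (P ⊗ (Q ⊗ R)))
    triple a b c = pair P (Q ⊗ R) a (pair Q R b c)
    r₁-triple : ∀ a b c → r₁ (triple a b c) ≡ a
    r₁-triple a b c = π₁-pair P (Q ⊗ R) a (pair Q R b c)
    r₂-triple : ∀ a b c → r₂ (triple a b c) ≡ b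
    r₂-triple a b c = trans (cong (π₁ Q R) (π₂-pair P (Q ⊗ R) a (pair Q R b c))) (π₁-pair Q R b c)
    r₃-triple : ∀ a b c → r₃ (triple a b c) ≡ c
    r₃-triple a b c = trans (cong (π₂ Q R) (π₂-pair P (Q ⊗ R) a (pair Q R b c))) (π₂-pair Q R b c)
    r-injective : ∀ {k k′} → r₁ k ≡ r₁ k′ → r₂ k ≡ r₂ k′ → r₃ k ≡ r₃ k′ → k ≡ k′
    r-injective p q r = π-injective P (Q ⊗ R) p (π-injective Q R q r)
    r-leq : ∀ k k′ → leq (P ⊗ (Q ⊗ R)) k k′ ≡ leq P (r₁ k) (r₁ k′) ∧ leq Q (r₂ k) (r₂ k′) ∧ leq R (r₃ k) (r₃ k′)
    r-leq k k′ = trans (⊗-leq P (Q ⊗ R) k k′) (cong (leq P (r₁ k) (r₁ k′) ∧_) (⊗-leq Q R _ _))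

  open Right P Q R
  open Right Q P R using () renaming (r₁ to s₁; r₂ to s₂; r₃ to s₃; triple to striple; r₁-triple to s₁-triple; r₂-triple to s₂-triple; r₃-triple to s₃-triple; r-injective to s-injective; r-leq to s-leq)

  ⊗-assoc : ((P ⊗ Q) ⊗ R) ≅ (P ⊗ (Q ⊗ R))
  ⊗-assoc = ≅-from-relation (λ k l → l₁ k ≡ r₁ l × l₂ k ≡ r₂ l × l₃ k ≡ r₃ l)
    (λ k → triple (l₁ k) (l₂ k) (l₃ k) , sym (r₁-triple _ _ _) , sym (r₂-triple _ _ _) , sym (r₃-triple _ _ _))
    (λ l → pair (P ⊗ Q) R (pair P Q (r₁ l) (r₂ l)) (r₃ l) ,
           trans (cong (π₁ P Q) (π₁-pair (P ⊗ Q) R _ _)) (π₁-pair P Q _ _) ,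
           trans (cong (π₂ P Q) (π₁-pair (P ⊗ Q) R _ _)) (π₂-pair P Q _ _) , π₂-pair (P ⊗ Q) R _ _)
    (λ (p , q , r) (p′ , q′ , r′) → r-injective (trans (sym p) p′) (trans (sym q) q′) (trans (sym r) r′))
    (λ (p , q , r) (p′ , q′ , r′) → π-injective (P ⊗ Q) R (π-injective P Q (trans p (sym p′)) (trans q (sym q′))) (trans r (sym r′)))
    (λ {k} {k′} {l} {l′} (p , q , r) (p′ , q′ , r′) → trans (l-leq k k′) (trans (Boolₚ.∧-assoc (leq P (l₁ k) (l₁ k′)) _ _)
      (trans (cong₂ _∧_ (cong₂ (leq P) p p′) (cong₂ _∧_ (cong₂ (leq Q) q q′) (cong₂ (leq R) r r′))) (sym (r-leq l l′)))))

  ⊗-swap : (P ⊗ (Q ⊗ R)) ≅ (Q ⊗ (P ⊗ R))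
  ⊗-swap = ≅-from-relation (λ k l → r₁ k ≡ s₂ l × r₂ k ≡ s₁ l × r₃ k ≡ s₃ l)
    (λ k → striple (r₂ k) (r₁ k) (r₃ k) , sym (s₂-triple _ _ _) , sym (s₁-triple _ _ _) , sym (s₃-triple _ _ _))
    (λ l → triple (s₂ l) (s₁ l) (s₃ l) , r₁-triple _ _ _ , r₂-triple _ _ _ , r₃-triple _ _ _)
    (λ (p , q , r) (p′ , q′ , r′) → s-injective (trans (sym q) q′) (trans (sym p) p′) (trans (sym r) r′))
    (λ (p , q , r) (p′ , q′ , r′) → r-injective (trans p (sym p′)) (trans q (sym q′)) (trans r (sym r′)))
    (λ {k} {k′} {l} {l′} (p , q , r) (p′ , q′ , r′) → trans (r-leq k k′)
      (trans (cong₂ _∧_ (cong₂ (leq P) p p′) (cong₂ _∧_ (cong₂ (leq Q) q q′) (cong₂ (leq R) r r′)))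
      (trans (∧-swap (leq P (s₂ l) (s₂ l′)) (leq Q (s₁ l) (s₁ l′)) (leq R (s₃ l) (s₃ l′))) (sym (s-leq l l′)))))
    where
    ∧-swap : ∀ a b c → a ∧ b ∧ c ≡ b ∧ a ∧ c
    ∧-swap true  b     c = refl
    ∧-swap false true  c = refl
    ∧-swap false false c = refl

prodPosets-↭ : ∀ (f : A → FinPoset) {xs ys} → xs ↭ ys → prodPosets (map f xs) ≅ prodPosets (map f ys)
prodPosets-↭ f ↭-refl       = ≅-refl
prodPosets-↭ f (prep x p)   = ⊗-congʳ (f x) (prodPosets-↭ f p)
prodPosets-↭ f (swap {xs = xs} x y p) = ≅-trans (⊗-swap (f x) (f y) (prodPosets (map f xs))) (⊗-congʳ (f y) (⊗-congʳ (f x) (prodPosets-↭ f p)))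
prodPosets-↭ f (↭-step p q) = ≅-trans (prodPosets-↭ f p) (prodPosets-↭ f q)

prodPosets-++ : ∀ (f : A → FinPoset) xs ys → (prodPosets (map f xs) ⊗ prodPosets (map f ys)) ≅ prodPosets (map f (xs ++ ys))
prodPosets-++ f []       ys = record { to = from ; from = to ; from∘to = to∘from ; to∘from = from∘to
                                     ; pres = λ k l → trans (cong₂ (leq (unitPoset ⊗ prodPosets (map f ys))) (sym (to∘from k)) (sym (to∘from l))) (sym (pres (from k) (from l))) }
  where open _≅_ (⊗-unitˡ (prodPosets (map f ys)))
prodPosets-++ f (x ∷ xs) ys = ≅-trans (⊗-assoc (f x) (prodPosets (map f xs)) (prodPosets (map f ys))) (⊗-congʳ (f x) (prodPosets-++ f xs ys))

-- The list of elements of NCᵈ is kept abstract, since its definition by exhaustive search unfolds into large terms.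
module NCPosets (d : ℕ) (elements : ∀ k → List (Rel k)) (Unique-elements : ∀ k → Unique (elements k))
  (∈-elements⁻ : ∀ {k} {M : Rel k} → M ∈ elements k → IsPartition M × Indivisible.Good d (part M))
  (∈-elements⁺ : ∀ {k} (x : Part k) → Indivisible.Good d x → toRel x ∈ elements k) {n : ℕ} where
  open Indivisible d

  𝒫 : ℕ → FinPoset
  𝒫 k = listPoset (refinesᵇ k) (elements k)

  𝒫ᵉ : Edge n → FinPoset
  𝒫ᵉ E = 𝒫 ∣ E ∣ₑ

  element : ∀ {k} → Fin (size (𝒫 k)) → Part k
  element {k} i = part (lookup (elements k) i)

  private
    element-facts : ∀ {k} (i : Fin (size (𝒫 k))) → IsPartition (lookup (elements k) i) × Good (element i)
    element-facts {k} i = ∈-elements⁻ (∈-lookup i)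

  element-Good : ∀ {k} (i : Fin (size (𝒫 k))) → Good (element i)
  element-Good i = proj₂ (element-facts i)

  element-injective : ∀ {k} {i j : Fin (size (𝒫 k))} → element i ≗ element j → i ≡ j
  element-injective {k} {i} {j} eq = lookup-injective (Unique-elements k)
    (part-injective (lookup (elements k) i) (lookup (elements k) j) (proj₁ (element-facts i)) (proj₁ (element-facts j)) eq)

  abstract
    element⁻¹ : ∀ {k} (x : Part k) → Good x → ∃[ i ] element i ≗ x
    element⁻¹ {k} x g = index m , subst (λ M → part M ≗ x) (lookup-index m) (part-toRel x)
      where
      m : toRel x ∈ elements k
      m = ∈-elements⁺ x g

  leq⁺ : ∀ {k} (i j : Fin (size (𝒫 k))) → element i ⊑ element j → leq (𝒫 k) i j ≡ true
  leq⁺ i j = refines⁺ _ _ (proj₁ (element-facts i)) (proj₁ (element-facts j))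

  leq⁻ : ∀ {k} (i j : Fin (size (𝒫 k))) → leq (𝒫 k) i j ≡ true → element i ⊑ element j
  leq⁻ i j = refines⁻ _ _ (proj₁ (element-facts i)) (proj₁ (element-facts j))

  ∏ : List (Edge n) → FinPoset
  ∏ A = prodPosets (map 𝒫ᵉ A)

  -- Junk value Δ for edges outside A.
  coordinate : ∀ (A : List (Edge n)) → Fin (size (∏ A)) → ∀ (E : Edge n) → Part ∣ E ∣ₑ
  coordinate []      k E = Δ
  coordinate (F ∷ A) k E with E ≟ₑ F
  ... | yes refl = element (π₁ (𝒫ᵉ E) (∏ A) k)
  ... | no _     = coordinate A (π₂ (𝒫ᵉ F) (∏ A) k) E

  coordinate-here : ∀ F A k → coordinate (F ∷ A) k F ≡ element (π₁ (𝒫ᵉ F) (∏ A) k)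
  coordinate-here F A k with F ≟ₑ F
  ... | yes refl = refl
  ... | no F≢F = ⊥-elim (F≢F refl)

  coordinate-there : ∀ F A k {E} → E ≢ F → coordinate (F ∷ A) k E ≡ coordinate A (π₂ (𝒫ᵉ F) (∏ A) k) E
  coordinate-there F A k {E} E≢F with E ≟ₑ F
  ... | yes E≡F = ⊥-elim (E≢F E≡F)
  ... | no _ = refl

  private
    ≢-head : ∀ {F : Edge n} {A E} → All (F ≢_) A → E ∈ A → E ≢ F
    ≢-head F∉A m refl = All.lookup F∉A m refl

  coordinate-Good : ∀ {A} → Unique A → ∀ k {E} → E ∈ A → Good (coordinate A k E)
  coordinate-Good {F ∷ A} (F∉A ∷ u) k (here refl) = subst Good (sym (coordinate-here F A k)) (element-Good (π₁ (𝒫ᵉ F) (∏ A) k))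
  coordinate-Good {F ∷ A} (F∉A ∷ u) k (there m) = subst Good (sym (coordinate-there F A k (≢-head F∉A m))) (coordinate-Good u _ m)

  coordinate⁻¹ : ∀ {A} → Unique A → (r : ∀ E → Part ∣ E ∣ₑ) → (∀ {E} → E ∈ A → Good (r E)) →
                 ∃[ k ] (∀ {E} → E ∈ A → coordinate A k E ≗ r E)
  coordinate⁻¹ {[]} u r g = Fin.zero , λ ()
  coordinate⁻¹ {F ∷ A} (F∉A ∷ u) r g = k , λ
      { (here refl) → subst (_≗ r F) (sym (trans (coordinate-here F A k) (cong element (π₁-pair (𝒫ᵉ F) (∏ A) _ _)))) (proj₂ head)
      ; {E} (there m) → subst (_≗ r E) (sym (trans (coordinate-there F A k (≢-head F∉A m)) (cong (λ l → coordinate A l E) (π₂-pair (𝒫ᵉ F) (∏ A) _ _)))) (proj₂ tail m) }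
    where
    head = element⁻¹ (r F) (g (here refl))
    tail = coordinate⁻¹ u r (g ∘ there)
    k = pair (𝒫ᵉ F) (∏ A) (proj₁ head) (proj₁ tail)

  coordinate-injective : ∀ {A} → Unique A → ∀ {k l} → (∀ {E} → E ∈ A → coordinate A k E ≗ coordinate A l E) → k ≡ l
  coordinate-injective {[]} u {Fin.zero} {Fin.zero} h = refl
  coordinate-injective {F ∷ A} (F∉A ∷ u) {k} {l} h = π-injective (𝒫ᵉ F) (∏ A)
    (element-injective (subst₂ _≗_ (coordinate-here F A k) (coordinate-here F A l) (h (here refl))))
    (coordinate-injective u λ m → subst₂ _≗_ (coordinate-there F A k (≢-head F∉A m)) (coordinate-there F A l (≢-head F∉A m)) (h (there m)))

  ∏-leq⁻ : ∀ {A} → Unique A → ∀ k l → leq (∏ A) k l ≡ true → ∀ {E} → E ∈ A → coordinate A k E ⊑ coordinate A l E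
  ∏-leq⁻ {F ∷ A} (F∉A ∷ u) k l h m with ∧⁻ (leq (𝒫ᵉ F) (π₁ (𝒫ᵉ F) (∏ A) k) (π₁ (𝒫ᵉ F) (∏ A) l)) (trans (sym (⊗-leq (𝒫ᵉ F) (∏ A) k l)) h)
  ∏-leq⁻ {F ∷ A} (F∉A ∷ u) k l h (here refl) | p , q = subst₂ _⊑_ (sym (coordinate-here F A k)) (sym (coordinate-here F A l)) (leq⁻ _ _ p)
  ∏-leq⁻ {F ∷ A} (F∉A ∷ u) k l h (there m) | p , q =
    subst₂ _⊑_ (sym (coordinate-there F A k (≢-head F∉A m))) (sym (coordinate-there F A l (≢-head F∉A m))) (∏-leq⁻ u _ _ q m)

  ∏-leq⁺ : ∀ {A} → Unique A → ∀ k l → (∀ {E} → E ∈ A → coordinate A k E ⊑ coordinate A l E) → leq (∏ A) k l ≡ true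
  ∏-leq⁺ {[]} u k l h = refl
  ∏-leq⁺ {F ∷ A} (F∉A ∷ u) k l h = trans (⊗-leq (𝒫ᵉ F) (∏ A) k l) (∧⁺
    (leq⁺ _ _ (subst₂ _⊑_ (coordinate-here F A k) (coordinate-here F A l) (h (here refl))))
    (∏-leq⁺ u _ _ λ m → subst₂ _⊑_ (coordinate-there F A k (≢-head F∉A m)) (coordinate-there F A l (≢-head F∉A m)) (h (there m))))

  module _ (u : Part n) {A : List (Edge n)} (B : Blocks d A u) (r : ∀ (E : Edge n) → Part ∣ E ∣ₑ) where

    private
      -- Quantifying over preimages makes the condition vacuous for edges that do not contain both
      -- points.
      On : Fin n → Fin n → Edge n → Set
      On i j E = ∀ a b → vertex E a ≡ i → vertex E b ≡ j → r E [ a ~ b ]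

      vertex-injective : ∀ (E : Edge n) {a b} → vertex E a ≡ vertex E b → a ≡ b
      vertex-injective E = lookup-injective (filter⁺ (Boolₚ.T? ∘ Vec.lookup E) (allFin⁺ n))

    record Glued (i j : Fin n) : Set where
      constructor _,_
      field
        inBlock : u [ i ~ j ]
        onEdges : ∀ {E} → E ∈ A → On i j E
    open Glued

    glue : Part n
    glue = record
      { _[_~_] = Glued
      ; dec = λ i j → map′ (λ (p , q) → p , All.lookup q) (λ (p , q) → p , All.tabulate q)
          (dec u i j ×-dec All.all? (λ E → all? λ a → all? λ b → (vertex E a ≟ᶠ i) →-dec ((vertex E b ≟ᶠ j) →-dec dec (r E) a b)) A)
      ; isEquivalence = record
        { refl = ~refl u , λ {E} m a b p q → subst (λ c → r E [ a ~ c ]) (vertex-injective E (trans p (sym q))) (~refl (r E))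
        ; sym = λ (p , q) → ~sym u p , λ {E} m a b s t → ~sym (r E) (q m b a t s)
        ; trans = λ (p , q) (p′ , q′) → ~trans u p p′ , λ {E} m a c s t →
            let (b , e) = vertex⁻¹ E (proj₁ (isBlock B E m (subst (_∈ₑ E) s (vertex-∈ E a))) p)
            in ~trans (r E) (q m a b s e) (q′ m b c e t) } }

    glue⊑ : glue ⊑ u
    glue⊑ (p , _) = p

    pull-glue : ∀ {E} → E ∈ A → pull E glue ≗ r E
    pull-glue {E} m = (λ (_ , q) → q m _ _ refl refl) , λ {a} {b} p →
      proj₂ (isBlock B E m (vertex-∈ E a)) (vertex-∈ E b) , λ m′ a′ b′ s t → onEdge m′ p s t
      where
      onEdge : ∀ {F} → F ∈ A → ∀ {a b a′ b′} → r E [ a ~ b ] → vertex F a′ ≡ vertex E a → vertex F b′ ≡ vertex E b → r F [ a′ ~ b′ ]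
      onEdge {F} m′ {a} {b} {a′} {b′} p s t with block-unique d {u = u} {E} {F} (isBlock B E m) (isBlock B F m′) (vertex-∈ E a) (subst (_∈ₑ F) s (vertex-∈ F a′)) (~refl u)
      ... | refl = subst₂ (λ c e → r E [ c ~ e ]) (vertex-injective E (sym s)) (vertex-injective E (sym t)) p

  pulls-⊑ : (u v w : Part n) {A : List (Edge n)} → Blocks d A u → v ⊑ u → (∀ {E} → E ∈ A → pull E v ⊑ pull E w) → v ⊑ w
  pulls-⊑ u v w B v⊑u h {i} {j} p with i ≟ᶠ j
  ... | yes refl = ~refl w
  ... | no i≢j with cover B (v⊑u p) i≢j
  ...   | E , m , i∈E with vertex⁻¹ E i∈E | vertex⁻¹ E (proj₁ (isBlock B E m i∈E) (v⊑u p))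
  ...     | a , refl | b , refl = h m p

  module _ (i j : Fin (size (𝒫 n))) (i≤j : element i ⊑ element j) {A : List (Edge n)}
           (B : Blocks d A (element j ⊓ K (element i))) where

    private
      P = 𝒫 n
      x = element i
      y = element j
      gx = element-Good i
      gy = element-Good j
      u = y ⊓ K x
      ncu : NC u
      ncu = meet-NC y (K x) (nc gy) (K-NC x)
      between : Fin (size P) → Bool
      between z = leq P i z ∧ leq P z j
      zs = filterᵇ between (allFin (size P))
      z : Fin (length zs) → Part n
      z a = element (lookup zs a)
      z-between : ∀ a → x ⊑ z a × z a ⊑ y
      z-between a = let (p , q) = ∧⁻ (leq P i (lookup zs a)) (proj₂ (∈-filterᵇ⁻ between (allFin (size P)) (∈-lookup a))) in leq⁻ i _ p , leq⁻ _ j q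
      z-Good : ∀ a → Good (z a)
      z-Good a = element-Good (lookup zs a)
      v : Fin (length zs) → Part n
      v a = z a ⊓ K x
      v-Below : ∀ a → Below d u (v a)
      v-Below a = complement-Below d x y gx gy i≤j (z a) (z-Good a) (proj₁ (z-between a)) (proj₂ (z-between a))
      v⊑u : ∀ a → v a ⊑ u
      v⊑u a = below (v-Below a)
      v-mono⁻ : ∀ a b → v a ⊑ v b → z a ⊑ z b
      v-mono⁻ a b h = join-⊑ x (v a) (z b) (proj₁ (z-between b)) (fst ∘ h) ∘
                      proj₂ (complement-join x (z a) (nc gx) (nc (z-Good a)) (proj₁ (z-between a)))
      z-injective : ∀ {a b} → z a ≗ z b → a ≡ b
      z-injective eq = lookup-injective (Unique-filterᵇ between (allFin⁺ (size P))) (element-injective eq)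

      -- The graph of the isomorphism: z corresponds to the restrictions of x⁻¹z to the nontrivial
      -- blocks of x⁻¹y.
      G : Fin (length zs) → Fin (size (∏ A)) → Set
      G a k = ∀ {E} → E ∈ A → coordinate A k E ≗ pull E (v a)

      G-total : ∀ a → ∃ (G a)
      G-total a = coordinate⁻¹ (unique B) (λ E → pull E (v a)) λ {E} m → Below⇒Good-pull d u (v a) ncu (v⊑u a) E (isBlock B E m) (v-Below a)

      -- The coordinates are glued to a partition `w` below `u`; then `join x w` is indivisible,
      -- lies between `x` and `y`, and has `w` as its complement over `x`.
      G-onto : ∀ k → ∃[ a ] G a k
      G-onto k = index m , λ {E} m′ → ≗-trans (coordinate A k E) (pull E w) (pull E (v (index m)))
          (≗-sym {x = pull E w} {coordinate A k E} (pull-glue u B (coordinate A k) m′)) (proj₂ v≗w , proj₁ v≗w)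
        where
        w = glue u B (coordinate A k)
        w⊑u : w ⊑ u
        w⊑u = glue⊑ u B (coordinate A k)
        w-Below : Below d u w
        w-Below = Good-pull⇒Below d u w ncu w⊑u A (isBlock B) (cover B) λ E m →
          Good-≗ d (coordinate A k E) (pull E w) (≗-sym {x = pull E w} {coordinate A k E} (pull-glue u B (coordinate A k) m)) (coordinate-Good (unique B) k m)
        e = element⁻¹ (join x w) (join-Good d x y gx gy i≤j w w-Below)
        m : proj₁ e ∈ zs
        m = ∈-filterᵇ⁺ between (∈-allFin (proj₁ e)) (∧⁺ (leq⁺ i (proj₁ e) (proj₂ (proj₂ e) ∘ join-⊒ˡ x w))
              (leq⁺ (proj₁ e) j (join-below d x y gx gy i≤j w w-Below ∘ proj₁ (proj₂ e))))
        z≗ : z (index m) ≗ join x w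
        z≗ = subst (λ l → element l ≗ join x w) (lookup-index m) (proj₂ e)
        v≗w : v (index m) ≗ w
        v≗w = let (p , q) = join-complement x w (nc gx) (ncᵇ w-Below) (snd ∘ w⊑u) in
              (λ (s , t) → p (proj₁ z≗ s , t)) , λ s → let (s′ , t) = q s in proj₂ z≗ s′ , t

      G-mono : ∀ {a b k l} → G a k → G b l → leq (interval P i j) a b ≡ leq (∏ A) k l
      G-mono {a} {b} {k} {l} g h = ≡-iff
        (λ eq → ∏-leq⁺ (unique B) k l λ {E} m → proj₂ (h m) ∘ (λ (p , q) → leq⁻ (lookup zs a) (lookup zs b) eq p , q) ∘ proj₁ (g m))
        (λ eq → leq⁺ (lookup zs a) (lookup zs b) (v-mono⁻ a b (pulls-⊑ u (v a) (v b) B (v⊑u a) λ {E} m →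
          proj₁ (h m) ∘ ∏-leq⁻ (unique B) k l eq m ∘ proj₂ (g m))))

    interval≅∏ : interval (𝒫 n) i j ≅ ∏ A
    interval≅∏ = ≅-from-relation G G-total G-onto
      (λ {a} {k} {l} g h → coordinate-injective (unique B) λ {E} m → ≗-trans (coordinate A k E) (pull E (v a)) (coordinate A l E) (g m) (≗-sym {x = coordinate A l E} {pull E (v a)} (h m)))
      (λ {a} {b} {k} g h → z-injective
        ( v-mono⁻ a b (pulls-⊑ u (v a) (v b) B (v⊑u a) λ {E} m → proj₁ (h m) ∘ proj₂ (g m))
        , v-mono⁻ b a (pulls-⊑ u (v b) (v a) B (v⊑u b) λ {E} m → proj₁ (g m) ∘ proj₂ (h m))))
      G-mono

-- Boolean definitions of hypertrees

private
  grow : Hypergraph n → (Fin n → Bool) → Fin n → Bool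
  grow {n} H S v = S v ∨ any (λ E → any (λ w → Vec.lookup E w ∧ S w) (allFin n) ∧ Vec.lookup E v) H

  -- The iteration in the definition of reachable is private there; the placeholder is filled in with it
  -- when iterate-solution, in which the number of steps is separated from n, is checked.
  mutual
    iterate : Hypergraph n → ℕ → (Fin n → Bool) → Fin n → Bool
    iterate {n} H k S v = _

    iterate-solution : ∀ m (H : Hypergraph (suc m)) i v → reachable H i v ≡ iterate H m (grow H (λ w → w ≟ᵇ i)) v
    iterate-solution m H i v with suc m | H | grow H (λ w → w ≟ᵇ i) | v
    ... | _ | _ | _ | _ = refl

module _ {n : ℕ} (H : Hypergraph n) where

  private
    Closed : (Fin n → Set) → Set
    Closed Q = ∀ {E i j} → E ∈ H → i ∈ₑ E → j ∈ₑ E → Q i → Q j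

    grow⁻ : ∀ S v → grow H S v ≡ true → S v ≡ true ⊎ (∃[ E ] E ∈ H × v ∈ₑ E × ∃[ w ] w ∈ₑ E × S w ≡ true)
    grow⁻ S v h with S v
    ... | true = inj₁ refl
    ... | false with any⁻ _ H h
    ...   | E , m , q with ∧⁻ (any (λ w → Vec.lookup E w ∧ S w) (allFin n)) q
    ...     | r , v∈E with any⁻ _ (allFin n) r
    ...       | w , _ , t = let (w∈E , Sw) = ∧⁻ (Vec.lookup E w) t in inj₂ (E , m , v∈E , w , w∈E , Sw)

    grow-old : ∀ S v → S v ≡ true → grow H S v ≡ true
    grow-old S v eq rewrite eq = refl

    grow-new : ∀ S {E v w} → E ∈ H → w ∈ₑ E → v ∈ₑ E → S w ≡ true → grow H S v ≡ true
    grow-new S {E} {v} {w} m w∈E v∈E Sw = trans (cong (S v ∨_) (any⁺ _ m (∧⁺ (any⁺ (λ w → Vec.lookup E w ∧ S w) (∈-allFin w) (∧⁺ w∈E Sw)) v∈E))) (Boolₚ.∨-zeroʳ (S v))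

    iterate-⊆ : ∀ {Q : Fin n → Set} → Closed Q → ∀ k S → (∀ v → S v ≡ true → Q v) → ∀ v → iterate H k S v ≡ true → Q v
    iterate-⊆ closed zero    S h v eq = h v eq
    iterate-⊆ {Q} closed (suc k) S h v eq = iterate-⊆ closed k (grow H S) step v eq
      where
      step : ∀ v → grow H S v ≡ true → Q v
      step v eq with grow⁻ S v eq
      ... | inj₁ Sv = h v Sv
      ... | inj₂ (E , m , v∈E , w , w∈E , Sw) = closed m w∈E v∈E (h w Sw)

    iterate-⊇ : ∀ k S v → S v ≡ true → iterate H k S v ≡ true
    iterate-⊇ zero    S v eq = eq
    iterate-⊇ (suc k) S v eq = iterate-⊇ k (grow H S) v (grow-old S v eq)

    true? : ∀ (S : Fin n → Bool) v → Dec (S v ≡ true)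
    true? S v = S v Boolₚ.≟ true

    -- Unless `S` is already stationary, a step adds a vertex, so `k` further steps suffice when at
    -- most `k` vertices are missing.
    iterate-Closed : ∀ k S → n ≤ # (true? S) + k → Closed (λ v → iterate H k S v ≡ true)
    iterate-Closed k S le with any? (λ v → true? (grow H S) v ×-dec ¬? (true? S v))
    ... | no none = λ m i∈E j∈E p → iterate-⊇ k S _ (S-closed m i∈E j∈E (iterate-⊆ S-closed k S (λ _ → id) _ p))
      where
      S-closed : Closed (λ v → S v ≡ true)
      S-closed {j = j} m i∈E j∈E Si = decidable-stable (true? S j) λ ¬Sj → none (j , grow-new S m i∈E j∈E Si , ¬Sj)
    iterate-Closed zero S le | yes (v , _ , ¬Sv) = ⊥-elim (<⇒≱ (subst (# (true? S) <_) (#-all {n} (λ _ → yes tt) λ _ → tt)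
      (#-mono-< (true? S) (λ _ → yes tt) (λ _ _ → tt) v tt ¬Sv)) (≤-trans le (≤-reflexive (+-identityʳ _))))
    iterate-Closed (suc k) S le | yes (v , new , ¬Sv) = iterate-Closed k (grow H S)
      (≤-trans le (≤-trans (≤-reflexive (+-suc _ k)) (+-monoˡ-≤ k (#-mono-< (true? S) (true? (grow H S)) (grow-old S) v new ¬Sv))))

    ≟ᵇ⁻ : ∀ {i v : Fin n} → (v ≟ᵇ i) ≡ true → v ≡ i
    ≟ᵇ⁻ {i} {v} = does⁻ (v ≟ᶠ i)

  reachable⇒comp : ∀ {i j} → reachable H i j ≡ true → comp H [ i ~ j ]
  reachable⇒comp {i} {j} = iterate-⊆ {Q = λ v → comp H [ i ~ v ]} (λ m p q r → ~trans (comp H) r (comp-edge m p q)) n (λ v → v ≟ᵇ i)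
    (λ v eq → subst (λ w → comp H [ i ~ w ]) (sym (≟ᵇ⁻ eq)) (~refl (comp H))) j

  -- The set reached from `i` is closed under edges, so being both reached or both not reached is an
  -- equivalence relation that contains all edges.
  comp⇒reachable : ∀ {i j} → comp H [ i ~ j ] → reachable H i j ≡ true
  comp⇒reachable {i} p = proj₁ (comp-least H same-reach (λ m p q → closed m p q , closed m q p) p)
      (iterate-⊇ n (λ v → v ≟ᵇ i) i (does⁺ (i ≟ᶠ i) refl))
    where
    R : Fin n → Set
    R v = iterate H n (λ w → w ≟ᵇ i) v ≡ true
    closed : Closed R
    closed = iterate-Closed n (λ v → v ≟ᵇ i) (m≤n+m n _)
    same-reach : IsEquivalence (λ a b → (R a → R b) × (R b → R a))
    same-reach = record { refl = id , id ; sym = λ (f , g) → g , f ; trans = λ (f , g) (f′ , g′) → f′ ∘ f , g ∘ g′ }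

  isConnected⁻ : isConnectedᵇ H ≡ true → total ⊑ comp H
  isConnected⁻ h {i} {j} _ = reachable⇒comp (allᶠ⁻ _ (allᶠ⁻ _ h i) j)

  isConnected⁺ : total ⊑ comp H → isConnectedᵇ H ≡ true
  isConnected⁺ h = allᶠ⁺ {n} _ λ i → allᶠ⁺ {n} (reachable H i) λ j → comp⇒reachable {i} {j} (h tt)

  isNoncrossingHypergraph⁻ : isNoncrossingHypergraphᵇ H ≡ true → Noncrossing H
  isNoncrossingHypergraph⁻ h {E} {F} mE mF E≢F {a} {c} {b} {e} a∈ c∈ b∈ e∈ a≢b a≢e c≢b c≢e =
    by-cases (side a c b) (side a c e) refl refl
    where
    strict : ∀ {i j : Fin n} → i ≼ j → i ≢ j → i ≺ j
    strict i≤j i≢j = ≤∧≢⇒< i≤j (i≢j ∘ toℕ-injective)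
    uncrossed : ∀ {E F i j k l} → E ∈ H → F ∈ H → E ≢ F → i ≺ j → j ≺ k → k ≺ l → i ∈ₑ E → k ∈ₑ E → j ∈ₑ F → l ∈ₑ F → ⊥
    uncrossed {E} {F} {i} {j} {k} {l} mE mF E≢F i<j j<k k<l i∈ k∈ j∈ l∈ = contradiction
      (trans (sym (allᶠ⁻ _ (allᶠ⁻ _ (allᶠ⁻ _ (allᶠ⁻ _ (⇒ᵇ⁻ (not (does (E ≟ₑ F))) (all⁻ _ (all⁻ _ h mE) mF) (distinct E≢F)) i) j) k) l))
        (cong not (∧⁺ {i <ᶠ j} (<ᶠ-true i<j) (∧⁺ {j <ᶠ k} (<ᶠ-true j<k) (∧⁺ {k <ᶠ l} (<ᶠ-true k<l) (∧⁺ i∈ (∧⁺ k∈ (∧⁺ j∈ l∈)))))))) λ ()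
      where
      distinct : E ≢ F → not (does (E ≟ₑ F)) ≡ true
      distinct neq with E ≟ₑ F
      ... | yes eq = ⊥-elim (neq eq)
      ... | no _ = refl
    crossing : ∀ {a c b e} → a ∈ₑ E → c ∈ₑ E → b ∈ₑ F → e ∈ₑ F → a ≢ b → c ≢ e → a ≢ e → a ≼ b → b ≺ c → side a c e ≡ false → ⊥
    crossing {a} {c} {b} {e} a∈ c∈ b∈ e∈ a≢b c≢e a≢e a≤b b<c se with ≺⊎≽ e a | ≺⊎≽ e c
    ... | inj₁ e<a | _ = uncrossed mF mE (E≢F ∘ sym) e<a (strict a≤b a≢b) b<c e∈ b∈ a∈ c∈
    ... | inj₂ a≤e | inj₁ e<c = contradiction (trans (sym se) (side-in a≤e e<c)) λ ()
    ... | inj₂ a≤e | inj₂ c≤e = uncrossed mE mF E≢F (strict a≤b a≢b) b<c (strict c≤e c≢e) a∈ c∈ b∈ e∈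
    crosses : ∀ {b e} → b ∈ₑ F → e ∈ₑ F → a ≢ b → a ≢ e → c ≢ b → c ≢ e → side a c b ≡ true → side a c e ≡ false → ⊥
    crosses {b} {e} b∈ e∈ a≢b a≢e c≢b c≢e sb se with side-true⁻ sb
    ... | inj₁ (a≤b , b<c) = crossing a∈ c∈ b∈ e∈ a≢b c≢e a≢e a≤b b<c se
    ... | inj₂ (c≤b , b<a) = crossing c∈ a∈ b∈ e∈ c≢b a≢e c≢e c≤b b<a (trans (side-comm c a e) se)
    by-cases : ∀ s t → side a c b ≡ s → side a c e ≡ t → side a c b ≡ side a c e
    by-cases true  true  p q = trans p (sym q)
    by-cases false false p q = trans p (sym q)
    by-cases true  false p q = ⊥-elim (crosses b∈ e∈ a≢b a≢e c≢b c≢e p q)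
    by-cases false true  p q = ⊥-elim (crosses e∈ b∈ a≢e a≢b c≢e c≢b q p)

  isNoncrossingHypergraph⁺ : Noncrossing H → isNoncrossingHypergraphᵇ H ≡ true
  isNoncrossingHypergraph⁺ ncH = all⁺ _ H λ E mE → all⁺ _ H λ F mF → ⇒ᵇ⁺ (not (does (E ≟ₑ F))) λ neq →
    allᶠ⁺ _ λ i → allᶠ⁺ _ λ j → allᶠ⁺ _ λ k → allᶠ⁺ _ λ l → not-true (λ t →
      let (i<j , t₁) = ∧⁻ (i <ᶠ j) t
          (j<k , t₂) = ∧⁻ (j <ᶠ k) t₁
          (k<l , t₃) = ∧⁻ (k <ᶠ l) t₂
          (i∈ , t₄) = ∧⁻ (Vec.lookup E i) t₃
          (k∈ , t₅) = ∧⁻ (Vec.lookup E k) t₄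
          (j∈ , l∈) = ∧⁻ (Vec.lookup F j) t₅
      in uncrossed mE mF (distinct neq) (<ᶠ-true⁻ i<j) (<ᶠ-true⁻ j<k) (<ᶠ-true⁻ k<l) i∈ k∈ j∈ l∈)
    where
    not-true : ∀ {b} → (b ≡ true → ⊥) → not b ≡ true
    not-true {true}  h = ⊥-elim (h refl)
    not-true {false} h = refl
    distinct : ∀ {E F : Edge n} → not (does (E ≟ₑ F)) ≡ true → E ≢ F
    distinct {E} {F} h eq with E ≟ₑ F
    distinct () eq | yes _
    distinct h eq  | no neq = neq eq
    uncrossed : ∀ {E F i j k l} → E ∈ H → F ∈ H → E ≢ F → i ≺ j → j ≺ k → k ≺ l → i ∈ₑ E → k ∈ₑ E → j ∈ₑ F → l ∈ₑ F → ⊥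
    uncrossed {E} {F} {i} {j} {k} {l} mE mF E≢F i<j j<k k<l i∈ k∈ j∈ l∈ = contradiction
      (trans (sym (side-in (<⇒≤ i<j) j<k)) (trans (ncH mE mF E≢F i∈ k∈ j∈ l∈
        (λ { refl → <-irrefl refl i<j }) (λ { refl → <-irrefl refl (<-trans i<j (<-trans j<k k<l)) })
        (λ { refl → <-irrefl refl j<k }) (λ { refl → <-irrefl refl k<l }))
        (side-above (<⇒≤ (<-trans i<j (<-trans j<k k<l))) (<⇒≤ k<l)))) λ ()

sum≡weight : ∀ (T : List (Edge n)) → sum (map (λ E → ∣ E ∣ₑ ∸ 1) T) ≡ weight T
sum≡weight []      = refl
sum≡weight (E ∷ T) = cong ((∣ E ∣ₑ ∸ 1) +_) (sum≡weight T)

-- Enumeration of hypergraphs as sublists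

∈-sublists-⊆ : ∀ {es T : List A} → T ∈ sublists es → ∀ {x} → x ∈ T → x ∈ es
∈-sublists-⊆ {es = []} (here refl) ()
∈-sublists-⊆ {es = e ∷ es} m x∈T with ∈-++⁻ (sublists es) m
... | inj₁ m′ = there (∈-sublists-⊆ m′ x∈T)
... | inj₂ m′ with ∈-map⁻ (e ∷_) m′
∈-sublists-⊆ {es = e ∷ es} m (here refl) | inj₂ _ | T′ , m″ , refl = here refl
∈-sublists-⊆ {es = e ∷ es} m (there x∈T) | inj₂ _ | T′ , m″ , refl = there (∈-sublists-⊆ m″ x∈T)

∈-sublists-unique : ∀ {es T : List A} → Unique es → T ∈ sublists es → Unique T
∈-sublists-unique {es = []} u (here refl) = []
∈-sublists-unique {es = e ∷ es} (e∉ ∷ u) m with ∈-++⁻ (sublists es) m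
... | inj₁ m′ = ∈-sublists-unique u m′
... | inj₂ m′ with ∈-map⁻ (e ∷_) m′
...   | T′ , m″ , refl = All.tabulate (λ x∈T′ → All.lookup e∉ (∈-sublists-⊆ m″ x∈T′)) ∷ ∈-sublists-unique u m″

filter-∈-sublists : ∀ {R : A → Set} (R? : ∀ x → Dec (R x)) es → filter R? es ∈ sublists es
filter-∈-sublists R? [] = here refl
filter-∈-sublists R? (e ∷ es) with R? e
... | yes _ = ∈-++⁺ʳ (sublists es) (∈-map⁺ (e ∷_) (filter-∈-sublists R? es))
... | no _  = ∈-++⁺ˡ (filter-∈-sublists R? es)

-- A sublist inherits the order of a duplicate-free list, hence is determined by its members; this
-- allows hypergraphs to be compared as sets.
sublists-ext : ∀ {es T T′ : List A} → Unique es → T ∈ sublists es → T′ ∈ sublists es →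
               (∀ {x} → x ∈ T → x ∈ T′) → (∀ {x} → x ∈ T′ → x ∈ T) → T ≡ T′
sublists-ext {es = []} u (here refl) (here refl) h k = refl
sublists-ext {es = e ∷ es} (e∉ ∷ u) m m′ h k with ∈-++⁻ (sublists es) m | ∈-++⁻ (sublists es) m′
... | inj₁ p | inj₁ p′ = sublists-ext u p p′ h k
... | inj₁ p | inj₂ p′ with ∈-map⁻ (e ∷_) p′
...   | T₁ , _ , refl = ⊥-elim (All.lookup e∉ (∈-sublists-⊆ p (k (here refl))) refl)
sublists-ext {es = e ∷ es} (e∉ ∷ u) m m′ h k | inj₂ p | inj₁ p′ with ∈-map⁻ (e ∷_) p
...   | T₁ , _ , refl = ⊥-elim (All.lookup e∉ (∈-sublists-⊆ p′ (h (here refl))) refl)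
sublists-ext {es = e ∷ es} (e∉ ∷ u) m m′ h k | inj₂ p | inj₂ p′ with ∈-map⁻ (e ∷_) p | ∈-map⁻ (e ∷_) p′
...   | T₁ , q , refl | T₁′ , q′ , refl = cong (e ∷_) (sublists-ext u q q′ (tail q h) (tail q′ k))
  where
  tail : ∀ {S S′} → S ∈ sublists es → (∀ {x} → x ∈ e ∷ S → x ∈ e ∷ S′) → ∀ {x} → x ∈ S → x ∈ S′
  tail q h x∈S with h (there x∈S)
  ... | here refl = ⊥-elim (All.lookup e∉ (∈-sublists-⊆ q x∈S) refl)
  ... | there x∈S′ = x∈S′

Unique-sublists : ∀ {es : List A} → Unique es → Unique (sublists es)
Unique-sublists {es = []} [] = [] ∷ []
Unique-sublists {es = e ∷ es} (e∉ ∷ u) = ++⁺ (Unique-sublists u) (map⁺ (λ { refl → refl }) (Unique-sublists u)) disjoint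
  where
  disjoint : ∀ {T} → ¬ (T ∈ sublists es × T ∈ map (e ∷_) (sublists es))
  disjoint (m , m′) with ∈-map⁻ (e ∷_) m′
  ... | T′ , _ , refl = All.lookup e∉ (∈-sublists-⊆ m (here refl)) refl

edges : ∀ n → List (Edge n)
edges n = filterᵇ (λ E → 2 ≤ᵇ ∣ E ∣ₑ) (allVecs bools n)

Unique-edges : ∀ n → Unique (edges n)
Unique-edges n = Unique-filterᵇ (λ E → 2 ≤ᵇ ∣ E ∣ₑ) (Unique-allVecs n Unique-bools)

∈-edges⁺ : (E : Edge n) → 2 ≤ ∣ E ∣ₑ → E ∈ edges n
∈-edges⁺ E 2≤ = ∈-filterᵇ⁺ (λ E → 2 ≤ᵇ ∣ E ∣ₑ) (∈-allVecs E λ _ → ∈-bools _) (T⇒≡true (≤⇒≤ᵇ 2≤))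

∈-edges⁻ : {E : Edge n} → E ∈ edges n → 2 ≤ ∣ E ∣ₑ
∈-edges⁻ {n} m = ≤ᵇ⇒≤ 2 _ (≡true⇒T (proj₂ (∈-filterᵇ⁻ (λ E → 2 ≤ᵇ ∣ E ∣ₑ) (allVecs bools n) m)))

∈-hypergraphs⇒≥2 : {T : Hypergraph n} → T ∈ hypergraphs n → ∀ E → E ∈ T → 2 ≤ ∣ E ∣ₑ
∈-hypergraphs⇒≥2 m E E∈T = ∈-edges⁻ (∈-sublists-⊆ m E∈T)

module _ (d : ℕ) where

  forest? : (T : List (Edge n)) (w : Part n) → Dec (Forest d T w)
  forest? {n} T w = map′ to from
    ( (isNoncrossingHypergraphᵇ T Boolₚ.≟ true)
    ×-dec (all? λ i → all? λ j → dec (comp T) i j →-dec dec w i j)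
    ×-dec (all? λ i → all? λ j → dec w i j →-dec dec (comp T) i j)
    ×-dec (weight T ≟ rank w)
    ×-dec All.all? (λ E → d ∣? (∣ E ∣ₑ ∸ 1)) T
    ×-dec All.all? (λ E → 2 ≤? ∣ E ∣ₑ) T)
    where
    Conditions : Set
    Conditions = isNoncrossingHypergraphᵇ T ≡ true × (∀ i j → comp T [ i ~ j ] → w [ i ~ j ]) × (∀ i j → w [ i ~ j ] → comp T [ i ~ j ]) ×
      weight T ≡ rank w × All (λ E → d ∣ ∣ E ∣ₑ ∸ 1) T × All (λ E → 2 ≤ ∣ E ∣ₑ) T
    to : Conditions → Forest d T w
    to (a , b , c , e , f , g) = record { noncrossing = isNoncrossingHypergraph⁻ T a ; spans = (λ {i} {j} → b i j) , (λ {i} {j} → c i j)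
      ; weight≡rank = e ; edgeSizes = λ E → All.lookup f ; edge≥2 = λ E → All.lookup g }
    from : Forest d T w → Conditions
    from F = isNoncrossingHypergraph⁺ T (noncrossing F) , (λ i j → proj₁ (spans F)) , (λ i j → proj₂ (spans F)) ,
      weight≡rank F , All.tabulate (edgeSizes F _) , All.tabulate (edge≥2 F _)

  Forest-≗ : {T : List (Edge n)} (w w′ : Part n) → w ≗ w′ → Forest d T w → Forest d T w′
  Forest-≗ {T = T} w w′ eq F = record { noncrossing = noncrossing F ; spans = ≗-trans (comp T) w w′ (spans F) eq
    ; weight≡rank = trans (weight≡rank F) (rank-cong {x = w} {w′} eq) ; edgeSizes = edgeSizes F ; edge≥2 = edge≥2 F }

  isNCHypertree : Hypergraph n → Bool
  isNCHypertree T = isHypertreeᵇ T ∧ isNoncrossingHypergraphᵇ T ∧ all (λ E → ≡1mod d ∣ E ∣ₑ) T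

  isNCHypertree⁻ : {T : Hypergraph n} → T ∈ hypergraphs n → isNCHypertree T ≡ true → Forest d T total
  isNCHypertree⁻ {n} {T} m h with ∧⁻ (isHypertreeᵇ T) h
  ... | ht , h₁ with ∧⁻ (isConnectedᵇ T) ht | ∧⁻ (isNoncrossingHypergraphᵇ T) h₁
  ...   | conn , wt | ncT , s = record { noncrossing = isNoncrossingHypergraph⁻ T ncT ; spans = (λ _ → tt) , isConnected⁻ T conn
    ; weight≡rank = trans (sym (sum≡weight T)) (trans (≡ᵇ⇒≡ (sum (map (λ E → ∣ E ∣ₑ ∸ 1) T)) _ (≡true⇒T wt)) (sym (rank-total {n})))
    ; edgeSizes = λ E E∈T → does⁻ (d ∣? (∣ E ∣ₑ ∸ 1)) (all⁻ (λ E → ≡1mod d ∣ E ∣ₑ) s E∈T) ; edge≥2 = ∈-hypergraphs⇒≥2 m }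

  isNCHypertree⁺ : {T : Hypergraph n} → Forest d T total → isNCHypertree T ≡ true
  isNCHypertree⁺ {n} {T} F = ∧⁺ (∧⁺ (isConnected⁺ T (proj₂ (spans F)))
      (T⇒≡true (≡⇒≡ᵇ _ _ (trans (sum≡weight T) (trans (weight≡rank F) (rank-total {n}))))))
    (∧⁺ (isNoncrossingHypergraph⁺ T (noncrossing F)) (all⁺ (λ E → ≡1mod d ∣ E ∣ₑ) T λ E m → does⁺ (d ∣? (∣ E ∣ₑ ∸ 1)) (edgeSizes F E m)))

-- Integer sums and chains

∑ℤ : (A → ℤ) → List A → ℤ
∑ℤ f []       = 0ℤ
∑ℤ f (x ∷ xs) = f x +ᶻ ∑ℤ f xs

∑ℤ-cong : ∀ {f g : A → ℤ} xs → (∀ x → x ∈ xs → f x ≡ g x) → ∑ℤ f xs ≡ ∑ℤ g xs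
∑ℤ-cong []       h = refl
∑ℤ-cong (x ∷ xs) h = cong₂ _+ᶻ_ (h x (here refl)) (∑ℤ-cong xs λ y m → h y (there m))

∑ℤ-zero : ∀ {f : A → ℤ} xs → (∀ x → x ∈ xs → f x ≡ 0ℤ) → ∑ℤ f xs ≡ 0ℤ
∑ℤ-zero []       h = refl
∑ℤ-zero (x ∷ xs) h = cong₂ _+ᶻ_ (h x (here refl)) (∑ℤ-zero xs λ y m → h y (there m))

∑ℤ-++ : ∀ (f : A → ℤ) xs ys → ∑ℤ f (xs ++ ys) ≡ ∑ℤ f xs +ᶻ ∑ℤ f ys
∑ℤ-++ f []       ys = sym (ℤₚ.+-identityˡ _)
∑ℤ-++ f (x ∷ xs) ys = trans (cong (f x +ᶻ_) (∑ℤ-++ f xs ys)) (sym (ℤₚ.+-assoc (f x) _ _))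

∑ℤ-map : ∀ (f : B → ℤ) (g : A → B) xs → ∑ℤ f (map g xs) ≡ ∑ℤ (f ∘ g) xs
∑ℤ-map f g []       = refl
∑ℤ-map f g (x ∷ xs) = cong (f (g x) +ᶻ_) (∑ℤ-map f g xs)

∑ℤ-concatMap : ∀ (f : B → ℤ) (g : A → List B) xs → ∑ℤ f (concatMap g xs) ≡ ∑ℤ (λ x → ∑ℤ f (g x)) xs
∑ℤ-concatMap f g []       = refl
∑ℤ-concatMap f g (x ∷ xs) = trans (∑ℤ-++ f (g x) (concatMap g xs)) (cong (∑ℤ f (g x) +ᶻ_) (∑ℤ-concatMap f g xs))

∑ℤ-neg : ∀ (f : A → ℤ) xs → ∑ℤ (λ x → - f x) xs ≡ - ∑ℤ f xs
∑ℤ-neg f []       = refl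
∑ℤ-neg f (x ∷ xs) = trans (cong (- f x +ᶻ_) (∑ℤ-neg f xs)) (sym (ℤₚ.neg-distrib-+ (f x) _))

∑ℤ-*ˡ : ∀ c (f : A → ℤ) xs → ∑ℤ (λ x → c *ᶻ f x) xs ≡ c *ᶻ ∑ℤ f xs
∑ℤ-*ˡ c f []       = sym (ℤₚ.*-zeroʳ c)
∑ℤ-*ˡ c f (x ∷ xs) = trans (cong (c *ᶻ f x +ᶻ_) (∑ℤ-*ˡ c f xs)) (sym (ℤₚ.*-distribˡ-+ c (f x) _))

∑ℤ-+ : ∀ (f g : A → ℤ) xs → ∑ℤ (λ x → f x +ᶻ g x) xs ≡ ∑ℤ f xs +ᶻ ∑ℤ g xs
∑ℤ-+ f g []       = refl
∑ℤ-+ f g (x ∷ xs) = begin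
  f x +ᶻ g x +ᶻ ∑ℤ (λ y → f y +ᶻ g y) xs    ≡⟨ cong (f x +ᶻ g x +ᶻ_) (∑ℤ-+ f g xs) ⟩
  f x +ᶻ g x +ᶻ (∑ℤ f xs +ᶻ ∑ℤ g xs)        ≡⟨ ℤₚ.+-assoc (f x) (g x) _ ⟩
  f x +ᶻ (g x +ᶻ (∑ℤ f xs +ᶻ ∑ℤ g xs))      ≡⟨ cong (f x +ᶻ_) (swap-middle (g x) (∑ℤ f xs) (∑ℤ g xs)) ⟩
  f x +ᶻ (∑ℤ f xs +ᶻ (g x +ᶻ ∑ℤ g xs))      ≡⟨ ℤₚ.+-assoc (f x) _ _ ⟨
  f x +ᶻ ∑ℤ f xs +ᶻ (g x +ᶻ ∑ℤ g xs)        ∎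
  where
  open ≡-Reasoning
  swap-middle : ∀ a b c → a +ᶻ (b +ᶻ c) ≡ b +ᶻ (a +ᶻ c)
  swap-middle a b c = trans (sym (ℤₚ.+-assoc a b c)) (trans (cong (_+ᶻ c) (ℤₚ.+-comm a b)) (ℤₚ.+-assoc b a c))

∑ℤ-↭ : ∀ (f : A → ℤ) {xs ys} → xs ↭ ys → ∑ℤ f xs ≡ ∑ℤ f ys
∑ℤ-↭ f ↭-refl       = refl
∑ℤ-↭ f (prep x p)   = cong (f x +ᶻ_) (∑ℤ-↭ f p)
∑ℤ-↭ f (swap x y p) = trans (cong (λ s → f x +ᶻ (f y +ᶻ s)) (∑ℤ-↭ f p))
  (trans (sym (ℤₚ.+-assoc (f x) (f y) _)) (trans (cong (_+ᶻ _) (ℤₚ.+-comm (f x) (f y))) (ℤₚ.+-assoc (f y) (f x) _)))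
∑ℤ-↭ f (↭-step p q) = trans (∑ℤ-↭ f p) (∑ℤ-↭ f q)

when : Bool → ℤ → ℤ
when b z = if b then z else 0ℤ

when-neg : ∀ b z → when b (- z) ≡ - when b z
when-neg true  z = refl
when-neg false z = refl

∑ℤ-filter : ∀ {R : A → Set} (R? : ∀ x → Dec (R x)) (f : A → ℤ) xs → ∑ℤ f (filter R? xs) ≡ ∑ℤ (λ x → when (does (R? x)) (f x)) xs
∑ℤ-filter R? f [] = refl
∑ℤ-filter R? f (x ∷ xs) with does (R? x)
... | true  = cong (f x +ᶻ_) (∑ℤ-filter R? f xs)
... | false = trans (∑ℤ-filter R? f xs) (sym (ℤₚ.+-identityˡ _))

∑ℤ-single : ∀ (f : Fin n → ℤ) i {xs} → Unique xs → i ∈ xs → ∑ℤ (λ j → when (does (j ≟ᶠ i)) (f j)) xs ≡ f i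
∑ℤ-single f i {x ∷ xs} (x∉ ∷ u) (here refl) with x ≟ᶠ x
... | no x≢x = ⊥-elim (x≢x refl)
... | yes _ = trans (cong (f x +ᶻ_) (∑ℤ-zero xs λ y m → absent y m)) (ℤₚ.+-identityʳ _)
  where
  absent : ∀ y → y ∈ xs → when (does (y ≟ᶠ x)) (f y) ≡ 0ℤ
  absent y m with y ≟ᶠ x
  ... | yes refl = ⊥-elim (All.lookup x∉ m refl)
  ... | no _ = refl
∑ℤ-single f i {x ∷ xs} (x∉ ∷ u) (there m) with x ≟ᶠ i
... | yes refl = ⊥-elim (All.lookup x∉ m refl)
... | no _ = trans (ℤₚ.+-identityˡ _) (∑ℤ-single f i u m)

module _ (f : A → ℤ) (g : B → ℤ) (R : A → B → Set) where

  private
    images : ∀ xs → (∀ {x} → x ∈ xs → ∃ (R x)) → List B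
    images []       h = []
    images (x ∷ xs) h = proj₁ (h (here refl)) ∷ images xs (h ∘ there)

    ∈-images⁻ : ∀ xs (h : ∀ {x} → x ∈ xs → ∃ (R x)) {y} → y ∈ images xs h → ∃[ x ] ∃[ m ] y ≡ proj₁ (h {x} m)
    ∈-images⁻ (x ∷ xs) h (here refl) = x , here refl , refl
    ∈-images⁻ (x ∷ xs) h (there m) = let (x′ , m′ , eq) = ∈-images⁻ xs (h ∘ there) m in x′ , there m′ , eq

    ∈-images⁺ : ∀ xs (h : ∀ {x} → x ∈ xs → ∃ (R x)) {x} (m : x ∈ xs) → proj₁ (h m) ∈ images xs h
    ∈-images⁺ (x ∷ xs) h (here refl) = here refl
    ∈-images⁺ (x ∷ xs) h (there m) = there (∈-images⁺ xs (h ∘ there) m)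

    Unique-images : ∀ {xs} (h : ∀ {x} → x ∈ xs → ∃ (R x)) → Unique xs →
                    (∀ {x x′} (m : x ∈ xs) (m′ : x′ ∈ xs) → proj₁ (h m) ≡ proj₁ (h m′) → x ≡ x′) → Unique (images xs h)
    Unique-images {[]} h [] inj = []
    Unique-images {x ∷ xs} h (x∉ ∷ u) inj = All.tabulate (λ m eq → let (x′ , m′ , eq′) = ∈-images⁻ xs (h ∘ there) m in
        All.lookup x∉ m′ (inj (here refl) (there m′) (trans eq eq′)))
      ∷ Unique-images (h ∘ there) u λ m m′ → inj (there m) (there m′)

    ∑ℤ-images : ∀ xs (h : ∀ {x} → x ∈ xs → ∃ (R x)) → (∀ {x y} → R x y → f x ≡ g y) → ∑ℤ f xs ≡ ∑ℤ g (images xs h)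
    ∑ℤ-images []       h eq = refl
    ∑ℤ-images (x ∷ xs) h eq = cong₂ _+ᶻ_ (eq (proj₂ (h (here refl)))) (∑ℤ-images xs (h ∘ there) eq)

  -- The chosen partners of the elements of `xs` form a permutation of `ys`. The correspondence is a
  -- relation because it is bijective only between the listed elements.
  ∑ℤ-matching : ∀ {xs ys} → Unique xs → Unique ys →
                (∀ {x} → x ∈ xs → ∃[ y ] R x y × y ∈ ys) → (∀ {y} → y ∈ ys → ∃[ x ] R x y × x ∈ xs) →
                (∀ {x y y′} → x ∈ xs → y ∈ ys → y′ ∈ ys → R x y → R x y′ → y ≡ y′) →
                (∀ {x x′ y} → x ∈ xs → x′ ∈ xs → y ∈ ys → R x y → R x′ y → x ≡ x′) →
                (∀ {x y} → R x y → f x ≡ g y) → ∑ℤ f xs ≡ ∑ℤ g ys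
  ∑ℤ-matching {xs} {ys} u v tot onto functional injective eq = trans (∑ℤ-images xs h eq) (∑ℤ-↭ g (unique-↭
      (Unique-images h u λ {x} {x′} m m′ e → injective m m′ (proj₂ (proj₂ (tot m))) (proj₁ (proj₂ (tot m)))
        (subst (R x′) (sym e) (proj₁ (proj₂ (tot m′)))))
      v
      (λ m → let (x , m′ , e) = ∈-images⁻ xs h m in subst (_∈ ys) (sym e) (proj₂ (proj₂ (tot m′))))
      λ {y} m → let (x , r , m′) = onto m in
        subst (_∈ images xs h) (functional m′ (proj₂ (proj₂ (tot m′))) m (proj₁ (proj₂ (tot m′))) r) (∈-images⁺ xs h m′)))
    where
    h : ∀ {x} → x ∈ xs → ∃ (R x)
    h m = proj₁ (tot m) , proj₁ (proj₂ (tot m))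

pairs : List A → (A → List B) → List (A × B)
pairs xs g = concatMap (λ x → map (x ,_) (g x)) xs

∑ℤ-pairs : ∀ (f : A × B → ℤ) xs (g : A → List B) → ∑ℤ f (pairs xs g) ≡ ∑ℤ (λ x → ∑ℤ (λ y → f (x , y)) (g x)) xs
∑ℤ-pairs f xs g = trans (∑ℤ-concatMap f (λ x → map (x ,_) (g x)) xs) (∑ℤ-cong xs λ x _ → ∑ℤ-map f (x ,_) (g x))

∈-pairs⁺ : ∀ {xs} {g : A → List B} {x y} → x ∈ xs → y ∈ g x → (x , y) ∈ pairs xs g
∈-pairs⁺ {xs = x ∷ xs} (here refl) m = ∈-++⁺ˡ (∈-map⁺ (x ,_) m)
∈-pairs⁺ {xs = z ∷ xs} {g} (there p) m = ∈-++⁺ʳ (map (z ,_) (g z)) (∈-pairs⁺ p m)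

∈-pairs⁻ : ∀ xs {g : A → List B} {x y} → (x , y) ∈ pairs xs g → x ∈ xs × y ∈ g x
∈-pairs⁻ (z ∷ xs) {g} m with ∈-++⁻ (map (z ,_) (g z)) m
... | inj₂ m′ = let (p , q) = ∈-pairs⁻ xs m′ in there p , q
... | inj₁ m′ with ∈-map⁻ (z ,_) m′
...   | _ , q , refl = here refl , q

Unique-pairs : ∀ {xs} {g : A → List B} → Unique xs → (∀ x → Unique (g x)) → Unique (pairs xs g)
Unique-pairs [] h = []
Unique-pairs {xs = x ∷ xs} {g} (x∉ ∷ u) h = ++⁺ (map⁺ (λ { refl → refl }) (h x)) (Unique-pairs u h) disjoint
  where
  disjoint : ∀ {p} → ¬ (p ∈ map (x ,_) (g x) × p ∈ pairs xs g)
  disjoint (m , m′) with ∈-map⁻ (x ,_) m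
  ... | _ , _ , refl = All.lookup x∉ (proj₁ (∈-pairs⁻ xs m′)) refl

sign-+ : ∀ a b → sign (a + b) ≡ sign a *ᶻ sign b
sign-+ zero    b = sym (ℤₚ.*-identityˡ (sign b))
sign-+ (suc a) b = trans (cong -_ (sign-+ a b)) (ℤₚ.neg-distribˡ-* (sign a) (sign b))

sign-square : ∀ a → sign a *ᶻ sign a ≡ 1ℤ
sign-square zero    = refl
sign-square (suc a) = trans (sym (ℤₚ.neg-distribˡ-* (sign a) (- sign a))) (trans (cong -_ (sym (ℤₚ.neg-distribʳ-* (sign a) (sign a))))
  (trans (ℤₚ.neg-involutive _) (sign-square a)))

-- Inserting or omitting the first element of `es` that satisfies `R` reverses the sign; the filter
-- removes every sublist through an earlier element.
∑ℤ-alternating : ∀ {R : A → Set} (R? : ∀ x → Dec (R x)) es {e} → e ∈ es → R e →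
                 ∑ℤ (λ T → sign (length T)) (filter (All.all? R?) (sublists es)) ≡ 0ℤ
∑ℤ-alternating {A} {R} R? es m r = trans (∑ℤ-filter (All.all? R?) (λ T → sign (length T)) (sublists es)) (go es m r)
  where
  w : List A → ℤ
  w T = when (does (All.all? R? T)) (sign (length T))
  split : ∀ e es → ∑ℤ w (sublists (e ∷ es)) ≡ ∑ℤ w (sublists es) +ᶻ ∑ℤ (λ T → w (e ∷ T)) (sublists es)
  split e es = trans (∑ℤ-++ w (sublists es) (map (e ∷_) (sublists es))) (cong (∑ℤ w (sublists es) +ᶻ_) (∑ℤ-map w (e ∷_) (sublists es)))
  w-∷ : ∀ e T → R e → w (e ∷ T) ≡ - w T
  w-∷ e T r with R? e
  ... | yes _ = when-neg (does (All.all? R? T)) (sign (length T))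
  ... | no ¬r = ⊥-elim (¬r r)
  w-∷-no : ∀ e T → ¬ R e → w (e ∷ T) ≡ 0ℤ
  w-∷-no e T ¬r with R? e
  ... | yes r = ⊥-elim (¬r r)
  ... | no _ = refl
  cancel : ∀ e es → R e → ∑ℤ w (sublists (e ∷ es)) ≡ 0ℤ
  cancel e es r = trans (split e es) (trans (cong (∑ℤ w (sublists es) +ᶻ_) (trans (∑ℤ-cong (sublists es) λ T _ → w-∷ e T r) (∑ℤ-neg w (sublists es)))) (ℤₚ.+-inverseʳ (∑ℤ w (sublists es))))
  go : ∀ es {e} → e ∈ es → R e → ∑ℤ w (sublists es) ≡ 0ℤ
  go (e ∷ es) (here refl) r = cancel e es r
  go (e ∷ es) (there m) r with R? e
  ... | yes r′ = cancel e es r′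
  ... | no ¬r = trans (split e es) (cong₂ _+ᶻ_ (go es m r) (∑ℤ-zero (sublists es) λ T _ → w-∷-no e T ¬r))

evalSum≡∑ℤ : ∀ φ s → evalSum φ s ≡ ∑ℤ (λ t → proj₁ t *ᶻ φ (proj₂ t)) s
evalSum≡∑ℤ φ []      = refl
evalSum≡∑ℤ φ (t ∷ s) = cong (λ z → proj₁ t *ᶻ φ (proj₂ t) +ᶻ z) (evalSum≡∑ℤ φ s)

-- The antipode as a recursive sum over chains

module Chains (P : FinPoset) where

  isTop isBot : Fin (size P) → Bool
  isTop x = all (λ z → leq P z x) (allFin (size P))
  isBot x = all (λ z → leq P x z) (allFin (size P))

  _<ᴾ_ : Fin (size P) → Fin (size P) → Bool
  x <ᴾ y = leq P x y ∧ not (x ≟ᵇ y)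

  chainSum : (FinPoset → ℤ) → ℕ → Fin (size P) → ℤ
  chainSum φ fuel x = ∑ℤ (λ c → sign (proj₁ c) *ᶻ φ (prodPosets (proj₂ c))) (chainsFrom P fuel x)

  private
    ∑ℤ-if : ∀ (f : A → ℤ) b xs → ∑ℤ f (if b then xs else []) ≡ when b (∑ℤ f xs)
    ∑ℤ-if f true  xs = refl
    ∑ℤ-if f false xs = refl

  chainSum-zero : ∀ φ x → chainSum φ 0 x ≡ when (isTop x) (φ unitPoset)
  chainSum-zero φ x with isTop x
  ... | true  = trans (ℤₚ.+-identityʳ _) (ℤₚ.*-identityˡ (φ unitPoset))
  ... | false = refl

  -- Splitting off the first interval changes the invariant: multiplication by `interval P x y`
  -- becomes part of φ.
  chainSum-suc : ∀ φ fuel x → chainSum φ (suc fuel) x ≡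
    when (isTop x) (φ unitPoset) +ᶻ ∑ℤ (λ y → when (x <ᴾ y) (- chainSum (λ Q → φ (interval P x y ⊗ Q)) fuel y)) (allFin (size P))
  chainSum-suc φ fuel x = trans (∑ℤ-++ w (if isTop x then (0 , []) ∷ [] else []) _) (cong₂ _+ᶻ_
    (trans (∑ℤ-if w (isTop x) ((0 , []) ∷ [])) (cong (when (isTop x)) (trans (ℤₚ.+-identityʳ _) (ℤₚ.*-identityˡ (φ unitPoset)))))
    (trans (∑ℤ-concatMap w _ (allFin (size P))) (∑ℤ-cong (allFin (size P)) λ y _ → trans (∑ℤ-if w (x <ᴾ y) _) (cong (when (x <ᴾ y)) (extend y)))))
    where
    w : ℕ × List FinPoset → ℤ
    w c = sign (proj₁ c) *ᶻ φ (prodPosets (proj₂ c))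
    extend : ∀ y → ∑ℤ w (map (λ c → suc (proj₁ c) , interval P x y ∷ proj₂ c) (chainsFrom P fuel y)) ≡ - chainSum (λ Q → φ (interval P x y ⊗ Q)) fuel y
    extend y = trans (∑ℤ-map w _ (chainsFrom P fuel y)) (trans
      (∑ℤ-cong (chainsFrom P fuel y) λ c _ → sym (ℤₚ.neg-distribˡ-* (sign (proj₁ c)) _))
      (∑ℤ-neg (λ c → sign (proj₁ c) *ᶻ φ (interval P x y ⊗ prodPosets (proj₂ c))) (chainsFrom P fuel y)))

  evalSum-antipode : ∀ φ → evalSum φ (antipode P) ≡ ∑ℤ (λ x → when (isBot x) (chainSum φ (size P) x)) (allFin (size P))
  evalSum-antipode φ = trans (evalSum≡∑ℤ φ (antipode P)) (trans (∑ℤ-concatMap _ _ (allFin (size P)))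
    (∑ℤ-cong (allFin (size P)) λ x _ → trans (∑ℤ-if _ (isBot x) _) (cong (when (isBot x)) (∑ℤ-map _ _ (chainsFrom P (size P) x)))))

-- The antipode

module _ (d : ℕ) where

  -- With `Blocks-⊆`, a partition and the set of its nontrivial blocks determine each other;
  -- uniqueness in the matching of forests rests on this.
  Blocks-⊑ : {A : List (Edge n)} (u w : Part n) → Blocks d A u → Blocks d A w → u ⊑ w
  Blocks-⊑ u w B B′ {i} {j} p with i ≟ᶠ j
  ... | yes refl = ~refl w
  ... | no i≢j = let (E , m , i∈E) = cover B p i≢j in proj₂ (isBlock B′ E m i∈E) (proj₁ (isBlock B E m i∈E) p)

  Blocks-⊆ : {A A′ : List (Edge n)} (u : Part n) → Blocks d A u → Blocks d A′ u → ∀ {E} → E ∈ A → E ∈ A′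
  Blocks-⊆ u B B′ {E} m with two-vertices E (block≥2 B E m)
  ... | a , b , a∈E , b∈E , a<b with cover B′ (proj₂ (isBlock B E m a∈E) b∈E) (λ { refl → <-irrefl refl a<b })
  ...   | F , m′ , a∈F = subst (_∈ _) (sym (block-unique d {u = u} {E} {F} (isBlock B E m) (isBlock B′ F m′) a∈E a∈F (~refl u))) m′

  Blocks-≗ : {A : List (Edge n)} (u w : Part n) → u ≗ w → Blocks d A u → Blocks d A w
  Blocks-≗ u w (f , g) B = record
    { unique = unique B
    ; isBlock = λ E m i∈E → let (p , q) = isBlock B E m i∈E in p ∘ g , f ∘ q
    ; cover = cover B ∘ g
    ; block≥2 = block≥2 B }

  isBlock? : (u : Part n) (E : Edge n) → Dec (IsBlockOf E u)
  isBlock? u E = map′ (λ h {i} {j} → h i j) (λ h i j → h)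
    (all? λ i → all? λ j → (i ∈ₑ? E) →-dec ((dec u i j →-dec (j ∈ₑ? E)) ×-dec ((j ∈ₑ? E) →-dec dec u i j)))

  blocksOf : Part n → List (Edge n)
  blocksOf {n} u = filter (isBlock? u) (edges n)

  blocksOf-Blocks : (u : Part n) → Blocks d (blocksOf u) u
  blocksOf-Blocks {n} u = record
    { unique = filter⁺ (isBlock? u) (Unique-edges n)
    ; isBlock = λ E m → proj₂ (∈-filter⁻ (isBlock? u) {xs = edges n} m)
    ; cover = λ {i} {j} uij i≢j → blockEdge i , ∈-filter⁺ (isBlock? u) (∈-edges⁺ (blockEdge i) (≥2 uij i≢j)) (blockEdge-isBlock i) , ∈-blockEdge (~refl u)
    ; block≥2 = λ E m → ∈-edges⁻ (proj₁ (∈-filter⁻ (isBlock? u) {xs = edges n} m)) }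
    where
    blockEdge : Fin n → Edge n
    blockEdge i = Vec.tabulate λ j → does (dec u i j)
    ∈-blockEdge : ∀ {i j} → u [ i ~ j ] → j ∈ₑ blockEdge i
    ∈-blockEdge {i} {j} p = trans (lookup∘tabulate _ j) (does⁺ (dec u i j) p)
    ∈-blockEdge⁻ : ∀ {i j} → j ∈ₑ blockEdge i → u [ i ~ j ]
    ∈-blockEdge⁻ {i} {j} p = does⁻ (dec u i j) (trans (sym (lookup∘tabulate _ j)) p)
    blockEdge-isBlock : ∀ i → IsBlockOf (blockEdge i) u
    blockEdge-isBlock i j∈ = (λ p → ∈-blockEdge (~trans u (∈-blockEdge⁻ j∈) p)) , λ k∈ → ~trans u (~sym u (∈-blockEdge⁻ j∈)) (∈-blockEdge⁻ k∈)
    ≥2 : ∀ {i j} → u [ i ~ j ] → i ≢ j → 2 ≤ ∣ blockEdge i ∣ₑ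
    ≥2 {i} {j} uij i≢j = begin
      2                                     ≡⟨ cong₂ _+_ (#-singleton i) (#-singleton j) ⟨
      # (_≟ᶠ i) + # (_≟ᶠ j)                 ≡⟨ #-sum (_≟ᶠ i) (_≟ᶠ j) (λ k → (k ≟ᶠ i) ⊎-dec (k ≟ᶠ j)) (λ _ → id) (λ _ → id) (λ { k refl refl → i≢j refl }) ⟨
      # (λ k → (k ≟ᶠ i) ⊎-dec (k ≟ᶠ j))     ≤⟨ #-mono (λ k → (k ≟ᶠ i) ⊎-dec (k ≟ᶠ j)) (_∈ₑ? blockEdge i) (λ { k (inj₁ refl) → ∈-blockEdge (~refl u) ; k (inj₂ refl) → ∈-blockEdge uij }) ⟩
      # (_∈ₑ? blockEdge i)                  ≡⟨ ∣_∣ₑ≡# (blockEdge i) ⟨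
      ∣ blockEdge i ∣ₑ                      ∎
      where open ≤-Reasoning

  compatible? : (E F : Edge n) → Dec (Compatible E F)
  compatible? E F = map′ (λ h {a} {b} {i} {j} → h a b i j) (λ h a b i j → h)
    (all? λ a → all? λ b → all? λ i → all? λ j → (a ∈ₑ? E) →-dec ((b ∈ₑ? E) →-dec ((i ∈ₑ? F) →-dec ((j ∈ₑ? F) →-dec (side a b i Boolₚ.≟ side a b j)))))

  MinEdge : List (Edge n) → Edge n → Set
  MinEdge T E = E ∈ T × Minimal T E

  minEdge? : (T : List (Edge n)) (E : Edge n) → Dec (MinEdge T E)
  minEdge? T E = (E ∈? T) ×-dec map′ (λ h {F} m → All.lookup h m) (λ h → All.tabulate h) (All.all? (λ F → ¬? (F ≟ₑ E) →-dec compatible? E F) T)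
    where open DecMembership _≟ₑ_ using (_∈?_)

  K-Δ : K (Δ {n}) ≗ total
  K-Δ = (λ _ → tt) , λ {i} {j} _ → unsep λ { {a} refl → trans (side-same a i) (sym (side-same a j)) }

  K-total : K (total {n}) ≗ Δ
  K-total = (λ {i} {j} k → decidable-stable (i ≟ᶠ j) λ i≢j → side-separates i≢j (sameSide k tt)) , λ { refl → ~refl (K total) }

  module _ (d∣n∸1 : d ∣ n ∸ 1) where
    open Indivisible d

    private
      Sizes-Δ : Sizes (Δ {n})
      Sizes-Δ i = ∣blockSize-singleton (Δ {n}) {i = i} λ j eq → sym eq
      Sizes-total : Sizes (total {n})
      Sizes-total i = subst (λ k → d ∣ k ∸ 1) (sym (#-all {n} (dec total i) λ _ → tt)) d∣n∸1

    Δ-Good : Good (Δ {n})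
    Δ-Good = good (λ { {a} {_} {b} {e} refl _ _ → trans (side-same a b) (sym (side-same a e)) }) Sizes-Δ (Sizes-≗ total (K Δ) (≗-sym {x = K Δ} {total} K-Δ) Sizes-total)

    total-Good : Good (total {n})
    total-Good = good total-NC Sizes-total (Sizes-≗ Δ (K total) (≗-sym {x = K total} {Δ} K-total) Sizes-Δ)

module Antipode (d : ℕ) (elements : ∀ k → List (Rel k)) (Unique-elements : ∀ k → Unique (elements k))
  (∈-elements⁻ : ∀ {k} {M : Rel k} → M ∈ elements k → IsPartition M × Indivisible.Good d (part M))
  (∈-elements⁺ : ∀ {k} (x : Part k) → Indivisible.Good d x → toRel x ∈ elements k) {n : ℕ} (d∣n∸1 : d ∣ n ∸ 1) where
  open Indivisible d
  open NCPosets d elements Unique-elements ∈-elements⁻ ∈-elements⁺ {n}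
  open DecMembership (_≟ₑ_ {n}) using (_∈?_)

  P : FinPoset
  P = 𝒫 n

  open Chains P

  Index : Set
  Index = Fin (size P)

  forests : Index → List (Hypergraph n)
  forests x = filter (λ T → forest? d T (K (element x))) (hypergraphs n)

  private
    ∈-forests⁻ : ∀ x {T} → T ∈ forests x → T ∈ hypergraphs n × Forest d T (K (element x))
    ∈-forests⁻ x m = ∈-filter⁻ (λ T → forest? d T (K (element x))) {xs = hypergraphs n} m

    ∈-forests⁺ : ∀ x {T} → T ∈ hypergraphs n → Forest d T (K (element x)) → T ∈ forests x
    ∈-forests⁺ x m F = ∈-filter⁺ (λ T → forest? d T (K (element x))) m F

    Unique-hypergraphs : Unique (hypergraphs n)
    Unique-hypergraphs = Unique-sublists (Unique-edges n)

    Unique-forests : ∀ x → Unique (forests x)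
    Unique-forests x = filter⁺ (λ T → forest? d T (K (element x))) Unique-hypergraphs

    unique-hypergraph : ∀ {T} → T ∈ hypergraphs n → Unique T
    unique-hypergraph = ∈-sublists-unique (Unique-edges n)

    hypergraph-ext : ∀ {T T′} → T ∈ hypergraphs n → T′ ∈ hypergraphs n → (∀ {E} → E ∈ T → E ∈ T′) → (∀ {E} → E ∈ T′ → E ∈ T) → T ≡ T′
    hypergraph-ext = sublists-ext (Unique-edges n)

    hypergraph-⊆ : ∀ {T E} → T ∈ hypergraphs n → E ∈ T → E ∈ edges n
    hypergraph-⊆ m = ∈-sublists-⊆ m

    filter-∈-hypergraphs : {R : Edge n → Set} (R? : ∀ E → Dec (R E)) → filter R? (edges n) ∈ hypergraphs n
    filter-∈-hypergraphs R? = filter-∈-sublists R? (edges n)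

  module Fibre (x : Index) where

    private
      X = element x
      gX = element-Good x

    above : List Index
    above = filterᵇ (leq P x) (allFin (size P))

    -- The subsets of the minimal edges of `T`, taken as sublists of all edges instead of sublists
    -- of `T`: they are then listed in the common order, and `∑ℤ-alternating` applies to `edges n`.
    minimals : Hypergraph n → List (Hypergraph n)
    minimals T = filter (All.all? (minEdge? d T)) (hypergraphs n)

    private
      ∈-above⁻ : ∀ {y} → y ∈ above → X ⊑ element y
      ∈-above⁻ {y} m = leq⁻ x y (proj₂ (∈-filterᵇ⁻ (leq P x) (allFin (size P)) m))

      ∈-minimals⁻ : ∀ T {A} → A ∈ minimals T → A ∈ hypergraphs n × All (MinEdge d T) A
      ∈-minimals⁻ T m = ∈-filter⁻ (All.all? (minEdge? d T)) {xs = hypergraphs n} m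

      left : List (Index × Hypergraph n)
      left = pairs above forests

      right : List (Hypergraph n × Hypergraph n)
      right = pairs (forests x) minimals

      -- Only a permutation can be required, since `T` is listed in the order of `edges n`.
      Matched : Index × Hypergraph n → Hypergraph n × Hypergraph n → Set
      Matched (y , T′) (T , A) = T ↭ A ++ T′ × X ⊑ element y × Blocks d A (element y ⊓ K X)

      -- A chord of `element y` separates the primed copies of its own two ends, so an edge with two
      -- vertices cannot lie both in a block of `element y` and in a block of its dual.
      apart : ∀ {y A T′} → Blocks d A (element y ⊓ K X) → Forest d T′ (K (element y)) → ∀ {E} → E ∈ A → ¬ E ∈ T′
      apart B F {E} m m′ with two-vertices E (block≥2 B E m)
      ... | a , b , a∈E , b∈E , a<b = side-separates {a = a} {b} (λ { refl → <-irrefl refl a<b })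
              (sameSide (proj₁ (spans F) (comp-edge m′ a∈E b∈E)) (fst (proj₂ (isBlock B E m a∈E) b∈E)))

      ++-⊆ : ∀ {T : List (Edge n)} A T′ → T ↭ A ++ T′ → ∀ {E} → E ∈ T → E ∈ A ⊎ E ∈ T′
      ++-⊆ A T′ p m = ∈-++⁻ A (∈-resp-↭ p m)

      forward : ∀ {p} → p ∈ left → ∃[ q ] Matched p q × q ∈ right
      forward {y , T′} m = (Tᵘ , Aᵘ) , (T↭ , x⊑y , Bᵘ) , ∈-pairs⁺ (∈-forests⁺ x (filter-∈-hypergraphs inT?) forestT)
          (∈-filter⁺ (All.all? (minEdge? d Tᵘ)) (filter-∈-hypergraphs (isBlock? d u)) (All.tabulate λ mA →
            ∈-resp-↭ (↭-sym T↭) (∈-++⁺ˡ mA) , glue-minimal d X gX T↭ (element y) (element-Good y) x⊑y Bᵘ F mA))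
        where
        m₁ = proj₁ (∈-pairs⁻ above m)
        m₂ = proj₂ (∈-pairs⁻ above m)
        x⊑y = ∈-above⁻ m₁
        hyp = proj₁ (∈-forests⁻ y m₂)
        F = proj₂ (∈-forests⁻ y m₂)
        u = element y ⊓ K X
        Aᵘ = blocksOf d u
        Bᵘ = blocksOf-Blocks d u
        inT? : (E : Edge n) → Dec (E ∈ Aᵘ ⊎ E ∈ T′)
        inT? E = (E ∈? Aᵘ) ⊎-dec (E ∈? T′)
        -- The union is listed anew in the order of `edges n`, which membership in `hypergraphs n`
        -- requires.
        Tᵘ = filter inT? (edges n)
        T↭ : Tᵘ ↭ Aᵘ ++ T′
        T↭ = unique-↭ (filter⁺ inT? (Unique-edges n)) (++⁺ (unique Bᵘ) (unique-hypergraph hyp) λ (a , b) → apart {y} Bᵘ F a b)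
          (λ mT → [ ∈-++⁺ˡ , ∈-++⁺ʳ Aᵘ ]′ (proj₂ (∈-filter⁻ inT? {xs = edges n} mT)))
          λ mAT → let s = ∈-++⁻ Aᵘ mAT in ∈-filter⁺ inT? ([ hypergraph-⊆ (filter-∈-hypergraphs (isBlock? d u)) , hypergraph-⊆ hyp ]′ s) s
        forestT : Forest d Tᵘ (K X)
        forestT = glue-forest d X gX T↭ (element y) (element-Good y) x⊑y Bᵘ F

      backward′ : ∀ {T A} → T ∈ hypergraphs n → Forest d T (K X) → A ∈ hypergraphs n → All (MinEdge d T) A →
                  ∃[ T′ ] T ↭ A ++ T′ × T′ ∈ hypergraphs n × ∃[ y ] X ⊑ element y × Blocks d A (element y ⊓ K X) × Forest d T′ (K (element y))
      backward′ {T} {A} hyp F hypA A-min = T′ , T↭ , filter-∈-hypergraphs inT′? , finish (element⁻¹ c (cut-Good d X gX T↭ uniqueA disjoint F minA))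
        where
        minA : ∀ {E} → E ∈ A → Minimal T E
        minA mE = proj₂ (All.lookup A-min mE)
        uniqueA : Unique A
        uniqueA = unique-hypergraph hypA
        inT′? : (E : Edge n) → Dec (E ∈ T × ¬ E ∈ A)
        inT′? E = (E ∈? T) ×-dec ¬? (E ∈? A)
        T′ : Hypergraph n
        T′ = filter inT′? (edges n)
        disjoint : ∀ {E} → E ∈ A → ¬ E ∈ T′
        disjoint mA mT′ = proj₂ (proj₂ (∈-filter⁻ inT′? {xs = edges n} mT′)) mA
        split : ∀ {E} → E ∈ T → E ∈ A ++ T′
        split {E} mT with E ∈? A
        ... | yes mA = ∈-++⁺ˡ mA
        ... | no ¬mA = ∈-++⁺ʳ A (∈-filter⁺ inT′? (hypergraph-⊆ hyp mT) (mT , ¬mA))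
        T↭ : T ↭ A ++ T′
        T↭ = unique-↭ (unique-hypergraph hyp) (++⁺ uniqueA (filter⁺ inT′? (Unique-edges n)) λ (a , b) → disjoint a b)
          split λ mAT → [ (λ mA → proj₁ (All.lookup A-min mA)) , (λ mT′ → proj₁ (proj₂ (∈-filter⁻ inT′? {xs = edges n} mT′))) ]′ (∈-++⁻ A mAT)
        c : Part n
        c = cut d X gX T↭ uniqueA disjoint F minA
        finish : (∃[ y ] element y ≗ c) → ∃[ y ] X ⊑ element y × Blocks d A (element y ⊓ K X) × Forest d T′ (K (element y))
        finish (y , y⊑c , c⊑y) = y , c⊑y ∘ join-⊒ˡ X (comp A) ,
          Blocks-≗ d (c ⊓ K X) (element y ⊓ K X) ((λ (p , k) → c⊑y p , k) , λ (p , k) → y⊑c p , k) (cut-blocks d X gX T↭ uniqueA disjoint F minA) ,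
          Forest-≗ d (K c) (K (element y)) (K-cong c (element y) (c⊑y , y⊑c)) (cut-forest d X gX T↭ uniqueA disjoint F minA)

      backward : ∀ {q} → q ∈ right → ∃[ p ] Matched p q × p ∈ left
      backward {T , A} m = pack (backward′ (proj₁ F) (proj₂ F) (proj₁ M) (proj₂ M))
        where
        F = ∈-forests⁻ x (proj₁ (∈-pairs⁻ (forests x) m))
        M = ∈-minimals⁻ T (proj₂ (∈-pairs⁻ (forests x) m))
        pack : (∃[ T′ ] T ↭ A ++ T′ × T′ ∈ hypergraphs n × ∃[ y ] X ⊑ element y × Blocks d A (element y ⊓ K X) × Forest d T′ (K (element y))) →
               ∃[ p ] Matched p (T , A) × p ∈ left
        pack (T′ , T↭ , hyp′ , y , x⊑y , blocks , F′) = (y , T′) , (T↭ , x⊑y , blocks) ,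
          ∈-pairs⁺ (∈-filterᵇ⁺ (leq P x) (∈-allFin y) (leq⁺ x y x⊑y)) (∈-forests⁺ y hyp′ F′)

      functional : ∀ {p q q′} → p ∈ left → q ∈ right → q′ ∈ right → Matched p q → Matched p q′ → q ≡ q′
      functional {y , T′} {T , A} {S , C} mp mq mq′ (T↭ , _ , B) (S↭ , _ , B′) = cong₂ _,_
        (hypergraph-ext (hyp mq) (hyp mq′) (transfer T↭ S↭ A⊆C) (transfer S↭ T↭ C⊆A))
        (hypergraph-ext (hypA mq) (hypA mq′) A⊆C C⊆A)
        where
        u = element y ⊓ K X
        A⊆C : ∀ {E} → E ∈ A → E ∈ C
        A⊆C = Blocks-⊆ d u B B′
        C⊆A : ∀ {E} → E ∈ C → E ∈ A
        C⊆A = Blocks-⊆ d u B′ B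
        hyp : ∀ {T A} → (T , A) ∈ right → T ∈ hypergraphs n
        hyp m = proj₁ (∈-forests⁻ x (proj₁ (∈-pairs⁻ (forests x) m)))
        hypA : ∀ {T A} → (T , A) ∈ right → A ∈ hypergraphs n
        hypA {T} m = proj₁ (∈-minimals⁻ T (proj₂ (∈-pairs⁻ (forests x) m)))
        transfer : ∀ {T S A C : List (Edge n)} → T ↭ A ++ T′ → S ↭ C ++ T′ → (∀ {E} → E ∈ A → E ∈ C) → ∀ {E} → E ∈ T → E ∈ S
        transfer {A = A} {C} T↭ S↭ h mT with ++-⊆ A T′ T↭ mT
        ... | inj₁ mA = ∈-resp-↭ (↭-sym S↭) (∈-++⁺ˡ (h mA))
        ... | inj₂ mT′ = ∈-resp-↭ (↭-sym S↭) (∈-++⁺ʳ C mT′)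

      -- The set `A` determines x⁻¹y and thereby `y`, by `complement-join`; and `T′` is what remains
      -- of `T` after removal of `A`, the two being disjoint.
      injective : ∀ {p p′ q} → p ∈ left → p′ ∈ left → q ∈ right → Matched p q → Matched p′ q → p ≡ p′
      injective {y , T′} {z , S′} {T , A} mp mp′ mq (T↭ , x⊑y , B) (T↭′ , x⊑z , B′) = cong₂ _,_
        (element-injective (sub y z x⊑y x⊑z B B′ , sub z y x⊑z x⊑y B′ B))
        (hypergraph-ext (hyp mp) (hyp mp′) (transfer T↭ T↭′ (apart {y} B (F mp))) (transfer T↭′ T↭ (apart {z} B′ (F mp′))))
        where
        F : ∀ {y T′} → (y , T′) ∈ left → Forest d T′ (K (element y))
        F {y} m = proj₂ (∈-forests⁻ y (proj₂ (∈-pairs⁻ above m)))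
        hyp : ∀ {y T′} → (y , T′) ∈ left → T′ ∈ hypergraphs n
        hyp {y} m = proj₁ (∈-forests⁻ y (proj₂ (∈-pairs⁻ above m)))
        sub : ∀ y z → X ⊑ element y → X ⊑ element z → Blocks d A (element y ⊓ K X) → Blocks d A (element z ⊓ K X) → element y ⊑ element z
        sub y z x⊑y x⊑z B B′ = join-⊑ X (element y ⊓ K X) (element z) x⊑z (fst ∘ Blocks-⊑ d (element y ⊓ K X) (element z ⊓ K X) B B′) ∘
          proj₂ (complement-join X (element y) (nc gX) (nc (element-Good y)) x⊑y)
        transfer : ∀ {T′ S′} → T ↭ A ++ T′ → T ↭ A ++ S′ → (∀ {E} → E ∈ A → ¬ E ∈ T′) → ∀ {E} → E ∈ T′ → E ∈ S′
        transfer {S′ = S′} T↭ T↭′ dis m with ++-⊆ A S′ T↭′ (∈-resp-↭ (↭-sym T↭) (∈-++⁺ʳ A m))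
        ... | inj₁ mA = ⊥-elim (dis mA m)
        ... | inj₂ mS′ = mS′

    module _ (φ : FinPoset → ℤ) (inv : IsoInvariant φ) where

      private
        leftTerm : Index × Hypergraph n → ℤ
        leftTerm (y , T′) = sign (length T′) *ᶻ φ (interval P x y ⊗ ∏ T′)

        rightTerm : Hypergraph n × Hypergraph n → ℤ
        rightTerm (T , A) = (sign (length T) *ᶻ φ (∏ T)) *ᶻ sign (length A)

        matchedTerms : ∀ {p q} → Matched p q → leftTerm p ≡ rightTerm q
        matchedTerms {y , T′} {T , A} (T↭ , x⊑y , B) = begin
          sign (length T′) *ᶻ φ (interval P x y ⊗ ∏ T′)
            ≡⟨ cong₂ _*ᶻ_ signs (inv _ _ (≅-trans (⊗-congˡ (∏ T′) (interval≅∏ x y x⊑y B)) (≅-trans (prodPosets-++ 𝒫ᵉ A T′) (prodPosets-↭ 𝒫ᵉ (↭-sym T↭))))) ⟩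
          (sign (length T) *ᶻ sign (length A)) *ᶻ φ (∏ T)
            ≡⟨ ℤₚ.*-assoc (sign (length T)) _ _ ⟩
          sign (length T) *ᶻ (sign (length A) *ᶻ φ (∏ T))
            ≡⟨ cong (λ z → sign (length T) *ᶻ z) (ℤₚ.*-comm (sign (length A)) _) ⟩
          sign (length T) *ᶻ (φ (∏ T) *ᶻ sign (length A))
            ≡⟨ ℤₚ.*-assoc (sign (length T)) _ _ ⟨
          (sign (length T) *ᶻ φ (∏ T)) *ᶻ sign (length A) ∎
          where
          open ≡-Reasoning
          signs : sign (length T′) ≡ sign (length T) *ᶻ sign (length A)
          signs = sym (begin
            sign (length T) *ᶻ sign (length A)                          ≡⟨ cong (λ k → sign k *ᶻ sign (length A)) (trans (↭-length T↭) (length-++ A)) ⟩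
            sign (length A + length T′) *ᶻ sign (length A)              ≡⟨ cong (_*ᶻ sign (length A)) (trans (sign-+ (length A) (length T′)) (ℤₚ.*-comm (sign (length A)) _)) ⟩
            (sign (length T′) *ᶻ sign (length A)) *ᶻ sign (length A)    ≡⟨ ℤₚ.*-assoc (sign (length T′)) _ _ ⟩
            sign (length T′) *ᶻ (sign (length A) *ᶻ sign (length A))    ≡⟨ cong (λ z → sign (length T′) *ᶻ z) (sign-square (length A)) ⟩
            sign (length T′) *ᶻ 1ℤ                                      ≡⟨ ℤₚ.*-identityʳ _ ⟩
            sign (length T′)                                            ∎)

      -- This is S * Id = ε evaluated at the interval [x , 1̂].
      fibre-sum : (∀ T → T ∈ forests x → ∃ (_∈ T)) → ∑ℤ (λ y → ∑ℤ (λ T′ → sign (length T′) *ᶻ φ (interval P x y ⊗ ∏ T′)) (forests y)) above ≡ 0ℤ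
      fibre-sum nonempty = begin
        ∑ℤ (λ y → ∑ℤ (λ T′ → leftTerm (y , T′)) (forests y)) above
          ≡⟨ ∑ℤ-pairs leftTerm above forests ⟨
        ∑ℤ leftTerm left
          ≡⟨ ∑ℤ-matching leftTerm rightTerm Matched
               (Unique-pairs (Unique-filterᵇ (leq P x) (allFin⁺ (size P))) Unique-forests)
               (Unique-pairs (Unique-forests x) λ T → filter⁺ (All.all? (minEdge? d T)) Unique-hypergraphs)
               forward backward functional injective (λ {p} {q} → matchedTerms {p} {q}) ⟩
        ∑ℤ rightTerm right
          ≡⟨ ∑ℤ-pairs rightTerm (forests x) minimals ⟩
        ∑ℤ (λ T → ∑ℤ (λ A → rightTerm (T , A)) (minimals T)) (forests x)
          ≡⟨ ∑ℤ-zero (forests x) vanish ⟩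
        0ℤ ∎
        where
        open ≡-Reasoning
        vanish : ∀ T → T ∈ forests x → ∑ℤ (λ A → rightTerm (T , A)) (minimals T) ≡ 0ℤ
        vanish T m with nonempty T m
        ... | E₀ , E₀∈T with exists-minimal d T (K X) (proj₂ (∈-forests⁻ x m)) E₀∈T
        ...   | E , E∈T , E-min = trans (∑ℤ-*ˡ (sign (length T) *ᶻ φ (∏ T)) (λ A → sign (length A)) (minimals T))
                (trans (cong ((sign (length T) *ᶻ φ (∏ T)) *ᶻ_) (∑ℤ-alternating (minEdge? d T) (edges n) (hypergraph-⊆ (proj₁ (∈-forests⁻ x m)) E∈T) (E∈T , E-min)))
                  (ℤₚ.*-zeroʳ (sign (length T) *ᶻ φ (∏ T))))

  forestSum : (FinPoset → ℤ) → Index → ℤ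
  forestSum φ x = ∑ℤ (λ T → sign (length T) *ᶻ φ (∏ T)) (forests x)

  private
    IsTop : Index → Set
    IsTop x = total ⊑ element x

    leq-refl : ∀ x → leq P x x ≡ true
    leq-refl x = leq⁺ x x id

    leq-antisym : ∀ {x y} → leq P x y ≡ true → leq P y x ≡ true → x ≡ y
    leq-antisym {x} {y} p q = element-injective (leq⁻ x y p , leq⁻ y x q)

    isTop⁺ : ∀ {x} → IsTop x → isTop x ≡ true
    isTop⁺ {x} top = allᶠ⁺ {size P} (λ z → leq P z x) λ z → leq⁺ z x λ _ → top tt

    1̂ : ∃[ t ] element t ≗ total {n}
    1̂ = element⁻¹ total (total-Good d d∣n∸1)
    0̂ : ∃[ b ] element b ≗ Δ {n}
    0̂ = element⁻¹ Δ (Δ-Good d d∣n∸1)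

    isTop⁻ : ∀ {x} → isTop x ≡ true → IsTop x
    isTop⁻ {x} h = leq⁻ (proj₁ 1̂) x (allᶠ⁻ {size P} (λ z → leq P z x) h (proj₁ 1̂)) ∘ proj₂ (proj₂ 1̂)

    rank-K-zero⇒top : ∀ {x} → rank (K (element x)) ≡ 0 → IsTop x
    rank-K-zero⇒top {x} eq = rank-≤⇒⊒ {x = element x} {total} (λ _ → tt) (≤-reflexive (trans (rank-total {n})
      (trans (sym (rank-K (element x) (nc (element-Good x)))) (trans (cong (rank (element x) +_) eq) (+-identityʳ _)))))

    Δ-rank : rank (Δ {n}) ≡ 0
    Δ-rank = #-none (nonMin? (Δ {n})) λ { i (j , j<i , refl) → <-irrefl refl j<i }

    nonempty : ∀ {x} → ¬ IsTop x → ∀ T → T ∈ forests x → ∃ (_∈ T)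
    nonempty {x} ¬top (E ∷ T) m = E , here refl
    nonempty {x} ¬top [] m = ⊥-elim (¬top (rank-K-zero⇒top (sym (weight≡rank (proj₂ (∈-forests⁻ x m))))))

    -- Here the dual is discrete and has rank 0, whereas every edge has weight at least 1.
    forests-top : ∀ {x} → IsTop x → forests x ↭ [] ∷ []
    forests-top {x} top = unique-↭ (Unique-forests x) ([] ∷ []) (λ {T} m → only T m) λ { (here refl) → ∈-forests⁺ x empty-∈ empty-forest }
      where
      Kx≗Δ : K (element x) ≗ Δ
      Kx≗Δ = ≗-trans (K (element x)) (K total) Δ (K-cong (element x) total ((λ _ → tt) , top)) (K-total d)
      rank-Kx : rank (K (element x)) ≡ 0
      rank-Kx = trans (rank-cong {x = K (element x)} {Δ} Kx≗Δ) Δ-rank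
      only : ∀ T → T ∈ forests x → T ∈ [] ∷ []
      only [] m = here refl
      only (E ∷ T) m = ⊥-elim (<⇒≱ (≤-trans (∸-monoˡ-≤ 1 (edge≥2 F E (here refl))) (m≤m+n (∣ E ∣ₑ ∸ 1) (weight T)))
          (≤-reflexive (trans (weight≡rank F) rank-Kx)))
        where F = proj₂ (∈-forests⁻ x m)
      empty-∈ : [] ∈ hypergraphs n
      empty-∈ = empty (edges n)
        where
        empty : ∀ {A : Set} (es : List A) → [] ∈ sublists es
        empty []       = here refl
        empty (e ∷ es) = ∈-++⁺ˡ (empty es)
      empty-forest : Forest d [] (K (element x))
      empty-forest = record
        { noncrossing = λ ()
        ; spans = (λ p → subst (λ j → K (element x) [ _ ~ j ]) (comp-least [] (isEquivalence Δ) (λ ()) p) (~refl (K (element x))))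
                , λ k → subst (λ j → comp [] [ _ ~ j ]) (proj₁ Kx≗Δ k) (~refl (comp []))
        ; weight≡rank = sym rank-Kx
        ; edgeSizes = λ _ ()
        ; edge≥2 = λ _ () }

    <ᴾ⁻ : ∀ {x y} → (x <ᴾ y) ≡ true → leq P x y ≡ true × x ≢ y
    <ᴾ⁻ {x} {y} h with ∧⁻ (leq P x y) h
    ... | le , neq = le , λ { refl → contradiction (trans (sym neq) (cong not (does⁺ (x ≟ᶠ x) refl))) λ () }

    <ᴾ⁺ : ∀ {x y} → leq P x y ≡ true → x ≢ y → (x <ᴾ y) ≡ true
    <ᴾ⁺ {x} {y} le x≢y = ∧⁺ le (distinct (x ≟ᶠ y))
      where
      distinct : (e : Dec (x ≡ y)) → not (does e) ≡ true
      distinct (yes eq) = ⊥-elim (x≢y eq)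
      distinct (no _) = refl

    -- Drops along every strict step, so it bounds the length of the chains from `x` and measures
    -- the fuel they need.
    above# : Index → ℕ
    above# x = # (λ y → (x <ᴾ y) Boolₚ.≟ true)

    above#-< : ∀ {x y} → (x <ᴾ y) ≡ true → above# y < above# x
    above#-< {x} {y} x<y = #-mono-< (λ z → (y <ᴾ z) Boolₚ.≟ true) (λ z → (x <ᴾ z) Boolₚ.≟ true) further y x<y λ y<y → proj₂ (<ᴾ⁻ {y} {y} y<y) refl
      where
      further : ∀ z → (y <ᴾ z) ≡ true → (x <ᴾ z) ≡ true
      further z y<z = <ᴾ⁺ {x} {z} (leq⁺ x z (leq⁻ y z (proj₁ (<ᴾ⁻ {y} {z} y<z)) ∘ leq⁻ x y (proj₁ (<ᴾ⁻ {x} {y} x<y))))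
        λ { refl → proj₂ (<ᴾ⁻ {x} {y} x<y) (leq-antisym (proj₁ (<ᴾ⁻ {x} {y} x<y)) (proj₁ (<ᴾ⁻ {y} {x} y<z))) }

    -- x⁻¹x has no nontrivial blocks, since a chord of `x` separates the primed copies of its ends;
    -- thus `[x , x]` is the empty product.
    trivial-interval : ∀ x φ → IsoInvariant φ → forestSum (λ Q → φ (interval P x x ⊗ Q)) x ≡ forestSum φ x
    trivial-interval x φ inv = ∑ℤ-cong (forests x) λ T _ → cong (λ z → sign (length T) *ᶻ z)
      (inv _ _ (≅-trans (⊗-congˡ (∏ T) (interval≅∏ x x id no-blocks)) (prodPosets-++ 𝒫ᵉ [] T)))
      where
      no-blocks : Blocks d [] (element x ⊓ K (element x))
      no-blocks = record { unique = [] ; isBlock = λ _ () ; block≥2 = λ _ ()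
                         ; cover = λ (p , k) i≢j → ⊥-elim (side-separates i≢j (sameSide k p)) }

  -- Below the top, `fibre-sum` expresses its term at `y = x`, which is `forestSum φ x`, as the
  -- negative of the terms at larger `y`; this is the recursion of `chainSum-suc`. Quantifying over
  -- φ lets the induction hypothesis be used for the invariants `φ′ y`.
  chainSum≡forestSum : ∀ fuel x → above# x ≤ fuel → ∀ φ → IsoInvariant φ → chainSum φ fuel x ≡ forestSum φ x
  chainSum≡forestSum fuel x le φ inv with isTop x Boolₚ.≟ true
  ... | yes top = trans (chainSum-top fuel) (sym (trans (∑ℤ-↭ _ (forests-top {x} (isTop⁻ {x} top))) (trans (ℤₚ.+-identityʳ _) (ℤₚ.*-identityˡ (φ unitPoset)))))
    where
    nothing-above : ∀ y → (x <ᴾ y) ≡ false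
    nothing-above y with x <ᴾ y in eq
    ... | false = refl
    ... | true = ⊥-elim (proj₂ (<ᴾ⁻ {x} {y} eq) (leq-antisym (proj₁ (<ᴾ⁻ {x} {y} eq)) (allᶠ⁻ {size P} (λ z → leq P z x) top y)))
    chainSum-top : ∀ fuel → chainSum φ fuel x ≡ φ unitPoset
    chainSum-top zero = trans (chainSum-zero φ x) (cong (λ b → when b (φ unitPoset)) top)
    chainSum-top (suc f) = trans (chainSum-suc φ f x) (trans (cong₂ _+ᶻ_ (cong (λ b → when b (φ unitPoset)) top)
      (∑ℤ-zero (allFin (size P)) λ y _ → cong (λ b → when b (- chainSum (λ Q → φ (interval P x y ⊗ Q)) f y)) (nothing-above y))) (ℤₚ.+-identityʳ _))
  chainSum≡forestSum zero x le φ inv | no ¬top = ⊥-elim (<⇒≱ (#-pos) le)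
    where
    t = proj₁ 1̂
    x<t : (x <ᴾ t) ≡ true
    x<t = <ᴾ⁺ {x} {t} (leq⁺ x t λ _ → proj₂ (proj₂ 1̂) tt) λ { refl → ¬top (isTop⁺ {t} (proj₂ (proj₂ 1̂))) }
    #-pos : 1 ≤ above# x
    #-pos = ≤-trans (≤-reflexive (sym (𝟙-yes ((x <ᴾ t) Boolₚ.≟ true) x<t))) (∈⇒≤∑ (λ y → 𝟙 ((x <ᴾ y) Boolₚ.≟ true)) (∈-allFin t))
  chainSum≡forestSum (suc f) x le φ inv | no ¬top = begin
    chainSum φ (suc f) x
      ≡⟨ chainSum-suc φ f x ⟩
    when (isTop x) (φ unitPoset) +ᶻ ∑ℤ (λ y → when (x <ᴾ y) (- chainSum (φ′ y) f y)) (allFin (size P))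
      ≡⟨ cong₂ _+ᶻ_ (cong (λ b → when b (φ unitPoset)) (not-top (isTop x) ¬top)) (∑ℤ-cong (allFin (size P)) λ y _ → recursive y) ⟩
    0ℤ +ᶻ ∑ℤ (λ y → - strictTerm y) (allFin (size P))
      ≡⟨ trans (ℤₚ.+-identityˡ _) (∑ℤ-neg strictTerm (allFin (size P))) ⟩
    - ∑ℤ strictTerm (allFin (size P))
      ≡⟨ opposite (forestSum φ x) (∑ℤ strictTerm (allFin (size P))) balance ⟩
    forestSum φ x ∎
    where
    open ≡-Reasoning
    φ′ : Index → FinPoset → ℤ
    φ′ y Q = φ (interval P x y ⊗ Q)
    inv′ : ∀ y → IsoInvariant (φ′ y)
    inv′ y Q Q′ iso = inv _ _ (⊗-congʳ (interval P x y) iso)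
    strictTerm : Index → ℤ
    strictTerm y = when (x <ᴾ y) (forestSum (φ′ y) y)
    not-top : ∀ b → ¬ b ≡ true → b ≡ false
    not-top true  h = ⊥-elim (h refl)
    not-top false h = refl
    recursive : ∀ y → when (x <ᴾ y) (- chainSum (φ′ y) f y) ≡ - strictTerm y
    recursive y with x <ᴾ y in eq
    ... | false = refl
    ... | true  = cong -_ (chainSum≡forestSum f y (≤-pred (≤-trans (above#-< {x} {y} eq) le)) (φ′ y) (inv′ y))
    opposite : ∀ a b → a +ᶻ b ≡ 0ℤ → - b ≡ a
    opposite a b eq = trans (sym (ℤₚ.+-identityˡ (- b))) (trans (cong (_+ᶻ (- b)) (sym eq))
      (trans (ℤₚ.+-assoc a b (- b)) (trans (cong (λ z → a +ᶻ z) (ℤₚ.+-inverseʳ b)) (ℤₚ.+-identityʳ a))))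
    pointwise : ∀ y → when (leq P x y) (forestSum (φ′ y) y) ≡ when (does (y ≟ᶠ x)) (forestSum (φ′ y) y) +ᶻ strictTerm y
    pointwise y with y ≟ᶠ x
    ... | yes refl = trans (cong (λ b → when b (forestSum (φ′ x) x)) (leq-refl x))
            (sym (trans (cong (λ b → forestSum (φ′ x) x +ᶻ when b (forestSum (φ′ x) x)) (not-top (x <ᴾ x) λ x<x → proj₂ (<ᴾ⁻ {x} {x} x<x) refl)) (ℤₚ.+-identityʳ _)))
    ... | no y≢x = trans (cong (λ b → when b (forestSum (φ′ y) y)) (≡-iff (λ le → <ᴾ⁺ {x} {y} le (y≢x ∘ sym)) (λ lt → proj₁ (<ᴾ⁻ {x} {y} lt))))
            (sym (ℤₚ.+-identityˡ _))
    balance : forestSum φ x +ᶻ ∑ℤ strictTerm (allFin (size P)) ≡ 0ℤ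
    balance = begin
      forestSum φ x +ᶻ ∑ℤ strictTerm (allFin (size P))
        ≡⟨ cong (_+ᶻ ∑ℤ strictTerm (allFin (size P))) (trans (sym (trivial-interval x φ inv)) (sym (∑ℤ-single (λ y → forestSum (φ′ y) y) x (allFin⁺ (size P)) (∈-allFin x)))) ⟩
      ∑ℤ (λ y → when (does (y ≟ᶠ x)) (forestSum (φ′ y) y)) (allFin (size P)) +ᶻ ∑ℤ strictTerm (allFin (size P))
        ≡⟨ ∑ℤ-+ (λ y → when (does (y ≟ᶠ x)) (forestSum (φ′ y) y)) strictTerm (allFin (size P)) ⟨
      ∑ℤ (λ y → when (does (y ≟ᶠ x)) (forestSum (φ′ y) y) +ᶻ strictTerm y) (allFin (size P))
        ≡⟨ ∑ℤ-cong (allFin (size P)) (λ y _ → sym (pointwise y)) ⟩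
      ∑ℤ (λ y → when (leq P x y) (forestSum (φ′ y) y)) (allFin (size P))
        ≡⟨ ∑ℤ-filter (Boolₚ.T? ∘ leq P x) (λ y → forestSum (φ′ y) y) (allFin (size P)) ⟨
      ∑ℤ (λ y → forestSum (φ′ y) y) (Fibre.above x)
        ≡⟨ Fibre.fibre-sum x φ inv (nonempty {x} (¬top ∘ isTop⁺ {x})) ⟩
      0ℤ ∎

  antipode≈hypertrees : antipode P ≈P map (λ T → sign (length T) , ∏ T) (ncHypertrees n d)
  antipode≈hypertrees φ inv = begin
    evalSum φ (antipode P)
      ≡⟨ evalSum-antipode φ ⟩
    ∑ℤ (λ x → when (isBot x) (chainSum φ (size P) x)) (allFin (size P))
      ≡⟨ ∑ℤ-cong (allFin (size P)) (λ x _ → cong (λ b → when b (chainSum φ (size P) x)) (isBot≡ x)) ⟩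
    ∑ℤ (λ x → when (does (x ≟ᶠ b)) (chainSum φ (size P) x)) (allFin (size P))
      ≡⟨ ∑ℤ-single (chainSum φ (size P)) b (allFin⁺ (size P)) (∈-allFin b) ⟩
    chainSum φ (size P) b
      -- The fuel `size P` is enough, as at most all elements of `P` lie strictly above `b`.
      ≡⟨ chainSum≡forestSum (size P) b (≤-trans (#-mono (λ y → (b <ᴾ y) Boolₚ.≟ true) (λ _ → yes tt) λ _ _ → tt) (≤-reflexive (#-all {size P} (λ _ → yes tt) λ _ → tt))) φ inv ⟩
    forestSum φ b
      ≡⟨ ∑ℤ-↭ term (unique-↭ (Unique-forests b) (Unique-filterᵇ (isNCHypertree d) Unique-hypergraphs) to from) ⟩
    ∑ℤ term (ncHypertrees n d)
      ≡⟨ ∑ℤ-map (λ t → proj₁ t *ᶻ φ (proj₂ t)) (λ T → sign (length T) , ∏ T) (ncHypertrees n d) ⟨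
    ∑ℤ (λ t → proj₁ t *ᶻ φ (proj₂ t)) (map (λ T → sign (length T) , ∏ T) (ncHypertrees n d))
      ≡⟨ evalSum≡∑ℤ φ (map (λ T → sign (length T) , ∏ T) (ncHypertrees n d)) ⟨
    evalSum φ (map (λ T → sign (length T) , ∏ T) (ncHypertrees n d)) ∎
    where
    open ≡-Reasoning
    b = proj₁ 0̂
    term : Hypergraph n → ℤ
    term T = sign (length T) *ᶻ φ (∏ T)
    b-least : ∀ z → leq P b z ≡ true
    b-least z = leq⁺ b z λ p → subst (λ j → element z [ _ ~ j ]) (proj₁ (proj₂ 0̂) p) (~refl (element z))
    isBot≡ : ∀ x → isBot x ≡ does (x ≟ᶠ b)
    isBot≡ x = ≡-iff (λ h → does⁺ (x ≟ᶠ b) (leq-antisym (allᶠ⁻ {size P} (leq P x) h b) (b-least x)))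
                     (λ h → allᶠ⁺ {size P} (leq P x) λ z → subst (λ w → leq P w z ≡ true) (sym (does⁻ (x ≟ᶠ b) h)) (b-least z))
    K-b : K (element b) ≗ total
    K-b = ≗-trans (K (element b)) (K Δ) total (K-cong (element b) Δ (proj₂ 0̂)) (K-Δ d)
    to : ∀ {T} → T ∈ forests b → T ∈ ncHypertrees n d
    to m = let (hyp , F) = ∈-forests⁻ b m in ∈-filterᵇ⁺ (isNCHypertree d) hyp (isNCHypertree⁺ d (Forest-≗ d (K (element b)) total K-b F))
    from : ∀ {T} → T ∈ ncHypertrees n d → T ∈ forests b
    from m = let (hyp , h) = ∈-filterᵇ⁻ (isNCHypertree d) (hypergraphs n) m in
      ∈-forests⁺ b hyp (Forest-≗ d total (K (element b)) (≗-sym {x = K (element b)} {total} K-b) (isNCHypertree⁻ d hyp h))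

theorem6p2 : (n d : ℕ) → 1 ≤ n → 1 ≤ d → d ∣ (n ∸ 1) →
    antipode (NCd n d) ≈P hypertreeSum n d
theorem6p2 n d _ _ d∣n∸1 = Antipode.antipode≈hypertrees d (λ k → indivisibleNCs k d) (Unique-indivisibleNCs d)
  (∈-indivisibleNCs⁻ d) (∈-indivisibleNCs⁺ d) {n} d∣n∸1
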